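{- Let $r\ge 2$ be an integer and put $m=3\cdot 2^r$. For every $n\ge 0$, \[ \nu_2(t_m(n))=\nu_2\binom{n+m-1}{m-1}. \]
   Context: Let $T(x)=\prod_{j\ge 0}(1-x^{2^j})\in\mathbb Z[[x]]$ be the Thue--Morse generating function, and for each integer $m\ge 1$ define the integers $t_m(n)$ by $T(x)^m=\sum_{n\ge 0}t_m(n)x^n$. For a nonzero integer $a$, $\nu_2(a)$ is the largest integer $v$ such that $2^v$ divides $a$, and $\nu_2(0)=+\infty$. -}

module Defs where

open import Data.Bool.Base using (if_then_else_)
open import Data.Fin.Base using (Fin; toℕ)
open import Data.Fin.Properties using (toℕ<n)
open import Data.Integer.Base as ℤ using (ℤ; +_; +0; +[1+_]; -[1+_]; 0ℤ; 1ℤ; ∣_∣)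
import Data.Integer.Divisibility as ℤ
import Data.Integer.Properties as ℤ
open import Data.Nat.Base
open import Data.Nat.Divisibility using (_∣?_; ∣⇒≤; 1∣_)
open import Data.Nat.Properties
open import Data.Product.Base using (∃; _×_; _,_; proj₁; proj₂)
open import Relation.Binary.PropositionalEquality
open import Relation.Nullary using (does; yes; no; contradiction)
open import Relation.Nullary.Decidable using (dec-false)
open import Relation.Nullary.Construct.Add.Supremum using (_⁺; ⊤⁺; [_])
open import Relation.Unary using (Pred; Decidable)

open import Algebra.Properties.CommutativeMonoid.Sum ℤ.+-0-commutativeMonoid
  using (sum; sum⁺-syntax; sum-cong-≗; sum-replicate-zero)

-- Formal power series over ℤ, as coefficient sequences.
ℤ⟦x⟧ : Set
ℤ⟦x⟧ = ℕ → ℤ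

infixl 6 _⊖_
infixl 7 _⊛_
infixr 8 _^ᵖ_

x^_ : ℕ → ℤ⟦x⟧
(x^ k) n = if does (n ≟ k) then 1ℤ else 0ℤ

𝟙 : ℤ⟦x⟧
𝟙 = x^ 0

_⊖_ : ℤ⟦x⟧ → ℤ⟦x⟧ → ℤ⟦x⟧
(f ⊖ g) n = f n ℤ.- g n

_⊛_ : ℤ⟦x⟧ → ℤ⟦x⟧ → ℤ⟦x⟧
(f ⊛ g) n = ∑[ i ≤ n ] (f (toℕ i) ℤ.* g (n ∸ toℕ i))

_^ᵖ_ : ℤ⟦x⟧ → ℕ → ℤ⟦x⟧
f ^ᵖ zero  = 𝟙
f ^ᵖ suc m = f ⊛ f ^ᵖ m

factor : ℕ → ℤ⟦x⟧
factor j = 𝟙 ⊖ x^ (2 ^ j)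

partialProduct : ℕ → ℤ⟦x⟧
partialProduct zero    = 𝟙
partialProduct (suc J) = factor J ⊛ partialProduct J

-- Since n < 2 ^ n, the factors with j ≥ n do not affect the coefficient
-- of xⁿ; T-limit below shows that T is the limit of the partial products.
T : ℤ⟦x⟧
T n = partialProduct n n

t : ℕ → ℕ → ℤ
t m n = (T ^ᵖ m) n

n<2^n : ∀ n → n < 2 ^ n
n<2^n zero    = s≤s z≤n
n<2^n (suc n) = begin-strict
  suc n                 ≤⟨ n<2^n n ⟩
  2 ^ n                 <⟨ m<m+n (2 ^ n) (m^n>0 2 n) ⟩
  2 ^ n + 2 ^ n         ≡⟨ cong (λ k → 2 ^ n + k) (+-identityʳ (2 ^ n)) ⟨
  2 ^ suc n             ∎
  where open ≤-Reasoning

x^-vanishes : ∀ {k n} → n ≢ k → (x^ k) n ≡ 0ℤ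
x^-vanishes {k} {n} n≢k =
  cong (if_then 1ℤ else 0ℤ) (dec-false (n ≟ k) n≢k)

factor-vanishes : ∀ j {n} → suc n < 2 ^ j → factor j (suc n) ≡ 0ℤ
factor-vanishes j lt rewrite x^-vanishes (<⇒≢ lt) = refl

factor-constant : ∀ j → 0 < 2 ^ j → factor j 0 ≡ 1ℤ
factor-constant j lt rewrite x^-vanishes (<⇒≢ lt) = refl

partialProduct-step : ∀ J n → n < 2 ^ J →
                      partialProduct (suc J) n ≡ partialProduct J n
partialProduct-step J n n<2^J = begin
  factor J 0 ℤ.* P n ℤ.+ sum tail  ≡⟨ cong₂ (λ c s → c ℤ.* P n ℤ.+ s)
                                        (factor-constant J (m^n>0 2 J)) tail≡0 ⟩
  1ℤ ℤ.* P n ℤ.+ 0ℤ                ≡⟨ ℤ.+-identityʳ _ ⟩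
  1ℤ ℤ.* P n                       ≡⟨ ℤ.*-identityˡ (P n) ⟩
  P n                              ∎
  where
  open ≡-Reasoning
  P : ℤ⟦x⟧
  P = partialProduct J
  tail : Fin n → ℤ
  tail i = factor J (suc (toℕ i)) ℤ.* P (n ∸ suc (toℕ i))
  tail≡0 : sum tail ≡ 0ℤ
  tail≡0 = trans
    (sum-cong-≗ λ i → cong (ℤ._* P (n ∸ suc (toℕ i)))
      (factor-vanishes J (≤-<-trans (toℕ<n i) n<2^J)))
    (sum-replicate-zero n)

T-limit : ∀ n J → n ≤ J → partialProduct J n ≡ T n
T-limit n J n≤J = go (≤⇒≤′ n≤J)
  where
  go : ∀ {J} → n ≤′ J → partialProduct J n ≡ T n
  go (≤′-reflexive refl) = refl
  go {suc J} (≤′-step n≤′J) =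
    trans (partialProduct-step J n (≤-<-trans (≤′⇒≤ n≤′J) (n<2^n J))) (go n≤′J)

-- The largest v ≤ b satisfying P, or 0 if there is none.
largest : ∀ {p} {P : Pred ℕ p} → Decidable P → ℕ → ℕ
largest P? zero    = 0
largest P? (suc b) = if does (P? (suc b)) then suc b else largest P? b

-- If 2 ^ v divides a ≠ 0 then v < 2 ^ v ≤ ∣ a ∣, so searching up to ∣ a ∣
-- suffices; see ν₂-spec.
ν₂ : ℤ → ℕ ⁺
ν₂ +0           = ⊤⁺
ν₂ a@(+[1+ _ ]) = [ largest (λ v → 2 ^ v ∣? ∣ a ∣) ∣ a ∣ ]
ν₂ a@(-[1+ _ ]) = [ largest (λ v → 2 ^ v ∣? ∣ a ∣) ∣ a ∣ ]

largest-spec : ∀ {p} {P : Pred ℕ p} (P? : Decidable P) → P 0 → ∀ b →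
               P (largest P? b) × (∀ w → w ≤ b → P w → w ≤ largest P? b)
largest-spec P? P0 zero = P0 , λ _ w≤0 _ → w≤0
largest-spec {P = P} P? P0 (suc b) with P? (suc b)
... | yes Pb = Pb , λ _ w≤b _ → w≤b
... | no ¬Pb = proj₁ ih , max
  where
  ih = largest-spec P? P0 b
  max : ∀ w → w ≤ suc b → P w → w ≤ largest P? b
  max w w≤1+b Pw = proj₂ ih w
    (s≤s⁻¹ (≤∧≢⇒< w≤1+b λ w≡1+b → ¬Pb (subst P w≡1+b Pw))) Pw

ν₂-spec : ∀ a → a ≢ 0ℤ →
          ∃ λ v → ν₂ a ≡ [ v ] × + (2 ^ v) ℤ.∣ a ×
                  (∀ w → + (2 ^ w) ℤ.∣ a → w ≤ v)
ν₂-spec +0 a≢0 = contradiction refl a≢0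
ν₂-spec a@(+[1+ _ ]) _ with largest-spec (λ v → 2 ^ v ∣? ∣ a ∣) (1∣ ∣ a ∣) ∣ a ∣
... | divs , max = _ , refl , divs , λ w d →
  max w (≤-trans (<⇒≤ (n<2^n w)) (∣⇒≤ d)) d
ν₂-spec a@(-[1+ _ ]) _ with largest-spec (λ v → 2 ^ v ∣? ∣ a ∣) (1∣ ∣ a ∣) ∣ a ∣
... | divs , max = _ , refl , divs , λ w d →
  max w (≤-trans (<⇒≤ (n<2^n w)) (∣⇒≤ d)) d

{-# OPTIONS --safe #-}
-- Put V = (1 - x)ᵐ Tᵐ, ƛ = (1 - x)/(1 + x) and b(n) = C(n + m - 1, m - 1), the
-- coefficients of (1 - x)⁻ᵐ.  Then V(x) = ƛ(x)ᵐ V(x²), and ƛᵐ ≡ 1 modulo 2ʳ⁺¹,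
-- so that V ≡ 1 and tₘ(n) ≡ b(n) modulo 2ʳ⁺¹.  This settles every n for which
-- 2ʳ⁺¹ ∤ b(n), in particular every n with n mod 2ʳ⁺² ≤ 2ʳ.
--
-- For the other n some n + j with 0 < j < m is a multiple 2ᴷN of 2ʳ⁺², N odd.
-- With θ = x d/dx, a multiple of xʲ Tᵐ can be written as θG · V, where
-- (1 - x)ᵐ⁻¹ G is the truncation of (1 - x)ᵐ⁻¹ below xʲ.  If U extracts the even
-- coefficients, then U(θG · V) = U(ƛᵐ θG) · V, and up to an odd factor
-- U(ƛᵐ θG) = 2 θG′ with G′ ≡ U G modulo 2.  This step needs (1 - x)ᵐ⁻¹ G to be a
-- polynomial of degree < m whose coefficients in degrees 2ʳ, …, 2ʳ⁺¹ - 1 have an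
-- even sum, a property which G′ inherits as soon as r ≥ 2.  After K steps, up to
-- odd factors, κ tₘ(n) = 2ᴷ (N G(2ᴷN) + even), while κ b(n) = 2ᴷ N G(2ᴷN) with
-- the same κ, and G(2ᴷN) is odd.
module Submission where

-- The high powers of two in b(n) near a multiple of 2ʳ⁺² are produced by Uθ = 2θU; hence the form
-- θG · V, and the demand that each halving return some θG′ with G′ integral. The obstacle is that
-- ƛᵐ is not constant: ƛᵐ θG differs from θ(ƛᵐ G) by 2m x P (1 + x)⁻ᵐ⁻¹, where P = (1 - x)ᵐ⁻¹ G, and
-- this has to be divided by the degree. For each coefficient P(i) separately, the division succeeds
-- after multiplication by C(m - 1, i), which is odd in the outer thirds of 0, ..., m - 1 and twice
-- an odd number in the middle third. So there is an odd c for which every C(m - 1, i) divides 2c.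
-- In the outer thirds a factor 2 is left over and the correction is even. In the middle third none
-- is left over, but the surviving parities do not depend on i, so it is enough that the middle
-- coefficients of P have an even sum. This condition passes to G′ by means of a spare power (1 -
-- x)^(2ʳ - 3), whence r ≥ 2.

open import Defs
open import Algebra.Bundles using (CommutativeRing)
open import Algebra.Solver.Ring.AlmostCommutativeRing
  using (_-Raw-AlmostCommutative⟶_; fromCommutativeRing)
open import Data.Nat.Base
  using (ℕ; zero; suc; _+_; _∸_; _*_; _^_; _≤_; _<_; z≤n; s≤s; NonZero; _/_; _%_)
open import Data.Nat.Combinatorics
  using (_C_; k>n⇒nCk≡0; nCk+nC[k+1]≡[n+1]C[k+1]; nCk≡nC[n∸k]; nCn≡1)
import Data.Nat.Divisibility as ℕ
import Data.Nat.DivMod as ℕ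
open import Data.Nat.Induction using (<-rec)
import Data.Nat.Properties as ℕ
import Data.Nat.Tactic.RingSolver as ℕ-solver
import Data.Maybe.Base as Maybe
open import Data.Product.Base using (∃; _×_; _,_; proj₁; proj₂)
open import Data.Sum.Base using (_⊎_; inj₁; inj₂; [_,_]′)
open import Function.Base using (_∘_)
open import Level using (0ℓ)
open import Relation.Binary.Bundles using (Setoid)
open import Relation.Binary.Definitions using (tri<; tri≈; tri>)
open import Relation.Binary.PropositionalEquality
import Relation.Binary.Reasoning.Setoid as SetoidReasoning
open import Relation.Nullary using (¬_; Dec; yes; no; contradiction)
open import Relation.Nullary.Construct.Add.Supremum using ([_])
open import Relation.Nullary.Decidable using (dec⇒maybe; from-no)

-- Divisibility of binomial coefficients by powers of 2.

module Binomials where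

  open import Data.Nat.Base
  open import Data.Nat.Combinatorics
    using (nCk≡n!/k![n-k]!; k>n⇒nCk≡0; nCk+nC[k+1]≡[n+1]C[k+1]; nCk≡nC[n∸k]; k![n∸k]!∣n!)
  open import Data.Nat.Divisibility
  open import Data.Nat.DivMod using (m/n*n≡m)
  open import Data.Nat.Primality using (euclidsLemma; prime[2])
  open import Data.Nat.Properties
  open import Data.Nat.Tactic.RingSolver using (solve-∀)

  Odd : ℕ → Set
  Odd n = ¬ 2 ∣ n

  odd-* : ∀ {a b} → Odd a → Odd b → Odd (a * b)
  odd-* {a} {b} odd-a odd-b 2∣ab = [ odd-a , odd-b ]′ (euclidsLemma a b prime[2] 2∣ab)

  2∣⊎2∣suc : ∀ n → 2 ∣ n ⊎ 2 ∣ suc n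
  2∣⊎2∣suc zero    = inj₁ (2 ∣0)
  2∣⊎2∣suc (suc n) = [ (λ 2∣n → inj₂ (∣m∣n⇒∣m+n ∣-refl 2∣n)) , inj₁ ]′ (2∣⊎2∣suc n)

  2^-mono-∣ : ∀ {s t} → s ≤ t → 2 ^ s ∣ 2 ^ t
  2^-mono-∣ {s} s≤t with m≤n⇒∃[o]m+o≡n s≤t
  ... | o , refl = subst (2 ^ s ∣_) (sym (^-distribˡ-+-* 2 s o)) (m∣m*n (2 ^ o))

  -- The first hypothesis says that 2 divides x at most s times.
  2^-cancel : ∀ s t {x y} → ¬ 2 ^ suc s ∣ x → 2 ^ (s + t) ∣ x * y → 2 ^ t ∣ y
  2^-cancel-odd : ∀ t {x y} → Odd x → 2 ^ t ∣ x * y → 2 ^ t ∣ y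

  2^-cancel-odd zero    odd-x d = 1∣ _
  2^-cancel-odd (suc t) {x} {y} odd-x d with euclidsLemma x y prime[2] (∣-trans (m∣m*n (2 ^ t)) d)
  ... | inj₁ 2∣x = contradiction 2∣x odd-x
  ... | inj₂ (divides y′ refl) = subst (2 ^ suc t ∣_) (*-comm 2 y′)
    (*-monoʳ-∣ 2 (2^-cancel-odd t {x} odd-x (*-cancelˡ-∣ 2 (subst (2 ^ suc t ∣_) (pull x y′) d))))
    where
    pull : ∀ x y → x * (y * 2) ≡ 2 * (x * y)
    pull = solve-∀

  2^-cancel s t {x} {y} 2^∤x d with 2 ∣? x
  ... | no odd-x = 2^-cancel-odd t odd-x (∣-trans (2^-mono-∣ (m≤n+m t s)) d)
  2^-cancel zero    t 2^∤x d | yes 2∣x = contradiction 2∣x 2^∤x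
  2^-cancel (suc s) t {y = y} 2^∤x d | yes (divides x refl) =
    2^-cancel s t {x} (λ 2^∣x → 2^∤x (subst (2 ^ suc (suc s) ∣_) (*-comm 2 x) (*-monoʳ-∣ 2 2^∣x)))
                  (*-cancelˡ-∣ 2 (subst (2 ^ suc (s + t) ∣_) (pull x y) d))
    where
    pull : ∀ x y → x * 2 * y ≡ 2 * (x * y)
    pull = solve-∀

  m≤n⇒∃[o]o+m≡n : ∀ {m n} → m ≤ n → ∃ λ o → o + m ≡ n
  m≤n⇒∃[o]o+m≡n {m} m≤n with m≤n⇒∃[o]m+o≡n m≤n
  ... | o , m+o≡n = o , trans (+-comm o m) m+o≡n

  C-factorial : ∀ a b → ((a + b) C b) * (a ! * b !) ≡ (a + b) !
  C-factorial a b = begin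
    ((a + b) C b) * (a ! * b !)
      ≡⟨ cong (((a + b) C b) *_) (trans (*-comm (a !) (b !)) (cong (λ k → b ! * k !) (sym (m+n∸n≡m a b)))) ⟩
    ((a + b) C b) * (b ! * (a + b ∸ b) !)
      ≡⟨ cong (_* (b ! * (a + b ∸ b) !)) (nCk≡n!/k![n-k]! (m≤n+m b a)) ⟩
    ((a + b) ! / (b ! * (a + b ∸ b) !)) * (b ! * (a + b ∸ b) !)
      ≡⟨ m/n*n≡m (k![n∸k]!∣n! (m≤n+m b a)) ⟩
    (a + b) ! ∎
    where
    open ≡-Reasoning
    instance _ = b !* (a + b ∸ b) !≢0

  C-absorb : ∀ n k → suc k * (suc n C suc k) ≡ suc n * (n C k)
  C-absorb n k with k ≤? n
  ... | no k≰n = trans (cong (suc k *_) (k>n⇒nCk≡0 (s≤s (≰⇒> k≰n))))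
    (trans (*-zeroʳ (suc k)) (sym (trans (cong (suc n *_) (k>n⇒nCk≡0 (≰⇒> k≰n))) (*-zeroʳ (suc n)))))
  ... | yes k≤n with m≤n⇒∃[o]o+m≡n k≤n
  ... | a , refl = *-cancelʳ-≡ _ _ (a ! * k !) {{m*n≢0 (a !) (k !) {{a !≢0}} {{k !≢0}}}} (begin
    suc k * (suc (a + k) C suc k) * (a ! * k !)
      ≡⟨ move (suc k) (suc (a + k) C suc k) (a !) (k !) ⟩
    (suc (a + k) C suc k) * (a ! * (suc k) !)
      ≡⟨ cong (λ n → (n C suc k) * (a ! * (suc k) !)) (+-suc a k) ⟨
    ((a + suc k) C suc k) * (a ! * (suc k) !)
      ≡⟨ C-factorial a (suc k) ⟩
    (a + suc k) !
      ≡⟨ cong _! (+-suc a k) ⟩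
    suc (a + k) * (a + k) !
      ≡⟨ cong (suc (a + k) *_) (C-factorial a k) ⟨
    suc (a + k) * (((a + k) C k) * (a ! * k !))
      ≡⟨ *-assoc (suc (a + k)) ((a + k) C k) (a ! * k !) ⟨
    suc (a + k) * ((a + k) C k) * (a ! * k !) ∎)
    where
    open ≡-Reasoning
    move : ∀ s c x y → s * c * (x * y) ≡ c * (x * (s * y))
    move = solve-∀

  C-absorb-top : ∀ a k → suc k * ((suc a + k) C suc k) ≡ suc a * ((suc a + k) C k)
  C-absorb-top a k = begin
    suc k * ((suc a + k) C suc k)
      ≡⟨ C-absorb (a + k) k ⟩
    suc (a + k) * ((a + k) C k)
      ≡⟨ cong (suc (a + k) *_) (trans (nCk≡nC[n∸k] (m≤n+m k a)) (cong ((a + k) C_) (m+n∸n≡m a k))) ⟩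
    suc (a + k) * ((a + k) C a)
      ≡⟨ C-absorb (a + k) a ⟨
    suc a * ((suc a + k) C suc a)
      ≡⟨ cong (suc a *_) (trans (nCk≡nC[n∸k] (m≤m+n (suc a) k)) (cong ((suc a + k) C_) (m+n∸m≡n (suc a) k))) ⟩
    suc a * ((suc a + k) C k) ∎
    where open ≡-Reasoning

  -- Both sides equal (a + i + d + 1)! / (a! i! d!), as `C-factorial` shows after multiplication by
  -- the denominator.
  C-exchange : ∀ a i d → let m = i + suc d ; n = a + suc i ; N = a + m in
               m * (N C m) * ((i + d) C i) ≡ n * (((n + d) C d) * ((a + i) C i))
  C-exchange a i d = *-cancelʳ-≡ _ _ (a ! * (i ! * d !))
    {{m*n≢0 (a !) (i ! * d !) {{a !≢0}} {{m*n≢0 (i !) (d !) {{i !≢0}} {{d !≢0}}}}}} (begin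
    m * (N C m) * ((i + d) C i) * (a ! * (i ! * d !))
      ≡⟨ move₁ m (N C m) ((i + d) C i) (a !) (i !) (d !) ⟩
    (N C m) * (a ! * (m * (((i + d) C i) * (d ! * i !))))
      ≡⟨ cong (λ z → (N C m) * (a ! * (m * z))) i+d! ⟩
    (N C m) * (a ! * (m * (i + d) !))
      ≡⟨ cong (λ z → (N C m) * (a ! * z)) m! ⟩
    (N C m) * (a ! * m !)
      ≡⟨ C-factorial a m ⟩
    (a + (i + suc d)) !
      ≡⟨ cong _! (n+d≡N a i d) ⟨
    (n + d) !
      ≡⟨ C-factorial n d ⟨
    ((n + d) C d) * (n ! * d !)
      ≡⟨ cong (λ z → ((n + d) C d) * (z * d !)) n! ⟨
    ((n + d) C d) * (n * (a + i) ! * d !)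
      ≡⟨ cong (λ z → ((n + d) C d) * (n * z * d !)) (C-factorial a i) ⟨
    ((n + d) C d) * (n * (((a + i) C i) * (a ! * i !)) * d !)
      ≡⟨ move₂ n ((n + d) C d) ((a + i) C i) (a !) (i !) (d !) ⟩
    n * (((n + d) C d) * ((a + i) C i)) * (a ! * (i ! * d !)) ∎)
    where
    open ≡-Reasoning
    m n N : ℕ
    m = i + suc d
    n = a + suc i
    N = a + m
    move₁ : ∀ m x y a i d → m * x * y * (a * (i * d)) ≡ x * (a * (m * (y * (d * i))))
    move₁ = solve-∀
    move₂ : ∀ n x y a i d → x * (n * (y * (a * i)) * d) ≡ n * (x * y) * (a * (i * d))
    move₂ = solve-∀
    n+d≡N : ∀ a i d → a + suc i + d ≡ a + (i + suc d)
    n+d≡N = solve-∀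
    i+d! : ((i + d) C i) * (d ! * i !) ≡ (i + d) !
    i+d! = trans (cong (λ k → (k C i) * (d ! * i !)) (+-comm i d))
                 (trans (C-factorial d i) (cong _! (+-comm d i)))
    m! : m * (i + d) ! ≡ m !
    m! rewrite +-suc i d = refl
    n! : n * (a + i) ! ≡ n !
    n! rewrite +-suc a i = refl

  module _ {s n : ℕ} (2^s∣n : 2 ^ s ∣ n) where

    private
      -- If c were odd, 2^s ∣ n would force 2^s ∣ i + 1, which is positive and below 2^s.
      even : ∀ {i c c′} → suc i < 2 ^ s → suc i * c ≡ n * c′ → 2 ∣ c
      even {i} {c} {c′} 1+i<2^s eq with 2 ∣? c
      ... | yes 2∣c = 2∣c
      ... | no odd-c = contradiction
        (2^-cancel-odd s odd-c (subst (2 ^ s ∣_) (trans (sym eq) (*-comm (suc i) c)) (∣m⇒∣m*n c′ 2^s∣n)))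
        (>⇒∤ 1+i<2^s)

    -- By Pascal's rule C(p, i) and C(p, i + 1) sum to C(n, i + 1), which is even by absorption, so
    -- the parity of C(p, 0) = 1 propagates.
    C-pred-odd : ∀ p i → n ≡ suc p → i < 2 ^ s → Odd (p C i)
    C-pred-odd p zero    _    _ 2∣1 = contradiction (∣⇒≤ 2∣1) λ { (s≤s ()) }
    C-pred-odd p (suc i) refl 1+i<2^s 2∣pC1+i = C-pred-odd p i refl (<-trans (n<1+n i) 1+i<2^s)
      (∣m+n∣m⇒∣n (subst (2 ∣_) (trans (sym (nCk+nC[k+1]≡[n+1]C[k+1] p i)) (+-comm (p C i) (p C suc i)))
                              (even {i} 1+i<2^s (C-absorb p i)))
                 2∣pC1+i)

    -- The same propagation along a diagonal: the increment C(n + d, d + 1) is even because d + 1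
    -- times it is n C(n + d, d).
    C-multiset-odd : ∀ d → d < 2 ^ s → Odd ((n + d) C d)
    C-multiset-odd zero    _       2∣1 = contradiction (∣⇒≤ 2∣1) λ { (s≤s ()) }
    C-multiset-odd (suc d) 1+d<2^s 2∣C = C-multiset-odd d (<-trans (n<1+n d) 1+d<2^s)
      (∣m+n∣m⇒∣n (subst (2 ∣_) pascal 2∣C) (even {d} {(n + d) C suc d} {(n + d) C d} 1+d<2^s absorb))
      where
      pascal : (n + suc d) C suc d ≡ ((n + d) C suc d) + ((n + d) C d)
      pascal = trans (cong (_C suc d) (+-suc n d))
        (trans (sym (nCk+nC[k+1]≡[n+1]C[k+1] (n + d) d)) (+-comm ((n + d) C d) _))
      absorb : suc d * ((n + d) C suc d) ≡ n * ((n + d) C d)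
      absorb = absorb′ n
        where
        absorb′ : ∀ n → suc d * ((n + d) C suc d) ≡ n * ((n + d) C d)
        absorb′ zero    = trans (cong (suc d *_) (k>n⇒nCk≡0 (n<1+n d))) (*-zeroʳ (suc d))
        absorb′ (suc a) = C-absorb-top a d

  2^s∤2^s+i : ∀ s {i} → suc i < 2 ^ s → ¬ 2 ^ s ∣ 2 ^ s + suc i
  2^s∤2^s+i s 1+i<2^s d = >⇒∤ 1+i<2^s (∣m+n∣m⇒∣n d ∣-refl)

  -- Supplies the odd constant of a halving step, one c for which 2c is divisible by every C(m₁, i).
  -- The product of the individual odd witnesses serves.
  odd-common-multiple : ∀ n (k : ℕ → ℕ) → (∀ i → i < n → ∃ λ o → Odd o × k i ∣ 2 * o) →
                        ∃ λ c → Odd c × (∀ i → i < n → k i ∣ 2 * c)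
  odd-common-multiple zero    k h = 1 , (λ 2∣1 → contradiction (∣⇒≤ 2∣1) λ { (s≤s ()) }) , λ _ ()
  odd-common-multiple (suc n) k h with h n ≤-refl | odd-common-multiple n k (λ i i<n → h i (m<n⇒m<1+n i<n))
  ... | o , odd-o , k∣2o | c , odd-c , k∣2c = o * c , odd-* odd-o odd-c , divides-all
    where
    divides-all : ∀ i → i < suc n → k i ∣ 2 * (o * c)
    divides-all i (s≤s i≤n) with m≤n⇒m<n∨m≡n i≤n
    ... | inj₁ i<n  = ∣-trans (k∣2c i i<n) (*-monoʳ-∣ 2 (n∣m*n o))
    ... | inj₂ refl = ∣-trans k∣2o (*-monoʳ-∣ 2 (m∣m*n {o} c))

  -- The binomial coefficients C(3 · 2^r - 1, i) in the three thirds of the range of i.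

  module Thirds (s m₁ : ℕ) (m≡3*2^r : suc m₁ ≡ 3 * 2 ^ suc s) where

    r Q : ℕ
    r = suc s
    Q = 2 ^ r

    Q∣m : 2 ^ r ∣ suc m₁
    Q∣m = divides 3 m≡3*2^r

    m≡Q+Q+Q : suc m₁ ≡ Q + (Q + Q)
    m≡Q+Q+Q = trans m≡3*2^r (cong (λ z → Q + (Q + z)) (+-identityʳ Q))

    low<m : ∀ {i} → i < Q → i < suc m₁
    low<m {i} i<Q = subst (i <_) (sym m≡Q+Q+Q) (<-≤-trans i<Q (m≤m+n Q (Q + Q)))

    middle<m : ∀ {e} → e < Q → Q + e < suc m₁
    middle<m {e} e<Q = subst (Q + e <_) (sym m≡Q+Q+Q) (+-monoʳ-< Q (<-≤-trans e<Q (m≤m+n Q Q)))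

    high<m : ∀ {e} → e < Q → Q + (Q + e) < suc m₁
    high<m {e} e<Q = subst (Q + (Q + e) <_) (sym m≡Q+Q+Q) (+-monoʳ-< Q (+-monoʳ-< Q e<Q))

    -- In binary m₁ is 10 followed by r ones, so subtracting i borrows exactly once for i in the
    -- middle third and never in the outer ones. This is the pattern behind `C-low`, `C-high` and
    -- `C-middle`.
    C-low : ∀ i → i < Q → Odd (m₁ C i)
    C-low i = C-pred-odd {r} Q∣m m₁ i refl

    -- The symmetry i ↦ m₁ - i carries the upper third to the lower one.
    C-high : ∀ e → e < Q → Odd (m₁ C (Q + (Q + e)))
    C-high e e<Q = subst Odd (sym (nCk≡nC[n∸k] (≤-pred (high<m e<Q))))
      (C-low _ (begin-strict
        m₁ ∸ (Q + (Q + e))             <⟨ ∸-monoˡ-< (n<1+n m₁) (≤-pred (high<m e<Q)) ⟩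
        suc m₁ ∸ (Q + (Q + e))         ≡⟨ cong (_∸ (Q + (Q + e))) m≡Q+Q+Q ⟩
        Q + (Q + Q) ∸ (Q + (Q + e))    ≡⟨ [m+n]∸[m+o]≡n∸o Q (Q + Q) (Q + e) ⟩
        Q + Q ∸ (Q + e)                ≡⟨ [m+n]∸[m+o]≡n∸o Q Q e ⟩
        Q ∸ e                          ≤⟨ m∸n≤m Q e ⟩
        Q                              ∎))
      where open ≤-Reasoning

    -- The third starts with C(m₁, Q) = 2 C(m₁, Q - 1), as m₁ - Q + 1 = 2Q, and neighbours in it sum
    -- to a multiple of 4.
    C-middle : ∀ e → e < Q → 2 ∣ m₁ C (Q + e) × ¬ 4 ∣ m₁ C (Q + e)
    C-middle zero    0<Q with m≤n⇒∃[o]m+o≡n 0<Q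
    ... | k , 1+k≡Q = subst (λ c → 2 ∣ c × ¬ 4 ∣ c) (sym twice)
                        (m∣m*n (m₁ C k) , λ 4∣ → C-low k k<Q (*-cancelˡ-∣ 2 4∣))
      where
      k<Q : k < Q
      k<Q = ≤-reflexive 1+k≡Q
      m₁≡ : suc (k + Q) + k ≡ m₁
      m₁≡ = suc-injective (trans (cong (λ q → suc (q + Q + k)) 1+k≡Q)
        (trans (shuffle Q k) (trans (cong (λ q → Q + (Q + q)) 1+k≡Q) (sym m≡Q+Q+Q))))
        where
        shuffle : ∀ q k → suc (q + q + k) ≡ q + (q + suc k)
        shuffle = solve-∀
      twice : m₁ C (Q + 0) ≡ 2 * (m₁ C k)
      twice = *-cancelˡ-≡ _ _ (suc k) (begin
        suc k * (m₁ C (Q + 0))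
          ≡⟨ cong₂ (λ n i → suc k * (n C i)) (sym m₁≡) (trans (+-identityʳ Q) (sym 1+k≡Q)) ⟩
        suc k * ((suc (k + Q) + k) C suc k)
          ≡⟨ C-absorb-top (k + Q) k ⟩
        suc (k + Q) * ((suc (k + Q) + k) C k)
          ≡⟨ cong₂ (λ q n → (suc k + q) * (n C k)) (sym 1+k≡Q) m₁≡ ⟩
        (suc k + suc k) * (m₁ C k)
          ≡⟨ regroup (suc k) (m₁ C k) ⟩
        suc k * (2 * (m₁ C k)) ∎)
        where
        open ≡-Reasoning
        regroup : ∀ k c → (k + k) * c ≡ k * (2 * c)
        regroup = solve-∀
    C-middle (suc e) 1+e<Q with C-middle e (<-trans (n<1+n e) 1+e<Q)
    ... | 2∣C , 4∤C =
        ∣m+n∣m⇒∣n (∣-trans (divides 2 refl) 4∣sum) 2∣C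
      , λ 4∣C′ → 4∤C (∣m+n∣m⇒∣n (subst (4 ∣_) (+-comm (m₁ C (Q + e)) _) 4∣sum) 4∣C′)
      where
      4∣sum : 4 ∣ (m₁ C (Q + e)) + (m₁ C (Q + suc e))
      4∣sum rewrite +-suc Q e | nCk+nC[k+1]≡[n+1]C[k+1] m₁ (Q + e) =
        -- m C(m₁, Q + e) is divisible by 2^(r + 1), of which Q + e + 1 absorbs at most 2^(r - 1).
        2^-cancel s 2 {suc (Q + e)} (subst (λ i → ¬ 2 ^ r ∣ i) (+-suc Q e) (2^s∤2^s+i r 1+e<Q))
          (subst₂ _∣_ modulus (sym (C-absorb m₁ (Q + e))) (*-pres-∣ Q∣m 2∣C))
        where
        modulus : 2 ^ r * 2 ≡ 2 ^ (s + 2)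
        modulus = trans (*-comm (2 ^ r) 2) (cong (2 ^_) (+-comm 2 s))

    C∣2*odd : ∀ i → i < suc m₁ → ∃ λ o → Odd o × m₁ C i ∣ 2 * o
    C∣2*odd i i<m with i <? Q
    ... | yes i<Q = m₁ C i , C-low i i<Q , n∣m*n 2
    ... | no  i≮Q with m≤n⇒∃[o]m+o≡n (≮⇒≥ i≮Q)
    ... | e , refl with e <? Q
    ... | yes e<Q = halve (C-middle e e<Q)
      where
      halve : 2 ∣ m₁ C (Q + e) × ¬ 4 ∣ m₁ C (Q + e) → ∃ λ o → Odd o × m₁ C (Q + e) ∣ 2 * o
      halve (divides o eq , 4∤C) = o , (λ 2∣o → 4∤C (subst (4 ∣_) (trans (*-comm 2 o) (sym eq)) (*-monoʳ-∣ 2 2∣o)))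
                                     , ∣-reflexive (trans eq (*-comm o 2))
    ... | no  e≮Q with m≤n⇒∃[o]m+o≡n (≮⇒≥ e≮Q)
    ... | e′ , refl = _ , C-high e′ (+-cancelˡ-< Q _ _ (+-cancelˡ-< Q _ _ (subst (Q + (Q + e′) <_) m≡Q+Q+Q i<m)))
                        , n∣m*n 2

    -- For i ≤ p and i ≤ m₁, this is m C(m₁, i) times the absolute value of the coefficient of x^(p
    -- - i) in (1 + x)⁻ᵐ⁻¹, divided by the degree p + 1.
    γ : ℕ → ℕ → ℕ
    γ p i = ((suc p + (m₁ ∸ i)) C (m₁ ∸ i)) * (p C i)

    γ-exchange : ∀ a i → i ≤ m₁ →
      suc m₁ * ((a + suc m₁) C suc m₁) * (m₁ C i) ≡ suc (a + i) * γ (a + i) i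
    γ-exchange a i i≤m₁ = subst₂
      (λ m₁ n → suc m₁ * ((a + suc m₁) C suc m₁) * (m₁ C i) ≡ n * (((n + d) C d) * ((a + i) C i)))
      (m+[n∸m]≡n i≤m₁) (+-suc a i)
      (subst (λ m → m * ((a + m) C m) * ((i + d) C i) ≡ (a + suc i) * (((a + suc i + d) C d) * ((a + i) C i)))
             (+-suc i d) (C-exchange a i d))
      where
      d : ℕ
      d = m₁ ∸ i

    -- Together with `γ-middle-even`: throughout the middle third the parity of γ(p, i) depends on p
    -- alone. Here both binomials have lower index below 2^(r + 1), the power dividing p + 1.
    γ-middle-odd : ∀ p e → e < Q → 2 ^ suc r ∣ suc p → Odd (γ p (Q + e))
    γ-middle-odd p e e<Q d =
      odd-* (C-multiset-odd {suc r} d (m₁ ∸ (Q + e)) (begin-strict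
              m₁ ∸ (Q + e)                   ≤⟨ ∸-monoʳ-≤ m₁ (m≤m+n Q e) ⟩
              m₁ ∸ Q                         <⟨ ∸-monoˡ-< (n<1+n m₁) (≤-trans (m≤m+n Q e) (≤-pred (middle<m e<Q))) ⟩
              suc m₁ ∸ Q                     ≡⟨ cong (_∸ Q) m≡Q+Q+Q ⟩
              Q + (Q + Q) ∸ Q                ≡⟨ m+n∸m≡n Q (Q + Q) ⟩
              Q + Q                          ≡⟨ cong (_+_ Q) (+-identityʳ Q) ⟨
              2 ^ suc r                      ∎))
            (C-pred-odd {suc r} d p (Q + e) refl (begin-strict
              Q + e        <⟨ +-monoʳ-< Q e<Q ⟩
              Q + Q        ≡⟨ cong (_+_ Q) (+-identityʳ Q) ⟨
              2 ^ suc r    ∎))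
      where open ≤-Reasoning

    γ-middle-even : ∀ p e → e < Q → ¬ 2 ^ suc r ∣ suc p → 2 ∣ γ p (Q + e)
    γ-middle-even p e e<Q 2^∤ with Q + e ≤? p
    ... | no i≰p = subst (2 ∣_) (sym (trans (cong (((suc p + (m₁ ∸ (Q + e))) C (m₁ ∸ (Q + e))) *_) (k>n⇒nCk≡0 (≰⇒> i≰p))) (*-zeroʳ ((suc p + (m₁ ∸ (Q + e))) C (m₁ ∸ (Q + e)))))) (2 ∣0)
    ... | yes i≤p with m≤n⇒∃[o]o+m≡n i≤p
    -- m and C(m₁, i) contribute 2^(r + 1) to (p + 1) γ(p, i), and p + 1 carries at most 2^r of it.
    ... | a , refl = 2^-cancel r 1 2^∤ (subst₂ _∣_ modulus (γ-exchange a i i≤m₁)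
                       (*-pres-∣ (∣m⇒∣m*n ((a + suc m₁) C suc m₁) Q∣m) (proj₁ (C-middle e e<Q))))
      where
      i : ℕ
      i = Q + e
      modulus : 2 ^ r * 2 ≡ 2 ^ (r + 1)
      modulus = trans (*-comm (2 ^ r) 2) (cong (2 ^_) (+-comm 1 r))
      i≤m₁ : i ≤ m₁
      i≤m₁ = ≤-pred (middle<m e<Q)

open Binomials

open import Data.Integer.Base as ℤ using (ℤ; +_; 0ℤ; 1ℤ; -1ℤ)
import Data.Integer.Divisibility as ℤᵤ
open import Data.Integer.Divisibility.Signed as ℤ using (divides; quotient)
import Data.Integer.Properties as ℤ
open import Data.Integer.Tactic.RingSolver using (solve-∀)

-- The ring ℤ⟦x⟧
infix 4 _≈_
infixl 6 _⊕_
infixr 7 _•_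

-- Pointwise equality, wrapped in a record so that the two series can be inferred.
record _≈_ (f g : ℤ⟦x⟧) : Set where
  constructor pointwise
  field at : ∀ n → f n ≡ g n
open _≈_

_⊕_ : ℤ⟦x⟧ → ℤ⟦x⟧ → ℤ⟦x⟧
(f ⊕ g) n = f n ℤ.+ g n

neg : ℤ⟦x⟧ → ℤ⟦x⟧
neg f n = ℤ.- f n

𝟘 : ℤ⟦x⟧
𝟘 _ = 0ℤ

_•_ : ℤ → ℤ⟦x⟧ → ℤ⟦x⟧
(k • f) n = k ℤ.* f n

⊛-zero : ∀ f g → (f ⊛ g) 0 ≡ f 0 ℤ.* g 0
⊛-zero f g = ℤ.+-identityʳ _

-- `(f ⊛ g) (suc n)` unfolds to f 0 · g (suc n) + `((f ∘ suc) ⊛ g) n`; the inductions on products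
-- below run on this recursion in the left factor.
⊛-cong : ∀ {f f′ g g′} → f ≈ f′ → g ≈ g′ → f ⊛ g ≈ f′ ⊛ g′
⊛-cong p q = pointwise (go p q)
  where
  go : ∀ {f f′ g g′} → f ≈ f′ → g ≈ g′ → ∀ n → (f ⊛ g) n ≡ (f′ ⊛ g′) n
  go p q zero    = cong₂ (λ a b → a ℤ.* b ℤ.+ 0ℤ) (at p 0) (at q 0)
  go p q (suc n) = cong₂ ℤ._+_ (cong₂ ℤ._*_ (at p 0) (at q (suc n)))
                              (go (pointwise (at p ∘ suc)) q n)

⊛-zeroˡ : ∀ f → 𝟘 ⊛ f ≈ 𝟘
⊛-zeroˡ f = pointwise go
  where
  go : ∀ n → (𝟘 ⊛ f) n ≡ 0ℤ
  go zero    = refl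
  go (suc n) = trans (ℤ.+-identityˡ _) (go n)

⊛-distribʳ : ∀ h f g → (f ⊕ g) ⊛ h ≈ f ⊛ h ⊕ g ⊛ h
⊛-distribʳ h f g = pointwise (go f g)
  where
  distrib₀ : ∀ a b c → (a ℤ.+ b) ℤ.* c ℤ.+ 0ℤ ≡ (a ℤ.* c ℤ.+ 0ℤ) ℤ.+ (b ℤ.* c ℤ.+ 0ℤ)
  distrib₀ = solve-∀
  distrib₁ : ∀ a b c d e → (a ℤ.+ b) ℤ.* c ℤ.+ (d ℤ.+ e) ≡ (a ℤ.* c ℤ.+ d) ℤ.+ (b ℤ.* c ℤ.+ e)
  distrib₁ = solve-∀
  go : ∀ f g n → ((f ⊕ g) ⊛ h) n ≡ (f ⊛ h ⊕ g ⊛ h) n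
  go f g zero    = distrib₀ (f 0) (g 0) (h 0)
  go f g (suc n) = trans (cong (ℤ._+_ ((f 0 ℤ.+ g 0) ℤ.* h (suc n))) (go (f ∘ suc) (g ∘ suc) n))
                         (distrib₁ (f 0) (g 0) _ _ _)

•-⊛ : ∀ k f g → (k • f) ⊛ g ≈ k • (f ⊛ g)
•-⊛ k f g = pointwise (go f)
  where
  assoc₀ : ∀ k a b → (k ℤ.* a) ℤ.* b ℤ.+ 0ℤ ≡ k ℤ.* (a ℤ.* b ℤ.+ 0ℤ)
  assoc₀ = solve-∀
  assoc₁ : ∀ k a b c → (k ℤ.* a) ℤ.* b ℤ.+ k ℤ.* c ≡ k ℤ.* (a ℤ.* b ℤ.+ c)
  assoc₁ = solve-∀
  go : ∀ f n → ((k • f) ⊛ g) n ≡ k ℤ.* (f ⊛ g) n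
  go f zero    = assoc₀ k (f 0) (g 0)
  go f (suc n) = trans (cong (ℤ._+_ ((k ℤ.* f 0) ℤ.* g (suc n))) (go (f ∘ suc) n))
                       (assoc₁ k (f 0) (g (suc n)) _)

⊛-assoc : ∀ f g h → (f ⊛ g) ⊛ h ≈ f ⊛ (g ⊛ h)
⊛-assoc f g h = pointwise (go f)
  where
  open ≡-Reasoning
  assoc₀ : ∀ a b c → (a ℤ.* b ℤ.+ 0ℤ) ℤ.* c ℤ.+ 0ℤ ≡ a ℤ.* (b ℤ.* c ℤ.+ 0ℤ) ℤ.+ 0ℤ
  assoc₀ = solve-∀
  assoc₁ : ∀ a b c d e → (a ℤ.* b ℤ.+ 0ℤ) ℤ.* c ℤ.+ (a ℤ.* d ℤ.+ e) ≡ a ℤ.* (b ℤ.* c ℤ.+ d) ℤ.+ e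
  assoc₁ = solve-∀
  go : ∀ f n → ((f ⊛ g) ⊛ h) n ≡ (f ⊛ (g ⊛ h)) n
  go f zero    = assoc₀ (f 0) (g 0) (h 0)
  go f (suc n) = begin
    (f ⊛ g) 0 ℤ.* h (suc n) ℤ.+ ((f 0 • (g ∘ suc) ⊕ (f ∘ suc) ⊛ g) ⊛ h) n
      ≡⟨ cong (ℤ._+_ ((f ⊛ g) 0 ℤ.* h (suc n))) (begin
        ((f 0 • (g ∘ suc) ⊕ (f ∘ suc) ⊛ g) ⊛ h) n
          ≡⟨ at (⊛-distribʳ h (f 0 • (g ∘ suc)) ((f ∘ suc) ⊛ g)) n ⟩
        ((f 0 • (g ∘ suc)) ⊛ h) n ℤ.+ (((f ∘ suc) ⊛ g) ⊛ h) n
          ≡⟨ cong₂ ℤ._+_ (at (•-⊛ (f 0) (g ∘ suc) h) n) (go (f ∘ suc) n) ⟩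
        f 0 ℤ.* ((g ∘ suc) ⊛ h) n ℤ.+ ((f ∘ suc) ⊛ (g ⊛ h)) n ∎) ⟩
    (f 0 ℤ.* g 0 ℤ.+ 0ℤ) ℤ.* h (suc n) ℤ.+
      (f 0 ℤ.* ((g ∘ suc) ⊛ h) n ℤ.+ ((f ∘ suc) ⊛ (g ⊛ h)) n)
      ≡⟨ assoc₁ (f 0) (g 0) (h (suc n)) _ _ ⟩
    (f ⊛ (g ⊛ h)) (suc n) ∎

-- The mirror image of the unfolding of `⊛`, with the last summand split off instead of the first;
-- commutativity comes from matching the two.
⊛-suc : ∀ f g n → (f ⊛ g) (suc n) ≡ (f ⊛ (g ∘ suc)) n ℤ.+ f (suc n) ℤ.* g 0
⊛-suc f g zero    = lemma (f 0) (g 1) (f 1) (g 0)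
  where
  lemma : ∀ a b c d → a ℤ.* b ℤ.+ (c ℤ.* d ℤ.+ 0ℤ) ≡ (a ℤ.* b ℤ.+ 0ℤ) ℤ.+ c ℤ.* d
  lemma = solve-∀
⊛-suc f g (suc n) = trans (cong (ℤ._+_ (f 0 ℤ.* g (suc (suc n)))) (⊛-suc (f ∘ suc) g n))
                          (sym (ℤ.+-assoc (f 0 ℤ.* g (suc (suc n))) _ _))

⊛-comm : ∀ f g → f ⊛ g ≈ g ⊛ f
⊛-comm f g = pointwise (go f g)
  where
  open ≡-Reasoning
  comm₀ : ∀ a b → a ℤ.* b ℤ.+ 0ℤ ≡ b ℤ.* a ℤ.+ 0ℤ
  comm₀ = solve-∀
  comm₁ : ∀ a b c → a ℤ.* b ℤ.+ c ≡ c ℤ.+ b ℤ.* a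
  comm₁ = solve-∀
  go : ∀ f g n → (f ⊛ g) n ≡ (g ⊛ f) n
  go f g zero    = comm₀ (f 0) (g 0)
  go f g (suc n) = begin
    f 0 ℤ.* g (suc n) ℤ.+ ((f ∘ suc) ⊛ g) n  ≡⟨ cong (ℤ._+_ (f 0 ℤ.* g (suc n))) (go (f ∘ suc) g n) ⟩
    f 0 ℤ.* g (suc n) ℤ.+ (g ⊛ (f ∘ suc)) n  ≡⟨ comm₁ (f 0) (g (suc n)) _ ⟩
    (g ⊛ (f ∘ suc)) n ℤ.+ g (suc n) ℤ.* f 0  ≡⟨ ⊛-suc g f n ⟨
    (g ⊛ f) (suc n)                        ∎

⊛-identityˡ : ∀ f → 𝟙 ⊛ f ≈ f
⊛-identityˡ f = pointwise go
  where
  lemma : ∀ a → 1ℤ ℤ.* a ℤ.+ 0ℤ ≡ a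
  lemma = solve-∀
  go : ∀ n → (𝟙 ⊛ f) n ≡ f n
  go zero    = lemma (f 0)
  go (suc n) = trans (cong (ℤ._+_ (1ℤ ℤ.* f (suc n))) (at (⊛-zeroˡ f) n)) (lemma (f (suc n)))

≈-refl : ∀ {f} → f ≈ f
≈-refl = pointwise λ _ → refl

≈-sym : ∀ {f g} → f ≈ g → g ≈ f
≈-sym p = pointwise λ n → sym (at p n)

≈-trans : ∀ {f g h} → f ≈ g → g ≈ h → f ≈ h
≈-trans p q = pointwise λ n → trans (at p n) (at q n)

⊕-cong : ∀ {f f′ g g′} → f ≈ f′ → g ≈ g′ → f ⊕ g ≈ f′ ⊕ g′
⊕-cong p q = pointwise λ n → cong₂ ℤ._+_ (at p n) (at q n)

⊛-congˡ : ∀ f {g g′} → g ≈ g′ → f ⊛ g ≈ f ⊛ g′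
⊛-congˡ f p = ⊛-cong (≈-refl {f}) p

⊛-congʳ : ∀ g {f f′} → f ≈ f′ → f ⊛ g ≈ f′ ⊛ g
⊛-congʳ g p = ⊛-cong p (≈-refl {g})

⊕-congˡ : ∀ f {g g′} → g ≈ g′ → f ⊕ g ≈ f ⊕ g′
⊕-congˡ f p = ⊕-cong (≈-refl {f}) p

⊕-congʳ : ∀ g {f f′} → f ≈ f′ → f ⊕ g ≈ f′ ⊕ g
⊕-congʳ g p = ⊕-cong p (≈-refl {g})

neg-cong : ∀ {f g} → f ≈ g → neg f ≈ neg g
neg-cong p = pointwise λ n → cong ℤ.-_ (at p n)

•-cong : ∀ k {f g} → f ≈ g → k • f ≈ k • g
•-cong k p = pointwise λ n → cong (k ℤ.*_) (at p n)

powerSeriesRing : CommutativeRing 0ℓ 0ℓ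
powerSeriesRing = record
  { Carrier = ℤ⟦x⟧ ; _≈_ = _≈_ ; _+_ = _⊕_ ; _*_ = _⊛_ ; -_ = neg ; 0# = 𝟘 ; 1# = 𝟙
  ; isCommutativeRing = record
    { isRing = record
      { +-isAbelianGroup = record
        { isGroup = record
          { isMonoid = record
            { isSemigroup = record
              { isMagma = record
                { isEquivalence = record { refl = ≈-refl ; sym = ≈-sym ; trans = ≈-trans }
                ; ∙-cong = ⊕-cong }
              ; assoc = λ f g h → pointwise λ n → ℤ.+-assoc (f n) (g n) (h n) }
            ; identity = (λ f → pointwise λ n → ℤ.+-identityˡ (f n))
                       , (λ f → pointwise λ n → ℤ.+-identityʳ (f n)) }
          ; inverse = (λ f → pointwise λ n → ℤ.+-inverseˡ (f n))
                    , (λ f → pointwise λ n → ℤ.+-inverseʳ (f n))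
          ; ⁻¹-cong = neg-cong }
        ; comm = λ f g → pointwise λ n → ℤ.+-comm (f n) (g n) }
      ; *-cong = ⊛-cong
      ; *-assoc = ⊛-assoc
      ; *-identity = ⊛-identityˡ , λ f → ≈-trans (⊛-comm f 𝟙) (⊛-identityˡ f)
      ; distrib = (λ h f g → ≈-trans (⊛-comm h (f ⊕ g)) (≈-trans (⊛-distribʳ h f g)
                               (⊕-cong (⊛-comm f h) (⊛-comm g h))))
                , ⊛-distribʳ }
    ; *-comm = ⊛-comm } }

module ℙ = CommutativeRing powerSeriesRing
import Algebra.Properties.CommutativeSemiring.Exp ℙ.commutativeSemiring as Exp
module ≈-Reasoning = SetoidReasoning ℙ.setoid

-- Lets the ring solver use integer constants, read as the series `k • 𝟙`; `scalar` below turns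
-- scalar multiples into products with these.
scalar-homomorphism : ℤ.+-*-rawRing -Raw-AlmostCommutative⟶ fromCommutativeRing powerSeriesRing
scalar-homomorphism = record
  { ⟦_⟧    = _• 𝟙
  ; +-homo = λ a b → pointwise λ n → ℤ.*-distribʳ-+ (𝟙 n) a b
  ; *-homo = λ a b → ≈-trans (pointwise λ n → ℤ.*-assoc a b (𝟙 n))
                             (≈-sym (≈-trans (•-⊛ a 𝟙 (b • 𝟙)) (pointwise λ n → cong (a ℤ.*_) (at (⊛-identityˡ (b • 𝟙)) n))))
  ; -‿homo = λ a → pointwise λ n → sym (ℤ.neg-distribˡ-* a (𝟙 n))
  ; 0-homo = pointwise λ n → refl
  ; 1-homo = pointwise λ n → ℤ.*-identityˡ (𝟙 n)
  }

open import Algebra.Solver.Ring ℤ.+-*-rawRing (fromCommutativeRing powerSeriesRing)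
  scalar-homomorphism
  (λ a b → Maybe.map (λ a≡b → pointwise λ n → cong (ℤ._* 𝟙 n) a≡b) (dec⇒maybe (a ℤ.≟ b)))
  using (solve; con; _:+_; _:*_; :-_; _:=_)

^ᵖ≡^ : ∀ f n → f ^ᵖ n ≡ f Exp.^ n
^ᵖ≡^ f zero    = refl
^ᵖ≡^ f (suc n) = cong (f ⊛_) (^ᵖ≡^ f n)

^ᵖ-cong : ∀ {f g} n → f ≈ g → f ^ᵖ n ≈ g ^ᵖ n
^ᵖ-cong {f} {g} n p rewrite ^ᵖ≡^ f n | ^ᵖ≡^ g n = Exp.^-congˡ n p

^ᵖ-+ : ∀ f m n → f ^ᵖ (m + n) ≈ f ^ᵖ m ⊛ f ^ᵖ n
^ᵖ-+ f m n rewrite ^ᵖ≡^ f (m + n) | ^ᵖ≡^ f m | ^ᵖ≡^ f n = Exp.^-homo-* f m n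

^ᵖ-⊛ : ∀ f g n → (f ⊛ g) ^ᵖ n ≈ f ^ᵖ n ⊛ g ^ᵖ n
^ᵖ-⊛ f g n rewrite ^ᵖ≡^ (f ⊛ g) n | ^ᵖ≡^ f n | ^ᵖ≡^ g n = Exp.^-distrib-* f g n

^ᵖ-* : ∀ f m n → (f ^ᵖ m) ^ᵖ n ≈ f ^ᵖ (m * n)
^ᵖ-* f m n rewrite ^ᵖ≡^ (f ^ᵖ m) n | ^ᵖ≡^ f m | ^ᵖ≡^ f (m * n) = Exp.^-assocʳ f m n

𝟙^ᵖ : ∀ n → 𝟙 ^ᵖ n ≈ 𝟙
𝟙^ᵖ zero    = ≈-refl
𝟙^ᵖ (suc n) = ≈-trans (⊛-identityˡ _) (𝟙^ᵖ n)

-- The operators θ, σ and U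

θ : ℤ⟦x⟧ → ℤ⟦x⟧
θ f n = + n ℤ.* f n

θ-cong : ∀ {f g} → f ≈ g → θ f ≈ θ g
θ-cong p = pointwise λ n → cong (+ n ℤ.*_) (at p n)

θ-⊛ : ∀ f g → θ (f ⊛ g) ≈ θ f ⊛ g ⊕ f ⊛ θ g
θ-⊛ f g = pointwise (go f)
  where
  step₀ : ∀ a b → 0ℤ ≡ (0ℤ ℤ.* a ℤ.* b ℤ.+ 0ℤ) ℤ.+ (a ℤ.* (0ℤ ℤ.* b) ℤ.+ 0ℤ)
  step₀ = solve-∀
  step₁ : ∀ n a b c d e → n ℤ.* c ≡ d ℤ.+ e →
          (1ℤ ℤ.+ n) ℤ.* (a ℤ.* b ℤ.+ c) ≡
          (0ℤ ℤ.* a ℤ.* b ℤ.+ (c ℤ.+ d)) ℤ.+ (a ℤ.* ((1ℤ ℤ.+ n) ℤ.* b) ℤ.+ e)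
  step₁ n a b c d e nc≡d+e = trans (expand n a b c)
    (trans (cong (λ s → a ℤ.* ((1ℤ ℤ.+ n) ℤ.* b) ℤ.+ (c ℤ.+ s)) nc≡d+e) (regroup n a b c d e))
    where
    expand : ∀ n a b c → (1ℤ ℤ.+ n) ℤ.* (a ℤ.* b ℤ.+ c) ≡
                         a ℤ.* ((1ℤ ℤ.+ n) ℤ.* b) ℤ.+ (c ℤ.+ n ℤ.* c)
    expand = solve-∀
    regroup : ∀ n a b c d e → a ℤ.* ((1ℤ ℤ.+ n) ℤ.* b) ℤ.+ (c ℤ.+ (d ℤ.+ e)) ≡
              (0ℤ ℤ.* a ℤ.* b ℤ.+ (c ℤ.+ d)) ℤ.+ (a ℤ.* ((1ℤ ℤ.+ n) ℤ.* b) ℤ.+ e)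
    regroup = solve-∀
  shift-θ : ∀ f n → (θ f ∘ suc) n ≡ ((f ∘ suc) ⊕ θ (f ∘ suc)) n
  shift-θ f n = suc-* (+ n) (f (suc n))
    where
    suc-* : ∀ n a → (1ℤ ℤ.+ n) ℤ.* a ≡ a ℤ.+ n ℤ.* a
    suc-* = solve-∀
  go : ∀ f n → θ (f ⊛ g) n ≡ (θ f ⊛ g ⊕ f ⊛ θ g) n
  go f zero    = step₀ (f 0) (g 0)
  go f (suc n) = trans
    (step₁ (+ n) (f 0) (g (suc n)) (((f ∘ suc) ⊛ g) n) ((θ (f ∘ suc) ⊛ g) n) _ (go (f ∘ suc) n))
    (cong (λ s → (0ℤ ℤ.* f 0 ℤ.* g (suc n) ℤ.+ s) ℤ.+ (f ⊛ θ g) (suc n))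
      (sym (trans (at (⊛-congʳ g (pointwise (shift-θ f))) n)
                  (at (⊛-distribʳ g (f ∘ suc) (θ (f ∘ suc))) n))))

-- f(x²)
σ : ℤ⟦x⟧ → ℤ⟦x⟧
σ f zero          = f 0
σ f (suc zero)    = 0ℤ
σ f (suc (suc n)) = σ (f ∘ suc) n

-- A local form of congruence, since `T` is known only degree by degree from its partial products.
σ-cong≤ : ∀ {f g} n → (∀ k → k ≤ n → f k ≡ g k) → σ f n ≡ σ g n
σ-cong≤ zero          p = p 0 z≤n
σ-cong≤ (suc zero)    p = refl
σ-cong≤ (suc (suc n)) p = σ-cong≤ n λ k k≤n → p (suc k) (s≤s (ℕ.m≤n⇒m≤1+n k≤n))

σ-cong : ∀ {f g} → f ≈ g → σ f ≈ σ g
σ-cong p = pointwise λ n → σ-cong≤ n λ k _ → at p k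

σ-⊕ : ∀ f g → σ (f ⊕ g) ≈ σ f ⊕ σ g
σ-⊕ f g = pointwise (go f g)
  where
  go : ∀ f g n → σ (f ⊕ g) n ≡ σ f n ℤ.+ σ g n
  go f g zero          = refl
  go f g (suc zero)    = refl
  go f g (suc (suc n)) = go (f ∘ suc) (g ∘ suc) n

σ-• : ∀ k f → σ (k • f) ≈ k • σ f
σ-• k f = pointwise (go f)
  where
  go : ∀ f n → σ (k • f) n ≡ k ℤ.* σ f n
  go f zero          = refl
  go f (suc zero)    = sym (ℤ.*-zeroʳ k)
  go f (suc (suc n)) = go (f ∘ suc) n

σ-⊛ : ∀ f g → σ (f ⊛ g) ≈ σ f ⊛ σ g
σ-⊛ f g = pointwise (go f g)
  where
  skip : ∀ a b c d → a ≡ b ℤ.+ d → a ≡ b ℤ.+ (0ℤ ℤ.* c ℤ.+ d)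
  skip a b c d a≡b+d = trans a≡b+d (cong (ℤ._+_ b) (sym (ℤ.+-identityˡ d)))
  odd₀ : ∀ a b → 0ℤ ≡ a ℤ.* 0ℤ ℤ.+ (0ℤ ℤ.* b ℤ.+ 0ℤ)
  odd₀ = solve-∀
  go : ∀ f g n → σ (f ⊛ g) n ≡ (σ f ⊛ σ g) n
  go f g zero          = refl
  go f g (suc zero)    = odd₀ (f 0) (g 0)
  go f g (suc (suc n)) = skip _ (f 0 ℤ.* σ (g ∘ suc) n) (σ g (suc n)) _ (trans
    (at (σ-⊕ (f 0 • (g ∘ suc)) ((f ∘ suc) ⊛ g)) n)
    (cong₂ ℤ._+_ (at (σ-• (f 0) (g ∘ suc)) n) (go (f ∘ suc) g n)))

σ-𝟙 : σ 𝟙 ≈ 𝟙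
σ-𝟙 = pointwise go
  where
  zeros : ∀ n → σ 𝟘 n ≡ 0ℤ
  zeros zero          = refl
  zeros (suc zero)    = refl
  zeros (suc (suc n)) = zeros n
  go : ∀ n → σ 𝟙 n ≡ 𝟙 n
  go zero          = refl
  go (suc zero)    = refl
  go (suc (suc n)) = zeros n

σ-^ᵖ : ∀ f n → σ (f ^ᵖ n) ≈ σ f ^ᵖ n
σ-^ᵖ f zero    = σ-𝟙
σ-^ᵖ f (suc n) = ≈-trans (σ-⊛ f (f ^ᵖ n)) (⊛-congˡ (σ f) (σ-^ᵖ f n))

U : ℤ⟦x⟧ → ℤ⟦x⟧
U f zero    = f 0
U f (suc n) = U (f ∘ suc ∘ suc) n

U-at : ∀ f n → U f n ≡ f (2 * n)
U-at f zero    = refl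
U-at f (suc n) = trans (U-at (f ∘ suc ∘ suc) n) (cong f (sym (ℕ.*-suc 2 n)))

U-cong : ∀ {f g} → f ≈ g → U f ≈ U g
U-cong {f} {g} p = pointwise λ n → trans (U-at f n) (trans (at p (2 * n)) (sym (U-at g n)))

-- The odd coefficients of σ g are zero, so only even coefficients of f take part in an even
-- coefficient of the product.
U-σ : ∀ g f → U (σ g ⊛ f) ≈ g ⊛ U f
U-σ g f = pointwise (go g)
  where
  skip : ∀ b c d → b ℤ.+ (0ℤ ℤ.* c ℤ.+ d) ≡ b ℤ.+ d
  skip b c d = cong (ℤ._+_ b) (ℤ.+-identityˡ d)
  go : ∀ g n → U (σ g ⊛ f) n ≡ (g ⊛ U f) n
  go g zero    = refl
  go g (suc n) = begin
    U (σ g ⊛ f) (suc n)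
      ≡⟨ U-at (σ g ⊛ f) (suc n) ⟩
    (σ g ⊛ f) (2 * suc n)
      ≡⟨ cong (σ g ⊛ f) (ℕ.*-suc 2 n) ⟩
    (σ g ⊛ f) (suc (suc (2 * n)))
      ≡⟨ skip (g 0 ℤ.* f (suc (suc (2 * n)))) (f (suc (2 * n))) _ ⟩
    g 0 ℤ.* f (suc (suc (2 * n))) ℤ.+ (σ (g ∘ suc) ⊛ f) (2 * n)
      ≡⟨ cong₂ ℤ._+_ (cong (g 0 ℤ.*_) (sym (trans (U-at f (suc n)) (cong f (ℕ.*-suc 2 n)))))
                     (trans (sym (U-at (σ (g ∘ suc) ⊛ f) n)) (go (g ∘ suc) n)) ⟩
    (g ⊛ U f) (suc n) ∎
    where open ≡-Reasoning

-- The series 1 - x and 1 + x, and the functional equation of `T`.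

X A B A⁻¹ B⁻¹ : ℤ⟦x⟧
X   = x^ 1
A   = factor 0
B   = 𝟙 ⊕ X
A⁻¹ _ = 1ℤ
B⁻¹ zero    = 1ℤ
B⁻¹ (suc n) = ℤ.- B⁻¹ n

X⊛-suc : ∀ f n → (X ⊛ f) (suc n) ≡ f n
X⊛-suc f n = trans (ℤ.+-identityˡ _) (at (⊛-identityˡ f) n)

A≈ : A ≈ 𝟙 ⊕ neg X
A≈ = pointwise λ _ → refl

A⊛ : ∀ f → A ⊛ f ≈ f ⊕ neg (X ⊛ f)
A⊛ f = begin
  A ⊛ f                  ≈⟨ ⊛-congʳ f A≈ ⟩
  (𝟙 ⊕ neg X) ⊛ f        ≈⟨ solve 3 (λ i x f → (i :+ :- x) :* f := i :* f :+ :- (x :* f)) ≈-refl 𝟙 X f ⟩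
  𝟙 ⊛ f ⊕ neg (X ⊛ f)    ≈⟨ ⊕-congʳ (neg (X ⊛ f)) (⊛-identityˡ f) ⟩
  f ⊕ neg (X ⊛ f)        ∎
  where open ≈-Reasoning

A⊛-zero : ∀ f → (A ⊛ f) 0 ≡ f 0
A⊛-zero f = trans (at (A⊛ f) 0) (ℤ.+-identityʳ (f 0))

A⊛-suc : ∀ f n → (A ⊛ f) (suc n) ≡ f (suc n) ℤ.- f n
A⊛-suc f n = trans (at (A⊛ f) (suc n)) (cong (λ z → f (suc n) ℤ.- z) (X⊛-suc f n))

B⊛ : ∀ f → B ⊛ f ≈ f ⊕ X ⊛ f
B⊛ f = ≈-trans (⊛-distribʳ f 𝟙 X) (⊕-congʳ (X ⊛ f) (⊛-identityˡ f))

B⊛-suc : ∀ f n → (B ⊛ f) (suc n) ≡ f (suc n) ℤ.+ f n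
B⊛-suc f n = trans (at (B⊛ f) (suc n)) (cong (λ z → f (suc n) ℤ.+ z) (X⊛-suc f n))

A⊛A⁻¹ : A ⊛ A⁻¹ ≈ 𝟙
A⊛A⁻¹ = pointwise λ { zero → refl ; (suc n) → A⊛-suc A⁻¹ n }

B⊛B⁻¹ : B ⊛ B⁻¹ ≈ 𝟙
B⊛B⁻¹ = pointwise λ { zero → refl ; (suc n) → trans (B⊛-suc B⁻¹ n) (ℤ.+-inverseˡ (B⁻¹ n)) }

^ᵖ-inverse : ∀ {f g} n → f ⊛ g ≈ 𝟙 → f ^ᵖ n ⊛ g ^ᵖ n ≈ 𝟙
^ᵖ-inverse {f} {g} n p = ≈-trans (≈-sym (^ᵖ-⊛ f g n)) (≈-trans (^ᵖ-cong n p) (𝟙^ᵖ n))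

σ-x^ : ∀ k → σ (x^ k) ≈ x^ (2 * k)
σ-x^ k = pointwise (go k)
  where
  go : ∀ k n → σ (x^ k) n ≡ (x^ (2 * k)) n
  go zero n = at σ-𝟙 n
  go (suc k) n rewrite ℕ.*-suc 2 k = step n
    where
    step : ∀ n → σ (x^ suc k) n ≡ (x^ (2 + 2 * k)) n
    step zero          = refl
    step (suc zero)    = refl
    step (suc (suc n)) = go k n

σ-factor : ∀ j → σ (factor j) ≈ factor (suc j)
σ-factor j = begin
  σ (factor j)                          ≈⟨ σ-cong (pointwise λ n → cong (ℤ._+_ (𝟙 n)) (sym (ℤ.-1*i≡-i ((x^ (2 ^ j)) n)))) ⟩
  σ (𝟙 ⊕ ℤ.-1ℤ • (x^ (2 ^ j)))          ≈⟨ σ-⊕ 𝟙 (ℤ.-1ℤ • (x^ (2 ^ j))) ⟩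
  σ 𝟙 ⊕ σ (ℤ.-1ℤ • (x^ (2 ^ j)))        ≈⟨ ⊕-cong σ-𝟙 (≈-trans (σ-• ℤ.-1ℤ (x^ (2 ^ j))) (pointwise λ n → cong (ℤ.-1ℤ ℤ.*_) (at (σ-x^ (2 ^ j)) n))) ⟩
  𝟙 ⊕ ℤ.-1ℤ • (x^ (2 ^ suc j))          ≈⟨ (pointwise λ n → cong (ℤ._+_ (𝟙 n)) (ℤ.-1*i≡-i ((x^ (2 ^ suc j)) n))) ⟩
  factor (suc j)                        ∎
  where open ≈-Reasoning

X⊛X : X ⊛ X ≈ σ X
X⊛X = pointwise λ { zero → refl ; (suc zero) → refl ; (suc (suc n)) →
  trans (X⊛-suc X (suc n)) (sym (at σ-𝟙 n)) }

σ-A : σ A ≈ A ⊛ B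
σ-A = begin
  σ A                ≈⟨ σ-factor 0 ⟩
  factor 1           ≈⟨ pointwise (λ n → cong (λ z → 𝟙 n ℤ.- z) (sym (at (σ-x^ 1) n))) ⟩
  𝟙 ⊕ neg (σ X)      ≈⟨ ⊕-congˡ 𝟙 (neg-cong X⊛X) ⟨
  𝟙 ⊕ neg (X ⊛ X)    ≈⟨ ⊕-congʳ (neg (X ⊛ X)) (⊛-identityˡ 𝟙) ⟨
  𝟙 ⊛ 𝟙 ⊕ neg (X ⊛ X) ≈⟨ solve 2 (λ i x → i :* i :+ :- (x :* x) := (i :+ :- x) :* (i :+ x)) ≈-refl 𝟙 X ⟩
  (𝟙 ⊕ neg X) ⊛ B    ≈⟨ ⊛-congʳ B A≈ ⟨
  A ⊛ B              ∎
  where open ≈-Reasoning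

-- `partialProduct` appends the factor of highest index, while the functional equation splits off
-- the factor of index 0; `σ-factor` accounts for the shift of the others.
partialProduct-suc : ∀ J → partialProduct (suc J) ≈ A ⊛ σ (partialProduct J)
partialProduct-suc zero    = ⊛-congˡ A (≈-sym σ-𝟙)
partialProduct-suc (suc J) = begin
  factor (suc J) ⊛ partialProduct (suc J)    ≈⟨ ⊛-cong (≈-sym (σ-factor J)) (partialProduct-suc J) ⟩
  σ (factor J) ⊛ (A ⊛ σ (partialProduct J))  ≈⟨ solve 3 (λ f a p → f :* (a :* p) := a :* (f :* p)) ≈-refl (σ (factor J)) A (σ (partialProduct J)) ⟩
  A ⊛ (σ (factor J) ⊛ σ (partialProduct J))  ≈⟨ ⊛-congˡ A (σ-⊛ (factor J) (partialProduct J)) ⟨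
  A ⊛ σ (partialProduct (suc J))             ∎
  where open ≈-Reasoning

-- Coefficient n of either side depends on degrees up to n only, where `partialProduct n` already
-- agrees with `T`.
T-functional : T ≈ A ⊛ σ T
T-functional = pointwise λ n → trans (sym (partialProduct-step n n (n<2^n n)))
                              (trans (at (partialProduct-suc n) n) (agree n))
  where
  truncate : ∀ n k → k ≤ n → σ (partialProduct n) k ≡ σ T k
  truncate n k k≤n = σ-cong≤ k λ i i≤k → T-limit i n (ℕ.≤-trans i≤k k≤n)
  agree : ∀ n → (A ⊛ σ (partialProduct n)) n ≡ (A ⊛ σ T) n
  agree zero    = refl
  agree (suc n) = trans (A⊛-suc (σ (partialProduct (suc n))) n)
    (trans (cong₂ ℤ._-_ (truncate (suc n) (suc n) ℕ.≤-refl) (truncate (suc n) n (ℕ.n≤1+n n)))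
           (sym (A⊛-suc (σ T) n)))

-- Congruences

infix 4 _≃_[_] _≋_[_]

record _≃_[_] (a b q : ℤ) : Set where
  constructor congruent
  field diff : q ℤ.∣ a ℤ.- b
open _≃_[_]

record _≋_[_] (f g : ℤ⟦x⟧) (q : ℤ) : Set where
  constructor pointwise
  field at : ∀ n → f n ≃ g n [ q ]
open _≋_[_] renaming (at to at≋)

module _ {q : ℤ} where

  ≃-reflexive : ∀ {a b} → a ≡ b → a ≃ b [ q ]
  ≃-reflexive {a} refl = congruent (divides 0ℤ (ℤ.+-inverseʳ a))

  ≃-refl : ∀ {a} → a ≃ a [ q ]
  ≃-refl = ≃-reflexive refl

  ≃-sym : ∀ {a b} → a ≃ b [ q ] → b ≃ a [ q ]
  ≃-sym {a} {b} (congruent d) = congruent (subst (q ℤ.∣_) (flip-diff a b) (ℤ.∣m⇒∣-m d))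
    where
    flip-diff : ∀ a b → ℤ.- (a ℤ.- b) ≡ b ℤ.- a
    flip-diff = solve-∀

  ≃-trans : ∀ {a b c} → a ≃ b [ q ] → b ≃ c [ q ] → a ≃ c [ q ]
  ≃-trans {a} {b} {c} (congruent d) (congruent e) =
    congruent (subst (q ℤ.∣_) (telescope a b c) (ℤ.∣m∣n⇒∣m+n d e))
    where
    telescope : ∀ a b c → (a ℤ.- b) ℤ.+ (b ℤ.- c) ≡ a ℤ.- c
    telescope = solve-∀

  ≃-+ : ∀ {a b c d} → a ≃ b [ q ] → c ≃ d [ q ] → a ℤ.+ c ≃ b ℤ.+ d [ q ]
  ≃-+ {a} {b} {c} {d} (congruent p) (congruent e) =
    congruent (subst (q ℤ.∣_) (regroup a b c d) (ℤ.∣m∣n⇒∣m+n p e))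
    where
    regroup : ∀ a b c d → (a ℤ.- b) ℤ.+ (c ℤ.- d) ≡ (a ℤ.+ c) ℤ.- (b ℤ.+ d)
    regroup = solve-∀

  ≃-* : ∀ {a b c d} → a ≃ b [ q ] → c ≃ d [ q ] → a ℤ.* c ≃ b ℤ.* d [ q ]
  ≃-* {a} {b} {c} {d} (congruent p) (congruent e) =
    congruent (subst (q ℤ.∣_) (regroup a b c d)
      (ℤ.∣m∣n⇒∣m+n (ℤ.∣m⇒∣m*n c p) (ℤ.∣n⇒∣m*n b e)))
    where
    regroup : ∀ a b c d → (a ℤ.- b) ℤ.* c ℤ.+ b ℤ.* (c ℤ.- d) ≡ a ℤ.* c ℤ.- b ℤ.* d
    regroup = solve-∀

  ≃-neg : ∀ {a b} → a ≃ b [ q ] → ℤ.- a ≃ ℤ.- b [ q ]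
  ≃-neg {a} {b} (congruent d) = congruent (subst (q ℤ.∣_) (push a b) (ℤ.∣m⇒∣-m d))
    where
    push : ∀ a b → ℤ.- (a ℤ.- b) ≡ ℤ.- a ℤ.- (ℤ.- b)
    push = solve-∀

  ∣⇒≃0 : ∀ {a} → q ℤ.∣ a → a ≃ 0ℤ [ q ]
  ∣⇒≃0 {a} d = congruent (subst (q ℤ.∣_) (sym (ℤ.+-identityʳ a)) d)

  ≃0⇒∣ : ∀ {a} → a ≃ 0ℤ [ q ] → q ℤ.∣ a
  ≃0⇒∣ {a} (congruent d) = subst (q ℤ.∣_) (ℤ.+-identityʳ a) d

≃-setoid : ℤ → Setoid 0ℓ 0ℓ
≃-setoid q = record { Carrier = ℤ ; _≈_ = _≃_[ q ]
  ; isEquivalence = record { refl = ≃-refl ; sym = ≃-sym ; trans = ≃-trans } }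

module ≃-Reasoning (q : ℤ) = SetoidReasoning (≃-setoid q)

≃-weaken : ∀ {p q a b} → p ℤ.∣ q → a ≃ b [ q ] → a ≃ b [ p ]
≃-weaken p∣q (congruent d) = congruent (ℤ.∣-trans p∣q d)

module _ {q : ℤ} where

  ≋-reflexive : ∀ {f g} → f ≈ g → f ≋ g [ q ]
  ≋-reflexive p = pointwise λ n → ≃-reflexive (at p n)

  ≋-refl : ∀ {f} → f ≋ f [ q ]
  ≋-refl = pointwise λ n → ≃-refl

  ≋-sym : ∀ {f g} → f ≋ g [ q ] → g ≋ f [ q ]
  ≋-sym p = pointwise λ n → ≃-sym (at≋ p n)

  ≋-trans : ∀ {f g h} → f ≋ g [ q ] → g ≋ h [ q ] → f ≋ h [ q ]
  ≋-trans p r = pointwise λ n → ≃-trans (at≋ p n) (at≋ r n)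

  ≋-⊛ : ∀ {f f′ g g′} → f ≋ f′ [ q ] → g ≋ g′ [ q ] → f ⊛ g ≋ f′ ⊛ g′ [ q ]
  ≋-⊛ p r = pointwise (go p r)
    where
    go : ∀ {f f′ g g′} → f ≋ f′ [ q ] → g ≋ g′ [ q ] → ∀ n → (f ⊛ g) n ≃ (f′ ⊛ g′) n [ q ]
    go p r zero    = ≃-+ (≃-* (at≋ p 0) (at≋ r 0)) ≃-refl
    go p r (suc n) = ≃-+ (≃-* (at≋ p 0) (at≋ r (suc n))) (go (pointwise (at≋ p ∘ suc)) r n)

  ≋-^ᵖ : ∀ {f g} n → f ≋ g [ q ] → f ^ᵖ n ≋ g ^ᵖ n [ q ]
  ≋-^ᵖ zero    p = ≋-refl
  ≋-^ᵖ (suc n) p = ≋-⊛ p (≋-^ᵖ n p)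

  σ-≃≤ : ∀ {f g} n → (∀ k → k ≤ n → f k ≃ g k [ q ]) → σ f n ≃ σ g n [ q ]
  σ-≃≤ zero          p = p 0 z≤n
  σ-≃≤ (suc zero)    p = ≃-refl
  σ-≃≤ (suc (suc n)) p = σ-≃≤ n λ k k≤n → p (suc k) (s≤s (ℕ.m≤n⇒m≤1+n k≤n))

  ≋-σ : ∀ {f g} → f ≋ g [ q ] → σ f ≋ σ g [ q ]
  ≋-σ p = pointwise λ n → σ-≃≤ n λ k _ → at≋ p k

  ≋-U : ∀ {f g} → f ≋ g [ q ] → U f ≋ U g [ q ]
  ≋-U {f} {g} p = pointwise λ n →
    subst₂ (_≃_[ q ]) (sym (U-at f n)) (sym (U-at g n)) (at≋ p (2 * n))

≋-setoid : ℤ → Setoid 0ℓ 0ℓ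
≋-setoid q = record { Carrier = ℤ⟦x⟧ ; _≈_ = _≋_[ q ]
  ; isEquivalence = record { refl = ≋-refl ; sym = ≋-sym ; trans = ≋-trans } }

module ≋-Reasoning (q : ℤ) = SetoidReasoning (≋-setoid q)

-- With f = g + q h the squares differ by q h (2g + q h), and 2g + q h is even because q is.
≃-square : ∀ {q f g} → + 2 ℤ.∣ q → f ≋ g [ q ] → f ⊛ f ≋ g ⊛ g [ q ℤ.* + 2 ]
≃-square {q} {f} {g} 2∣q f≋g = pointwise λ n → congruent
  (subst (q ℤ.* + 2 ℤ.∣_) (sym (difference n)) (ℤ.*-monoʳ-∣ q (≃0⇒∣ (at≋ even n))))
  where
  h : ℤ⟦x⟧
  h n = quotient (diff (at≋ f≋g n))
  f≈ : f ≈ g ⊕ q • h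
  f≈ = pointwise λ n → trans (split (f n) (g n))
    (cong (ℤ._+_ (g n)) (trans (ℤ._∣_.equality (diff (at≋ f≋g n))) (ℤ.*-comm (h n) q)))
    where
    split : ∀ a b → a ≡ b ℤ.+ (a ℤ.- b)
    split = solve-∀
  even : h ⊛ (g ⊕ g ⊕ q • h) ≋ 𝟘 [ + 2 ]
  even = ≋-trans (≋-⊛ (≋-refl {f = h}) (pointwise vanishes))
                 (≋-reflexive (≈-trans (⊛-comm h 𝟘) (⊛-zeroˡ h)))
    where
    vanishes : ∀ n → (g ⊕ g ⊕ q • h) n ≃ 0ℤ [ + 2 ]
    vanishes n = ∣⇒≃0 (ℤ.∣m∣n⇒∣m+n (subst (+ 2 ℤ.∣_) (double (g n)) (ℤ.∣m⇒∣m*n (g n) (ℤ.∣-refl {+ 2})))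
                                  (ℤ.∣m⇒∣m*n (h n) 2∣q))
      where
      double : ∀ a → + 2 ℤ.* a ≡ a ℤ.+ a
      double = solve-∀
  square : f ⊛ f ≈ g ⊛ g ⊕ q • (h ⊛ (g ⊕ g ⊕ q • h))
  square = begin
    f ⊛ f
      ≈⟨ ⊛-cong f≈ f≈ ⟩
    (g ⊕ q • h) ⊛ (g ⊕ q • h)
      ≈⟨ solve 2 (λ g k → (g :+ k) :* (g :+ k) := g :* g :+ k :* (g :+ g :+ k)) ≈-refl g (q • h) ⟩
    g ⊛ g ⊕ (q • h) ⊛ (g ⊕ g ⊕ q • h)
      ≈⟨ ⊕-congˡ (g ⊛ g) (•-⊛ q h (g ⊕ g ⊕ q • h)) ⟩
    g ⊛ g ⊕ q • (h ⊛ (g ⊕ g ⊕ q • h)) ∎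
    where open ≈-Reasoning
  difference : ∀ n → (f ⊛ f) n ℤ.- (g ⊛ g) n ≡ q ℤ.* (h ⊛ (g ⊕ g ⊕ q • h)) n
  difference n = trans (cong (ℤ._- (g ⊛ g) n) (at square n)) (cancel ((g ⊛ g) n) _)
    where
    cancel : ∀ a b → (a ℤ.+ b) ℤ.- a ≡ b
    cancel = solve-∀

-- Powers of 1 - x modulo 2 and of (1 - x)/(1 + x) modulo powers of 2.

A≋B : A ≋ B [ + 2 ]
A≋B = pointwise λ n → congruent (divides (ℤ.- X n) (difference (𝟙 n) (X n)))
  where
  difference : ∀ a b → (a ℤ.- b) ℤ.- (a ℤ.+ b) ≡ ℤ.- b ℤ.* + 2
  difference = solve-∀

σA≋A² : σ A ≋ A ⊛ A [ + 2 ]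
σA≋A² = ≋-trans (≋-reflexive σ-A) (≋-⊛ (≋-refl {f = A}) (≋-sym A≋B))

-- Frobenius: modulo 2, `σ` acts on A as squaring.
A^2^ : ∀ k → A ^ᵖ (2 ^ k) ≋ factor k [ + 2 ]
A^2^ zero    = ≋-reflexive (≈-trans (⊛-comm A 𝟙) (⊛-identityˡ A))
A^2^ (suc k) = begin
  A ^ᵖ (2 * 2 ^ k)       ≈⟨ ≋-reflexive (^ᵖ-* A 2 (2 ^ k)) ⟨
  (A ^ᵖ 2) ^ᵖ (2 ^ k)    ≈⟨ ≋-^ᵖ (2 ^ k) (≋-reflexive (⊛-congˡ A (≈-trans (⊛-comm A 𝟙) (⊛-identityˡ A)))) ⟩
  (A ⊛ A) ^ᵖ (2 ^ k)     ≈⟨ ≋-^ᵖ (2 ^ k) σA≋A² ⟨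
  σ A ^ᵖ (2 ^ k)         ≈⟨ ≋-reflexive (σ-^ᵖ A (2 ^ k)) ⟨
  σ (A ^ᵖ (2 ^ k))       ≈⟨ ≋-σ (A^2^ k) ⟩
  σ (factor k)           ≈⟨ ≋-reflexive (σ-factor k) ⟩
  factor (suc k)         ∎
  where open ≋-Reasoning (+ 2)

ƛ : ℤ⟦x⟧
ƛ = A ⊛ B⁻¹

-- 1 - x and 1 + x agree modulo 2, and each squaring gains one more factor 2 by `≃-square`.
ƛ^2^ : ∀ k → ƛ ^ᵖ (2 ^ k) ≋ 𝟙 [ + (2 ^ suc k) ]
ƛ^2^ zero    = begin
  ƛ ⊛ 𝟙      ≈⟨ ≋-reflexive (≈-trans (⊛-comm ƛ 𝟙) (⊛-identityˡ ƛ)) ⟩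
  A ⊛ B⁻¹    ≈⟨ ≋-⊛ A≋B (≋-refl {f = B⁻¹}) ⟩
  B ⊛ B⁻¹    ≈⟨ ≋-reflexive B⊛B⁻¹ ⟩
  𝟙          ∎
  where open ≋-Reasoning (+ 2)
ƛ^2^ (suc k) = subst (ƛ ^ᵖ (2 ^ suc k) ≋ 𝟙 [_]) modulus (begin
  ƛ ^ᵖ (2 * 2 ^ k)                ≡⟨ cong (λ e → ƛ ^ᵖ (2 ^ k + e)) (ℕ.+-identityʳ (2 ^ k)) ⟩
  ƛ ^ᵖ (2 ^ k + 2 ^ k)            ≈⟨ ≋-reflexive (^ᵖ-+ ƛ (2 ^ k) (2 ^ k)) ⟩
  ƛ ^ᵖ (2 ^ k) ⊛ ƛ ^ᵖ (2 ^ k)     ≈⟨ ≃-square (divides (+ (2 ^ k)) halve) (ƛ^2^ k) ⟩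
  𝟙 ⊛ 𝟙                           ≈⟨ ≋-reflexive (⊛-identityˡ 𝟙) ⟩
  𝟙                               ∎)
  where
  open ≋-Reasoning (+ (2 ^ suc k) ℤ.* + 2)
  halve : + (2 ^ suc k) ≡ + (2 ^ k) ℤ.* + 2
  halve = trans (cong +_ (ℕ.*-comm 2 (2 ^ k))) (ℤ.pos-* (2 ^ k) 2)
  modulus : + (2 ^ suc k) ℤ.* + 2 ≡ + (2 ^ suc (suc k))
  modulus = trans (sym (ℤ.pos-* (2 ^ suc k) 2)) (cong +_ (ℕ.*-comm (2 ^ suc k) 2))

ƛ^3*2^ : ∀ r → ƛ ^ᵖ (3 * 2 ^ r) ≋ 𝟙 [ + (2 ^ suc r) ]
ƛ^3*2^ r = begin
  ƛ ^ᵖ (3 * 2 ^ r)      ≡⟨ cong (ƛ ^ᵖ_) (ℕ.*-comm 3 (2 ^ r)) ⟩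
  ƛ ^ᵖ (2 ^ r * 3)      ≈⟨ ≋-reflexive (^ᵖ-* ƛ (2 ^ r) 3) ⟨
  (ƛ ^ᵖ (2 ^ r)) ^ᵖ 3   ≈⟨ ≋-^ᵖ 3 (ƛ^2^ r) ⟩
  𝟙 ^ᵖ 3                ≈⟨ ≋-reflexive (𝟙^ᵖ 3) ⟩
  𝟙                     ∎
  where open ≋-Reasoning (+ (2 ^ suc r))

-- The series V and its functional equation.

module _ (m : ℕ) where

  V : ℤ⟦x⟧
  V = A ^ᵖ m ⊛ T ^ᵖ m

  T^m-functional : T ^ᵖ m ≈ A ^ᵖ m ⊛ σ (T ^ᵖ m)
  T^m-functional = begin
    T ^ᵖ m                  ≈⟨ ^ᵖ-cong m T-functional ⟩
    (A ⊛ σ T) ^ᵖ m          ≈⟨ ^ᵖ-⊛ A (σ T) m ⟩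
    A ^ᵖ m ⊛ σ T ^ᵖ m       ≈⟨ ⊛-congˡ (A ^ᵖ m) (σ-^ᵖ T m) ⟨
    A ^ᵖ m ⊛ σ (T ^ᵖ m)     ∎
    where open ≈-Reasoning

  σ-A^m : σ (A ^ᵖ m) ≈ A ^ᵖ m ⊛ B ^ᵖ m
  σ-A^m = begin
    σ (A ^ᵖ m)            ≈⟨ σ-^ᵖ A m ⟩
    σ A ^ᵖ m              ≈⟨ ^ᵖ-cong m σ-A ⟩
    (A ⊛ B) ^ᵖ m          ≈⟨ ^ᵖ-⊛ A B m ⟩
    A ^ᵖ m ⊛ B ^ᵖ m       ∎
    where open ≈-Reasoning

  -- Since σ A = A B, the series ƛ is A² / σ A. This form yields the functional equation of `V` and,
  -- in the descent, the degree bound for `G′`.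
  σ-A^m⊛ƛ^m : σ (A ^ᵖ m) ⊛ ƛ ^ᵖ m ≈ A ^ᵖ m ⊛ A ^ᵖ m
  σ-A^m⊛ƛ^m = begin
    σ (A ^ᵖ m) ⊛ ƛ ^ᵖ m
      ≈⟨ ⊛-cong σ-A^m (^ᵖ-⊛ A B⁻¹ m) ⟩
    (A ^ᵖ m ⊛ B ^ᵖ m) ⊛ (A ^ᵖ m ⊛ B⁻¹ ^ᵖ m)
      ≈⟨ solve 3 (λ a b c → (a :* b) :* (a :* c) := (b :* c) :* (a :* a)) ≈-refl (A ^ᵖ m) (B ^ᵖ m) (B⁻¹ ^ᵖ m) ⟩
    (B ^ᵖ m ⊛ B⁻¹ ^ᵖ m) ⊛ (A ^ᵖ m ⊛ A ^ᵖ m)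
      ≈⟨ ⊛-congʳ (A ^ᵖ m ⊛ A ^ᵖ m) (^ᵖ-inverse m B⊛B⁻¹) ⟩
    𝟙 ⊛ (A ^ᵖ m ⊛ A ^ᵖ m)
      ≈⟨ ⊛-identityˡ (A ^ᵖ m ⊛ A ^ᵖ m) ⟩
    A ^ᵖ m ⊛ A ^ᵖ m ∎
    where open ≈-Reasoning

  V-functional : V ≈ ƛ ^ᵖ m ⊛ σ V
  V-functional = begin
    A ^ᵖ m ⊛ T ^ᵖ m
      ≈⟨ ⊛-congˡ (A ^ᵖ m) T^m-functional ⟩
    A ^ᵖ m ⊛ (A ^ᵖ m ⊛ σ (T ^ᵖ m))
      ≈⟨ ⊛-assoc (A ^ᵖ m) (A ^ᵖ m) (σ (T ^ᵖ m)) ⟨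
    (A ^ᵖ m ⊛ A ^ᵖ m) ⊛ σ (T ^ᵖ m)
      ≈⟨ ⊛-congʳ (σ (T ^ᵖ m)) σ-A^m⊛ƛ^m ⟨
    (σ (A ^ᵖ m) ⊛ ƛ ^ᵖ m) ⊛ σ (T ^ᵖ m)
      ≈⟨ solve 3 (λ a l s → (a :* l) :* s := l :* (a :* s)) ≈-refl (σ (A ^ᵖ m)) (ƛ ^ᵖ m) (σ (T ^ᵖ m)) ⟩
    ƛ ^ᵖ m ⊛ (σ (A ^ᵖ m) ⊛ σ (T ^ᵖ m))
      ≈⟨ ⊛-congˡ (ƛ ^ᵖ m) (σ-⊛ (A ^ᵖ m) (T ^ᵖ m)) ⟨
    ƛ ^ᵖ m ⊛ σ V ∎
    where open ≈-Reasoning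

  V-zero : V 0 ≡ 1ℤ
  V-zero = trans (⊛-zero (A ^ᵖ m) (T ^ᵖ m)) (cong₂ ℤ._*_ (one A refl m) (one T refl m))
    where
    one : ∀ f → f 0 ≡ 1ℤ → ∀ k → (f ^ᵖ k) 0 ≡ 1ℤ
    one f f0≡1 zero    = refl
    one f f0≡1 (suc k) = trans (⊛-zero f (f ^ᵖ k)) (cong₂ ℤ._*_ f0≡1 (one f f0≡1 k))

  T^m≈ : T ^ᵖ m ≈ A⁻¹ ^ᵖ m ⊛ V
  T^m≈ = begin
    T ^ᵖ m                              ≈⟨ ⊛-identityˡ (T ^ᵖ m) ⟨
    𝟙 ⊛ T ^ᵖ m                          ≈⟨ ⊛-congʳ (T ^ᵖ m) (^ᵖ-inverse m A⊛A⁻¹) ⟨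
    (A ^ᵖ m ⊛ A⁻¹ ^ᵖ m) ⊛ T ^ᵖ m        ≈⟨ solve 3 (λ a b c → (a :* b) :* c := b :* (a :* c)) ≈-refl (A ^ᵖ m) (A⁻¹ ^ᵖ m) (T ^ᵖ m) ⟩
    A⁻¹ ^ᵖ m ⊛ V                        ∎
    where open ≈-Reasoning

  -- Modulo q the functional equation reads V(x) ≡ V(x²), so a coefficient of positive degree is
  -- zero or a copy of one of smaller positive degree.
  V≋𝟙 : ∀ {q} → ƛ ^ᵖ m ≋ 𝟙 [ q ] → V ≋ 𝟙 [ q ]
  V≋𝟙 {q} ƛ^m≋𝟙 = pointwise (<-rec (λ n → V n ≃ 𝟙 n [ q ]) go)
    where
    V≋σV : V ≋ σ V [ q ]
    V≋σV = ≋-trans (≋-reflexive V-functional)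
      (≋-trans (≋-⊛ ƛ^m≋𝟙 (≋-refl {f = σ V})) (≋-reflexive (⊛-identityˡ (σ V))))
    go : ∀ n → (∀ {k} → k < n → V k ≃ 𝟙 k [ q ]) → V n ≃ 𝟙 n [ q ]
    go zero                _   = ≃-reflexive V-zero
    go (suc zero)          rec = at≋ V≋σV 1
    go (suc (suc n))       rec = ≃-trans (at≋ V≋σV (suc (suc n)))
      (≃-trans (σ-≃≤ n λ k k≤n → rec (s≤s (s≤s k≤n))) (≃-reflexive (at σ-𝟙 (suc (suc n)))))

-- Differential identities and finite sums

θ-⊕ : ∀ f g → θ (f ⊕ g) ≈ θ f ⊕ θ g
θ-⊕ f g = pointwise λ n → ℤ.*-distribˡ-+ (+ n) (f n) (g n)

θ-neg : ∀ f → θ (neg f) ≈ neg (θ f)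
θ-neg f = pointwise λ n → sym (ℤ.neg-distribʳ-* (+ n) (f n))

θ-𝟙 : θ 𝟙 ≈ 𝟘
θ-𝟙 = pointwise λ { zero → refl ; (suc n) → ℤ.*-zeroʳ (+ suc n) }

θ-X : θ X ≈ X
θ-X = pointwise λ { zero → refl ; (suc zero) → refl ; (suc (suc n)) → ℤ.*-zeroʳ (+ suc (suc n)) }

⊕-identityˡ : ∀ f → 𝟘 ⊕ f ≈ f
⊕-identityˡ f = pointwise λ n → ℤ.+-identityˡ (f n)

θ-A : θ A ≈ neg X
θ-A = begin
  θ A                  ≈⟨ θ-cong A≈ ⟩
  θ (𝟙 ⊕ neg X)        ≈⟨ θ-⊕ 𝟙 (neg X) ⟩
  θ 𝟙 ⊕ θ (neg X)      ≈⟨ ⊕-cong θ-𝟙 (≈-trans (θ-neg X) (neg-cong θ-X)) ⟩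
  𝟘 ⊕ neg X            ≈⟨ ⊕-identityˡ (neg X) ⟩
  neg X                ∎
  where open ≈-Reasoning

θ-B : θ B ≈ X
θ-B = begin
  θ B          ≈⟨ θ-⊕ 𝟙 X ⟩
  θ 𝟙 ⊕ θ X    ≈⟨ ⊕-cong θ-𝟙 θ-X ⟩
  𝟘 ⊕ X        ≈⟨ ⊕-identityˡ X ⟩
  X            ∎
  where open ≈-Reasoning

θ-B⁻¹ : θ B⁻¹ ≈ neg (X ⊛ (B⁻¹ ⊛ B⁻¹))
θ-B⁻¹ = begin
  θ B⁻¹
    ≈⟨ ⊛-identityˡ (θ B⁻¹) ⟨
  𝟙 ⊛ θ B⁻¹
    ≈⟨ ⊛-congʳ (θ B⁻¹) B⊛B⁻¹ ⟨
  (B ⊛ B⁻¹) ⊛ θ B⁻¹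
    ≈⟨ solve 4 (λ b c x d → (b :* c) :* d := c :* (x :* c :+ b :* d) :+ :- (x :* (c :* c))) ≈-refl B B⁻¹ X (θ B⁻¹) ⟩
  B⁻¹ ⊛ (X ⊛ B⁻¹ ⊕ B ⊛ θ B⁻¹) ⊕ neg (X ⊛ (B⁻¹ ⊛ B⁻¹))
    ≈⟨ ⊕-congʳ (neg (X ⊛ (B⁻¹ ⊛ B⁻¹))) (⊛-congˡ B⁻¹ constant) ⟩
  B⁻¹ ⊛ 𝟘 ⊕ neg (X ⊛ (B⁻¹ ⊛ B⁻¹))
    ≈⟨ ⊕-congʳ (neg (X ⊛ (B⁻¹ ⊛ B⁻¹))) (≈-trans (⊛-comm B⁻¹ 𝟘) (⊛-zeroˡ B⁻¹)) ⟩
  𝟘 ⊕ neg (X ⊛ (B⁻¹ ⊛ B⁻¹))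
    ≈⟨ ⊕-identityˡ (neg (X ⊛ (B⁻¹ ⊛ B⁻¹))) ⟩
  neg (X ⊛ (B⁻¹ ⊛ B⁻¹)) ∎
  where
  open ≈-Reasoning
  constant : X ⊛ B⁻¹ ⊕ B ⊛ θ B⁻¹ ≈ 𝟘
  constant = begin
    X ⊛ B⁻¹ ⊕ B ⊛ θ B⁻¹     ≈⟨ ⊕-congʳ (B ⊛ θ B⁻¹) (⊛-congʳ B⁻¹ θ-B) ⟨
    θ B ⊛ B⁻¹ ⊕ B ⊛ θ B⁻¹   ≈⟨ θ-⊛ B B⁻¹ ⟨
    θ (B ⊛ B⁻¹)             ≈⟨ θ-cong B⊛B⁻¹ ⟩
    θ 𝟙                     ≈⟨ θ-𝟙 ⟩
    𝟘                       ∎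

scalar : ∀ k f → k • f ≈ (k • 𝟙) ⊛ f
scalar k f = ≈-sym (≈-trans (•-⊛ k 𝟙 f) (•-cong k (⊛-identityˡ f)))

θ-ƛ : θ ƛ ≈ neg (+ 2 • (X ⊛ (B⁻¹ ⊛ B⁻¹)))
θ-ƛ = begin
  θ ƛ
    ≈⟨ θ-⊛ A B⁻¹ ⟩
  θ A ⊛ B⁻¹ ⊕ A ⊛ θ B⁻¹
    ≈⟨ ⊕-cong (⊛-cong θ-A (≈-sym (≈-trans (⊛-comm B⁻¹ 𝟙) (⊛-identityˡ B⁻¹)))) (⊛-cong A≈ θ-B⁻¹) ⟩
  neg X ⊛ (B⁻¹ ⊛ 𝟙) ⊕ (𝟙 ⊕ neg X) ⊛ neg (X ⊛ (B⁻¹ ⊛ B⁻¹))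
    -- Writing the factor 1 as (1 + x)(1 + x)⁻¹ puts both terms over (1 + x)².
    ≈⟨ ⊕-congʳ ((𝟙 ⊕ neg X) ⊛ neg (X ⊛ (B⁻¹ ⊛ B⁻¹))) (⊛-congˡ (neg X) (⊛-congˡ B⁻¹ B⊛B⁻¹)) ⟨
  neg X ⊛ (B⁻¹ ⊛ (B ⊛ B⁻¹)) ⊕ (𝟙 ⊕ neg X) ⊛ neg (X ⊛ (B⁻¹ ⊛ B⁻¹))
    ≈⟨ solve 3 (λ i x c → :- x :* (c :* ((i :+ x) :* c)) :+ (i :+ :- x) :* :- (x :* (c :* c))
                       := :- (con (+ 2) :* (i :* (x :* (c :* c))))) ≈-refl 𝟙 X B⁻¹ ⟩
  neg ((+ 2 • 𝟙) ⊛ (𝟙 ⊛ (X ⊛ (B⁻¹ ⊛ B⁻¹))))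
    ≈⟨ neg-cong (≈-trans (⊛-congˡ (+ 2 • 𝟙) (⊛-identityˡ (X ⊛ (B⁻¹ ⊛ B⁻¹)))) (≈-sym (scalar (+ 2) (X ⊛ (B⁻¹ ⊛ B⁻¹))))) ⟩
  neg (+ 2 • (X ⊛ (B⁻¹ ⊛ B⁻¹))) ∎
  where open ≈-Reasoning

⊛-• : ∀ k f g → f ⊛ (k • g) ≈ k • (f ⊛ g)
⊛-• k f g = ≈-trans (⊛-comm f (k • g)) (≈-trans (•-⊛ k g f) (•-cong k (⊛-comm g f)))

-- The companion `⊛θ-^ᵖ` carries an extra factor f, which covers the exponent 0 without a
-- predecessor; each form feeds the other in the induction.
θ-^ᵖ : ∀ f k → θ (f ^ᵖ suc k) ≈ + suc k • (f ^ᵖ k ⊛ θ f)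
⊛θ-^ᵖ : ∀ f k → f ⊛ θ (f ^ᵖ k) ≈ + k • (f ^ᵖ k ⊛ θ f)

θ-^ᵖ f k = begin
  θ (f ⊛ f ^ᵖ k)
    ≈⟨ θ-⊛ f (f ^ᵖ k) ⟩
  θ f ⊛ f ^ᵖ k ⊕ f ⊛ θ (f ^ᵖ k)
    ≈⟨ ⊕-cong (⊛-comm (θ f) (f ^ᵖ k)) (⊛θ-^ᵖ f k) ⟩
  f ^ᵖ k ⊛ θ f ⊕ + k • (f ^ᵖ k ⊛ θ f)
    ≈⟨ pointwise (λ n → sym (ℤ.suc-* (+ k) ((f ^ᵖ k ⊛ θ f) n))) ⟩
  + suc k • (f ^ᵖ k ⊛ θ f) ∎
  where open ≈-Reasoning

⊛θ-^ᵖ f zero    = begin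
  f ⊛ θ 𝟙                ≈⟨ ⊛-congˡ f θ-𝟙 ⟩
  f ⊛ 𝟘                  ≈⟨ ≈-trans (⊛-comm f 𝟘) (⊛-zeroˡ f) ⟩
  0ℤ • (𝟙 ⊛ θ f)         ∎
  where open ≈-Reasoning
⊛θ-^ᵖ f (suc k) = begin
  f ⊛ θ (f ^ᵖ suc k)                   ≈⟨ ⊛-congˡ f (θ-^ᵖ f k) ⟩
  f ⊛ (+ suc k • (f ^ᵖ k ⊛ θ f))       ≈⟨ ⊛-• (+ suc k) f (f ^ᵖ k ⊛ θ f) ⟩
  + suc k • (f ⊛ (f ^ᵖ k ⊛ θ f))       ≈⟨ •-cong (+ suc k) (⊛-assoc f (f ^ᵖ k) (θ f)) ⟨
  + suc k • (f ^ᵖ suc k ⊛ θ f)         ∎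
  where open ≈-Reasoning

-- With P = (1 - x)ᵐ⁻¹ G, the polynomial (1 - x)ᵐ θ G is expressed through P alone.
A^m⊛θ : ∀ m₁ G → let P = A ^ᵖ m₁ ⊛ G in
        A ^ᵖ suc m₁ ⊛ θ G ≈ A ⊛ θ P ⊕ + m₁ • (X ⊛ P)
A^m⊛θ m₁ G = ≈-sym (begin
  A ⊛ θ P ⊕ + m₁ • (X ⊛ P)
    ≈⟨ ⊕-congʳ (+ m₁ • (X ⊛ P)) (⊛-congˡ A (θ-⊛ (A ^ᵖ m₁) G)) ⟩
  A ⊛ (θ (A ^ᵖ m₁) ⊛ G ⊕ A ^ᵖ m₁ ⊛ θ G) ⊕ + m₁ • (X ⊛ P)
    ≈⟨ solve 6 (λ a d g p t r → a :* (d :* g :+ p :* t) :+ r := (a :* d) :* g :+ (a :* p) :* t :+ r)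
         ≈-refl A (θ (A ^ᵖ m₁)) G (A ^ᵖ m₁) (θ G) (+ m₁ • (X ⊛ P)) ⟩
  (A ⊛ θ (A ^ᵖ m₁)) ⊛ G ⊕ A ^ᵖ suc m₁ ⊛ θ G ⊕ + m₁ • (X ⊛ P)
    ≈⟨ ⊕-cong (⊕-congʳ (A ^ᵖ suc m₁ ⊛ θ G) (⊛-congʳ G derivative)) (scalar (+ m₁) (X ⊛ P)) ⟩
  ((+ m₁ • 𝟙) ⊛ (A ^ᵖ m₁ ⊛ neg X)) ⊛ G ⊕ A ^ᵖ suc m₁ ⊛ θ G ⊕ (+ m₁ • 𝟙) ⊛ (X ⊛ P)
    ≈⟨ solve 5 (λ k p x g s → (k :* (p :* :- x)) :* g :+ s :+ k :* (x :* (p :* g)) := s)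
         ≈-refl (+ m₁ • 𝟙) (A ^ᵖ m₁) X G (A ^ᵖ suc m₁ ⊛ θ G) ⟩
  A ^ᵖ suc m₁ ⊛ θ G ∎)
  where
  open ≈-Reasoning
  P : ℤ⟦x⟧
  P = A ^ᵖ m₁ ⊛ G
  derivative : A ⊛ θ (A ^ᵖ m₁) ≈ (+ m₁ • 𝟙) ⊛ (A ^ᵖ m₁ ⊛ neg X)
  derivative = begin
    A ⊛ θ (A ^ᵖ m₁)                   ≈⟨ ⊛θ-^ᵖ A m₁ ⟩
    + m₁ • (A ^ᵖ m₁ ⊛ θ A)            ≈⟨ •-cong (+ m₁) (⊛-congˡ (A ^ᵖ m₁) θ-A) ⟩
    + m₁ • (A ^ᵖ m₁ ⊛ neg X)          ≈⟨ scalar (+ m₁) (A ^ᵖ m₁ ⊛ neg X) ⟩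
    (+ m₁ • 𝟙) ⊛ (A ^ᵖ m₁ ⊛ neg X)    ∎

A^m⊛θ-zero : ∀ m₁ G → (A ^ᵖ suc m₁ ⊛ θ G) 0 ≡ 0ℤ
A^m⊛θ-zero m₁ G = trans (⊛-zero (A ^ᵖ suc m₁) (θ G)) (ℤ.*-zeroʳ ((A ^ᵖ suc m₁) 0))

-- The factor m₁ - l vanishes at l = m₁ and so separates the degrees above m₁ from those below; the
-- degree bounds of the descent rest on this.
A^m⊛θ-suc : ∀ m₁ G l → let P = A ^ᵖ m₁ ⊛ G in
            (A ^ᵖ suc m₁ ⊛ θ G) (suc l) ≡ + suc l ℤ.* P (suc l) ℤ.+ (+ m₁ ℤ.- + l) ℤ.* P l
A^m⊛θ-suc m₁ G l = begin
  (A ^ᵖ suc m₁ ⊛ θ G) (suc l)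
    ≡⟨ at (A^m⊛θ m₁ G) (suc l) ⟩
  (A ⊛ θ P) (suc l) ℤ.+ + m₁ ℤ.* (X ⊛ P) (suc l)
    ≡⟨ cong₂ (λ a b → a ℤ.+ + m₁ ℤ.* b) (A⊛-suc (θ P) l) (X⊛-suc P l) ⟩
  (+ suc l ℤ.* P (suc l) ℤ.- + l ℤ.* P l) ℤ.+ + m₁ ℤ.* P l
    ≡⟨ collect (+ suc l ℤ.* P (suc l)) (+ l) (+ m₁) (P l) ⟩
  + suc l ℤ.* P (suc l) ℤ.+ (+ m₁ ℤ.- + l) ℤ.* P l ∎
  where
  open ≡-Reasoning
  P : ℤ⟦x⟧
  P = A ^ᵖ m₁ ⊛ G
  collect : ∀ a l m p → (a ℤ.- l ℤ.* p) ℤ.+ m ℤ.* p ≡ a ℤ.+ (m ℤ.- l) ℤ.* p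
  collect = solve-∀

-- Product rule with θƛ = -2x / (1 + x)². The correction involves G only through P, so its
-- coefficients are sums of bounded length once P is a polynomial.
ƛ^m⊛θ : ∀ m₁ G → let m = suc m₁ ; P = A ^ᵖ m₁ ⊛ G in
        ƛ ^ᵖ m ⊛ θ G ≈ θ (ƛ ^ᵖ m ⊛ G) ⊕ + (2 * m) • (X ⊛ (P ⊛ B⁻¹ ^ᵖ suc m))
ƛ^m⊛θ m₁ G = ≈-sym (begin
  θ (ƛ ^ᵖ m ⊛ G) ⊕ + (2 * m) • K
    ≈⟨ ⊕-congʳ (+ (2 * m) • K) (θ-⊛ (ƛ ^ᵖ m) G) ⟩
  θ (ƛ ^ᵖ m) ⊛ G ⊕ ƛ ^ᵖ m ⊛ θ G ⊕ + (2 * m) • K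
    ≈⟨ ⊕-congʳ (+ (2 * m) • K) (⊕-congʳ (ƛ ^ᵖ m ⊛ θ G) θƛ^m⊛G) ⟩
  neg (+ (2 * m) • K) ⊕ ƛ ^ᵖ m ⊛ θ G ⊕ + (2 * m) • K
    ≈⟨ solve 2 (λ k s → :- k :+ s :+ k := s) ≈-refl (+ (2 * m) • K) (ƛ ^ᵖ m ⊛ θ G) ⟩
  ƛ ^ᵖ m ⊛ θ G ∎)
  where
  open ≈-Reasoning
  m : ℕ
  m = suc m₁
  K Y : ℤ⟦x⟧
  K = X ⊛ ((A ^ᵖ m₁ ⊛ G) ⊛ B⁻¹ ^ᵖ suc m)
  Y = X ⊛ (B⁻¹ ⊛ B⁻¹)
  θƛ^m⊛G : θ (ƛ ^ᵖ m) ⊛ G ≈ neg (+ (2 * m) • K)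
  θƛ^m⊛G = begin
    θ (ƛ ^ᵖ m) ⊛ G
      ≈⟨ ⊛-congʳ G (θ-^ᵖ ƛ m₁) ⟩
    (+ m • (ƛ ^ᵖ m₁ ⊛ θ ƛ)) ⊛ G
      ≈⟨ ⊛-congʳ G (≈-trans (•-cong (+ m) (⊛-cong (^ᵖ-⊛ A B⁻¹ m₁) (≈-trans θ-ƛ (neg-cong (scalar (+ 2) Y)))))
                            (scalar (+ m) ((A ^ᵖ m₁ ⊛ B⁻¹ ^ᵖ m₁) ⊛ neg ((+ 2 • 𝟙) ⊛ Y)))) ⟩
    ((+ m • 𝟙) ⊛ ((A ^ᵖ m₁ ⊛ B⁻¹ ^ᵖ m₁) ⊛ neg ((+ 2 • 𝟙) ⊛ Y))) ⊛ G
      ≈⟨ solve 5 (λ k t u y g → (k :* (u :* :- (t :* y))) :* g := :- (t :* (k :* ((u :* y) :* g))))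
           ≈-refl (+ m • 𝟙) (+ 2 • 𝟙) (A ^ᵖ m₁ ⊛ B⁻¹ ^ᵖ m₁) Y G ⟩
    neg ((+ 2 • 𝟙) ⊛ ((+ m • 𝟙) ⊛ (((A ^ᵖ m₁ ⊛ B⁻¹ ^ᵖ m₁) ⊛ Y) ⊛ G)))
      ≈⟨ neg-cong (⊛-congˡ (+ 2 • 𝟙) (⊛-congˡ (+ m • 𝟙)
           (solve 5 (λ a c i x g → ((a :* c) :* (x :* (i :* i))) :* g := x :* ((a :* g) :* (i :* (i :* c))))
             ≈-refl (A ^ᵖ m₁) (B⁻¹ ^ᵖ m₁) B⁻¹ X G))) ⟩
    neg ((+ 2 • 𝟙) ⊛ ((+ m • 𝟙) ⊛ K))
      ≈⟨ neg-cong (begin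
        (+ 2 • 𝟙) ⊛ ((+ m • 𝟙) ⊛ K)  ≈⟨ scalar (+ 2) ((+ m • 𝟙) ⊛ K) ⟨
        + 2 • ((+ m • 𝟙) ⊛ K)        ≈⟨ •-cong (+ 2) (scalar (+ m) K) ⟨
        + 2 • (+ m • K)              ≈⟨ pointwise (λ n → trans (sym (ℤ.*-assoc (+ 2) (+ m) (K n)))
                                                          (cong (ℤ._* K n) (sym (ℤ.pos-* 2 m)))) ⟩
        + (2 * m) • K                ∎) ⟩
    neg (+ (2 * m) • K) ∎

Vanishes : ℕ → ℤ⟦x⟧ → Set
Vanishes d f = ∀ n → d ≤ n → f n ≡ 0ℤ

vanishes-A⊛ : ∀ {d f} → Vanishes d f → Vanishes (suc d) (A ⊛ f)
vanishes-A⊛ {f = f} v (suc n) (s≤s d≤n) =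
  trans (A⊛-suc f n) (cong₂ ℤ._-_ (v (suc n) (ℕ.m≤n⇒m≤1+n d≤n)) (v n d≤n))

vanishes-A^⊛ : ∀ k {d f} → Vanishes d f → Vanishes (k + d) (A ^ᵖ k ⊛ f)
vanishes-A^⊛ zero    {f = f} v n d≤n = trans (at (⊛-identityˡ f) n) (v n d≤n)
vanishes-A^⊛ (suc k) {f = f} v n d≤n =
  trans (at (⊛-assoc A (A ^ᵖ k) f) n) (vanishes-A⊛ (vanishes-A^⊛ k v) n d≤n)

Σ< : ℕ → (ℕ → ℤ) → ℤ
Σ< zero    a = 0ℤ
Σ< (suc n) a = a 0 ℤ.+ Σ< n (a ∘ suc)

Σ<-cong : ∀ n {a b} → (∀ i → i < n → a i ≡ b i) → Σ< n a ≡ Σ< n b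
Σ<-cong zero    p = refl
Σ<-cong (suc n) p = cong₂ ℤ._+_ (p 0 (s≤s z≤n)) (Σ<-cong n λ i i<n → p (suc i) (s≤s i<n))

Σ<-* : ∀ n k a → Σ< n (λ i → k ℤ.* a i) ≡ k ℤ.* Σ< n a
Σ<-* zero    k a = sym (ℤ.*-zeroʳ k)
Σ<-* (suc n) k a = trans (cong (ℤ._+_ (k ℤ.* a 0)) (Σ<-* n k (a ∘ suc)))
                         (sym (ℤ.*-distribˡ-+ k (a 0) (Σ< n (a ∘ suc))))

Σ<-+ : ∀ k l a → Σ< (k + l) a ≡ Σ< k a ℤ.+ Σ< l (λ i → a (k + i))
Σ<-+ zero    l a = sym (ℤ.+-identityˡ _)
Σ<-+ (suc k) l a = trans (cong (ℤ._+_ (a 0)) (Σ<-+ k l (a ∘ suc))) (sym (ℤ.+-assoc (a 0) _ _))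

Σ<-≃ : ∀ {q} n {a b} → (∀ i → i < n → a i ≃ b i [ q ]) → Σ< n a ≃ Σ< n b [ q ]
Σ<-≃ zero    p = ≃-refl
Σ<-≃ (suc n) p = ≃-+ (p 0 (s≤s z≤n)) (Σ<-≃ n λ i i<n → p (suc i) (s≤s i<n))

Σ<-zero : ∀ n → Σ< n (λ _ → 0ℤ) ≡ 0ℤ
Σ<-zero zero    = refl
Σ<-zero (suc n) = trans (ℤ.+-identityˡ _) (Σ<-zero n)

Σ<-telescope : ∀ n f a → Σ< n (λ i → (A ⊛ f) (suc a + i)) ≡ f (a + n) ℤ.- f a
Σ<-telescope zero    f a = trans (sym (ℤ.+-inverseʳ (f a))) (cong (λ k → f k ℤ.- f a) (sym (ℕ.+-identityʳ a)))
Σ<-telescope (suc n) f a = begin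
  (A ⊛ f) (suc a + 0) ℤ.+ Σ< n (λ i → (A ⊛ f) (suc a + suc i))
    ≡⟨ cong₂ ℤ._+_ (trans (cong (A ⊛ f) (ℕ.+-identityʳ (suc a))) (A⊛-suc f a))
                   (trans (Σ<-cong n λ i _ → cong (A ⊛ f) (ℕ.+-suc (suc a) i)) (Σ<-telescope n f (suc a))) ⟩
  (f (suc a) ℤ.- f a) ℤ.+ (f (suc a + n) ℤ.- f (suc a))
    ≡⟨ telescope (f a) (f (suc a)) (f (suc a + n)) ⟩
  f (suc a + n) ℤ.- f a
    ≡⟨ cong (λ k → f k ℤ.- f a) (ℕ.+-suc a n) ⟨
  f (a + suc n) ℤ.- f a ∎
  where
  open ≡-Reasoning
  telescope : ∀ a b c → (b ℤ.- a) ℤ.+ (c ℤ.- b) ≡ c ℤ.- a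
  telescope = solve-∀

shift : ℕ → ℤ⟦x⟧ → ℤ⟦x⟧
shift zero    f n       = f n
shift (suc i) f zero    = 0ℤ
shift (suc i) f (suc n) = shift i f n

⊛-polynomial : ∀ d {P} f → Vanishes d P → ∀ n → (P ⊛ f) n ≡ Σ< d (λ i → P i ℤ.* shift i f n)
⊛-polynomial zero    {P} f v n = trans (at (⊛-congʳ f (pointwise λ k → v k z≤n)) n) (at (⊛-zeroˡ f) n)
⊛-polynomial (suc d) {P} f v zero    = cong (ℤ._+_ (P 0 ℤ.* f 0))
  (sym (trans (Σ<-cong d λ i _ → ℤ.*-zeroʳ (P (suc i))) (Σ<-zero d)))
⊛-polynomial (suc d) {P} f v (suc n) = cong (ℤ._+_ (P 0 ℤ.* f (suc n)))
  (⊛-polynomial d f (λ k d≤k → v (suc k) (s≤s d≤k)) n)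

X⊛-shift : ∀ d {P} f → Vanishes d P → ∀ n →
           (X ⊛ (P ⊛ f)) n ≡ Σ< d (λ i → P i ℤ.* shift (suc i) f n)
X⊛-shift d {P} f v zero    = sym (trans (Σ<-cong d λ i _ → ℤ.*-zeroʳ (P i)) (Σ<-zero d))
X⊛-shift d {P} f v (suc n) = trans (X⊛-suc (P ⊛ f) n) (⊛-polynomial d f v n)

x^⊛-shift : ∀ k f n → ((x^ k) ⊛ f) n ≡ shift k f n
x^⊛-shift zero    f n       = at (⊛-identityˡ f) n
x^⊛-shift (suc k) f zero    = refl
x^⊛-shift (suc k) f (suc n) = trans (ℤ.+-identityˡ _) (x^⊛-shift k f n)

shift-+ : ∀ k f n → shift k f (k + n) ≡ f n
shift-+ zero    f n = refl
shift-+ (suc k) f n = shift-+ k f n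

shift-< : ∀ {k n} f → n < k → shift k f n ≡ 0ℤ
shift-< {suc k} {zero}  f _         = refl
shift-< {suc k} {suc n} f (s≤s n<k) = shift-< f n<k

-- Halving the exponent

solve-for : ∀ f g h k → f ⊛ g ≈ 𝟙 → f ⊛ h ≈ k → h ≈ g ⊛ k
solve-for f g h k fg≈𝟙 fh≈k = begin
  h              ≈⟨ ⊛-identityˡ h ⟨
  𝟙 ⊛ h          ≈⟨ ⊛-congʳ h fg≈𝟙 ⟨
  (f ⊛ g) ⊛ h    ≈⟨ solve 3 (λ f g h → (f :* g) :* h := g :* (f :* h)) ≈-refl f g h ⟩
  g ⊛ (f ⊛ h)    ≈⟨ ⊛-congˡ g fh≈k ⟩
  g ⊛ k          ∎
  where open ≈-Reasoning

pascal : ∀ n k → + ((suc n + suc k) C suc k) ≡ + ((suc n + k) C k) ℤ.+ + ((n + suc k) C suc k)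
pascal n k = trans (cong +_ (sym (nCk+nC[k+1]≡[n+1]C[k+1] (n + suc k) k)))
  (trans (ℤ.pos-+ ((n + suc k) C k) ((n + suc k) C suc k))
         (cong (λ N → + (N C k) ℤ.+ + ((n + suc k) C suc k)) (ℕ.+-suc n k)))

A⁻¹^ : ∀ k n → (A⁻¹ ^ᵖ suc k) n ≡ + ((n + k) C k)
A⁻¹^ zero    n = trans (at (≈-trans (⊛-comm A⁻¹ 𝟙) (⊛-identityˡ A⁻¹)) n) refl
A⁻¹^ (suc k) n = sym (at (solve-for A A⁻¹ G (A⁻¹ ^ᵖ suc k) A⊛A⁻¹ (pointwise difference)) n)
  where
  G : ℤ⟦x⟧
  G n = + ((n + suc k) C suc k)
  cancel : ∀ a b → (a ℤ.+ b) ℤ.- b ≡ a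
  cancel = solve-∀
  one : ∀ k → + (k C k) ≡ 1ℤ
  one k = cong +_ (nCn≡1 k)
  difference : ∀ n → (A ⊛ G) n ≡ (A⁻¹ ^ᵖ suc k) n
  difference zero    = trans (A⊛-zero G) (trans (one (suc k)) (sym (trans (A⁻¹^ k 0) (one k))))
  difference (suc n) = trans (A⊛-suc G n) (trans (cong (ℤ._- G n) (pascal n k))
    (trans (cancel (+ ((suc n + k) C k)) (G n)) (sym (A⁻¹^ k (suc n)))))

-- `B⁻¹ n` is the sign (-1)ⁿ and also serves as such in the formulas that follow.
B⁻¹^ : ∀ k n → (B⁻¹ ^ᵖ suc k) n ≡ B⁻¹ n ℤ.* + ((n + k) C k)
B⁻¹^ zero    n = trans (at (≈-trans (⊛-comm B⁻¹ 𝟙) (⊛-identityˡ B⁻¹)) n) (sym (ℤ.*-identityʳ (B⁻¹ n)))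
B⁻¹^ (suc k) n = sym (at (solve-for B B⁻¹ G (B⁻¹ ^ᵖ suc k) B⊛B⁻¹ (pointwise total)) n)
  where
  G : ℤ⟦x⟧
  G n = B⁻¹ n ℤ.* + ((n + suc k) C suc k)
  cancel : ∀ s a b → ℤ.- s ℤ.* (a ℤ.+ b) ℤ.+ s ℤ.* b ≡ ℤ.- s ℤ.* a
  cancel = solve-∀
  one : ∀ k → 1ℤ ℤ.* + (k C k) ≡ 1ℤ
  one k = cong (λ c → 1ℤ ℤ.* + c) (nCn≡1 k)
  total : ∀ n → (B ⊛ G) n ≡ (B⁻¹ ^ᵖ suc k) n
  total zero    = trans (at (B⊛ G) 0) (trans (ℤ.+-identityʳ (G 0)) (trans (one (suc k)) (sym (trans (B⁻¹^ k 0) (one k)))))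
  total (suc n) = trans (B⊛-suc G n) (trans (cong (λ c → ℤ.- B⁻¹ n ℤ.* c ℤ.+ G n) (pascal n k))
    (trans (cancel (B⁻¹ n) (+ ((suc n + k) C k)) (+ ((n + suc k) C suc k))) (sym (B⁻¹^ k (suc n)))))

A^-coefficient : ∀ k l → (A ^ᵖ k) l ≡ B⁻¹ l ℤ.* + (k C l)
A^-coefficient zero    zero    = refl
A^-coefficient zero    (suc l) = sym (ℤ.*-zeroʳ (B⁻¹ (suc l)))
A^-coefficient (suc k) zero    = trans (A⊛-zero (A ^ᵖ k)) (A^-coefficient k 0)
A^-coefficient (suc k) (suc l) = begin
  (A ⊛ A ^ᵖ k) (suc l)
    ≡⟨ A⊛-suc (A ^ᵖ k) l ⟩
  (A ^ᵖ k) (suc l) ℤ.- (A ^ᵖ k) l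
    ≡⟨ cong₂ ℤ._-_ (A^-coefficient k (suc l)) (A^-coefficient k l) ⟩
  ℤ.- B⁻¹ l ℤ.* + (k C suc l) ℤ.- B⁻¹ l ℤ.* + (k C l)
    ≡⟨ collect (B⁻¹ l) (+ (k C suc l)) (+ (k C l)) ⟩
  ℤ.- B⁻¹ l ℤ.* (+ (k C l) ℤ.+ + (k C suc l))
    ≡⟨ cong (λ c → ℤ.- B⁻¹ l ℤ.* c) (trans (sym (ℤ.pos-+ (k C l) (k C suc l))) (cong +_ (nCk+nC[k+1]≡[n+1]C[k+1] k l))) ⟩
  B⁻¹ (suc l) ℤ.* + (suc k C suc l) ∎
  where
  open ≡-Reasoning
  collect : ∀ s a b → ℤ.- s ℤ.* a ℤ.- s ℤ.* b ≡ ℤ.- s ℤ.* (b ℤ.+ a)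
  collect = solve-∀

even⇒≃0 : ∀ {n} → 2 ℕ.∣ n → + n ≃ 0ℤ [ + 2 ]
even⇒≃0 (ℕ.divides k refl) = ∣⇒≃0 (divides (+ k) (ℤ.pos-* k 2))

odd⇒≃1 : ∀ {n} → Odd n → + n ≃ 1ℤ [ + 2 ]
odd⇒≃1 {n} odd-n with 2∣⊎2∣suc n
... | inj₁ 2∣n = contradiction 2∣n odd-n
... | inj₂ 2∣1+n = ≃-trans (≃-reflexive (add (+ n))) (≃-+ {a = + suc n} {0ℤ} { -1ℤ} {1ℤ} (even⇒≃0 2∣1+n) (congruent (divides -1ℤ refl)))
  where
  add : ∀ a → a ≡ (1ℤ ℤ.+ a) ℤ.+ -1ℤ
  add = solve-∀

B⁻¹-odd : ∀ n → B⁻¹ n ≃ 1ℤ [ + 2 ]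
B⁻¹-odd zero    = ≃-refl
B⁻¹-odd (suc n) = ≃-trans (≃-neg (B⁻¹-odd n)) (congruent (divides -1ℤ refl))

factor⊛ : ∀ j f n → (factor j ⊛ f) n ≡ f n ℤ.- shift (2 ^ j) f n
factor⊛ j f n = begin
  (factor j ⊛ f) n
    ≡⟨ at (⊛-congʳ f {factor j} {𝟙 ⊕ neg y} (pointwise λ _ → refl)) n ⟩
  ((𝟙 ⊕ neg y) ⊛ f) n
    ≡⟨ at (solve 3 (λ i y f → (i :+ :- y) :* f := i :* f :+ :- (y :* f)) ≈-refl 𝟙 y f) n ⟩
  (𝟙 ⊛ f) n ℤ.- (y ⊛ f) n
    ≡⟨ cong₂ ℤ._-_ (at (⊛-identityˡ f) n) (x^⊛-shift (2 ^ j) f n) ⟩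
  f n ℤ.- shift (2 ^ j) f n ∎
  where
  open ≡-Reasoning
  y : ℤ⟦x⟧
  y = x^ (2 ^ j)

-- The halving step from `G` to `G′`, with w = Q - 3.

module Descent (s m₁ w : ℕ) (m≡3*2^r : suc m₁ ≡ 3 * 2 ^ suc s) (Q≡3+w : 2 ^ suc s ≡ 3 + w) where

  open Thirds s m₁ m≡3*2^r

  m : ℕ
  m = suc m₁

  -- Q, ..., 2Q - 1 are the indices below m with C(m₁, i) even, where division of 2c by C(m₁, i)
  -- leaves no factor 2; `balance` makes up for it.
  record Balanced (G : ℤ⟦x⟧) : Set where
    field
      polynomial : Vanishes m (A ^ᵖ m₁ ⊛ G)
      balance    : Σ< Q (λ e → (A ^ᵖ m₁ ⊛ G) (Q + e)) ≃ 0ℤ [ + 2 ]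

  F : ℤ⟦x⟧
  F = B⁻¹ ^ᵖ suc m

  Γ : ℕ → ℕ → ℤ
  Γ p i = B⁻¹ (p ∸ i) ℤ.* + γ p i

  Γ≃γ : ∀ p i → Γ p i ≃ + γ p i [ + 2 ]
  Γ≃γ p i = ≃-trans (≃-* (B⁻¹-odd (p ∸ i)) ≃-refl) (≃-reflexive (ℤ.*-identityˡ (+ γ p i)))

  exchange : ∀ p i → i ≤ m₁ → + m ℤ.* (+ (m₁ C i) ℤ.* shift i F p) ≡ + suc p ℤ.* Γ p i
  exchange p i i≤m₁ with i ℕ.≤? p
  -- For i > p both sides are zero, by `shift` on the left and by C(p, i) inside γ on the right, so
  -- the truncated `p ∸ i` does no harm.
  ... | no i≰p = trans (cong (λ z → + m ℤ.* (+ (m₁ C i) ℤ.* z)) (shift-< F (ℕ.≰⇒> i≰p)))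
        (trans (annihilate (+ m) (+ (m₁ C i)) (+ suc p) (B⁻¹ (p ∸ i)))
          (cong (λ z → + suc p ℤ.* (B⁻¹ (p ∸ i) ℤ.* + z)) (sym
            (trans (cong (((suc p + (m₁ ∸ i)) C (m₁ ∸ i)) *_) (k>n⇒nCk≡0 (ℕ.≰⇒> i≰p)))
                   (ℕ.*-zeroʳ ((suc p + (m₁ ∸ i)) C (m₁ ∸ i)))))))
    where
    annihilate : ∀ a b c d → a ℤ.* (b ℤ.* 0ℤ) ≡ c ℤ.* (d ℤ.* 0ℤ)
    annihilate = solve-∀
  ... | yes i≤p with m≤n⇒∃[o]o+m≡n i≤p
  ... | a , refl = begin
    + m ℤ.* (+ (m₁ C i) ℤ.* shift i F (a + i))
      ≡⟨ cong (λ z → + m ℤ.* (+ (m₁ C i) ℤ.* z)) (trans (cong (shift i F) (ℕ.+-comm a i)) (trans (shift-+ i F a) (B⁻¹^ m a))) ⟩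
    + m ℤ.* (+ (m₁ C i) ℤ.* (B⁻¹ a ℤ.* + ((a + m) C m)))
      ≡⟨ regroup (+ m) (+ (m₁ C i)) (B⁻¹ a) (+ ((a + m) C m)) ⟩
    B⁻¹ a ℤ.* (+ m ℤ.* + ((a + m) C m) ℤ.* + (m₁ C i))
      ≡⟨ cong₂ (λ b z → B⁻¹ b ℤ.* z) (sym (ℕ.m+n∸n≡m a i)) naturals ⟩
    B⁻¹ (a + i ∸ i) ℤ.* (+ suc (a + i) ℤ.* + γ (a + i) i)
      ≡⟨ swap (B⁻¹ (a + i ∸ i)) (+ suc (a + i)) (+ γ (a + i) i) ⟩
    + suc (a + i) ℤ.* Γ (a + i) i ∎
    where
    open ≡-Reasoning
    regroup : ∀ m k b c → m ℤ.* (k ℤ.* (b ℤ.* c)) ≡ b ℤ.* (m ℤ.* c ℤ.* k)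
    regroup = solve-∀
    swap : ∀ a b c → a ℤ.* (b ℤ.* c) ≡ b ℤ.* (a ℤ.* c)
    swap = solve-∀
    naturals : + m ℤ.* + ((a + m) C m) ℤ.* + (m₁ C i) ≡ + suc (a + i) ℤ.* + γ (a + i) i
    naturals = begin
      + m ℤ.* + ((a + m) C m) ℤ.* + (m₁ C i)   ≡⟨ cong (ℤ._* + (m₁ C i)) (sym (ℤ.pos-* m ((a + m) C m))) ⟩
      + (m * ((a + m) C m)) ℤ.* + (m₁ C i)     ≡⟨ ℤ.pos-* (m * ((a + m) C m)) (m₁ C i) ⟨
      + (m * ((a + m) C m) * (m₁ C i))         ≡⟨ cong +_ (γ-exchange a i i≤m₁) ⟩
      + (suc (a + i) * γ (a + i) i)            ≡⟨ ℤ.pos-* (suc (a + i)) (γ (a + i) i) ⟩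
      + suc (a + i) ℤ.* + γ (a + i) i          ∎

  -- Put H = ƛᵐ G. In degree N = 2n > 0 the coefficient of c ƛᵐ θG is N c H(N) plus 2cm times a
  -- coefficient of x P (1 + x)⁻ᵐ⁻¹. Both are multiples of N; the quotient c H(N) + D(N - 1) is
  -- G′(n), and N = 2n gives the factor 2 before θG′.
  balanced-descent : ∀ {G} → Balanced G → ∃ λ c → Odd c × ∃ λ G′ →
    Balanced G′ × (+ c • U (ƛ ^ᵖ m ⊛ θ G) ≈ + 2 • θ G′) × G′ ≋ U G [ + 2 ]
  balanced-descent {G} G-balanced with odd-common-multiple m (m₁ C_) C∣2*odd
  ... | c , odd-c , C∣2c = c , odd-c , G′ , record { polynomial = P′-polynomial ; balance = P′-balance } , cU≈2θ , G′≋UG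
    where
    open Balanced G-balanced
    P : ℤ⟦x⟧
    P = A ^ᵖ m₁ ⊛ G

    -- 2 c / C(m₁, i), with junk value 0 for i ≥ m.
    c′ : ℕ → ℕ
    c′ i with m₁ C i ℕ.∣? 2 * c
    ... | yes d = ℕ.quotient d
    ... | no _  = 0

    c′*C : ∀ i → i < m → c′ i * (m₁ C i) ≡ 2 * c
    c′*C i i<m with m₁ C i ℕ.∣? 2 * c
    ... | yes (ℕ.divides q eq) = sym eq
    ... | no ∤                 = contradiction (C∣2c i i<m) ∤

    c′-even : ∀ i → i < m → Odd (m₁ C i) → + c′ i ≃ 0ℤ [ + 2 ]
    c′-even i i<m odd-C = even⇒≃0 (2^-cancel-odd 1 odd-C
      (subst (2 ℕ.∣_) (trans (sym (c′*C i i<m)) (ℕ.*-comm (c′ i) (m₁ C i))) (ℕ.m∣m*n c)))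

    c′-odd : ∀ e → e < Q → + c′ (Q + e) ≃ 1ℤ [ + 2 ]
    c′-odd e e<Q = odd⇒≃1 λ 2∣c′ → odd-c (ℕ.*-cancelˡ-∣ 2 (subst (4 ℕ.∣_) (c′*C (Q + e) (middle<m e<Q))
      (ℕ.*-pres-∣ 2∣c′ (proj₁ (C-middle e e<Q)))))

    -- The coefficient of x^(p + 1) in 2cm x P (1 + x)⁻ᵐ⁻¹, divided by p + 1. Each summand is
    -- divided on its own through `exchange`, `c′ i` being the cofactor of C(m₁, i) in 2c.
    D : ℕ → ℤ
    D p = Σ< m (λ i → P i ℤ.* (+ c′ i ℤ.* Γ p i))

    D-spec : ∀ p → + suc p ℤ.* D p ≡ + (2 * c) ℤ.* (+ m ℤ.* (X ⊛ (P ⊛ F)) (suc p))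
    D-spec p = begin
      + suc p ℤ.* D p
        ≡⟨ Σ<-* m (+ suc p) (λ i → P i ℤ.* (+ c′ i ℤ.* Γ p i)) ⟨
      Σ< m (λ i → + suc p ℤ.* (P i ℤ.* (+ c′ i ℤ.* Γ p i)))
        ≡⟨ Σ<-cong m term ⟩
      Σ< m (λ i → (+ (2 * c) ℤ.* + m) ℤ.* (P i ℤ.* shift i F p))
        ≡⟨ Σ<-* m (+ (2 * c) ℤ.* + m) (λ i → P i ℤ.* shift i F p) ⟩
      (+ (2 * c) ℤ.* + m) ℤ.* Σ< m (λ i → P i ℤ.* shift i F p)
        ≡⟨ cong ((+ (2 * c) ℤ.* + m) ℤ.*_) (X⊛-shift m F polynomial (suc p)) ⟨
      (+ (2 * c) ℤ.* + m) ℤ.* (X ⊛ (P ⊛ F)) (suc p)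
        ≡⟨ ℤ.*-assoc (+ (2 * c)) (+ m) _ ⟩
      + (2 * c) ℤ.* (+ m ℤ.* (X ⊛ (P ⊛ F)) (suc p)) ∎
      where
      open ≡-Reasoning
      pull : ∀ n p c g → n ℤ.* (p ℤ.* (c ℤ.* g)) ≡ p ℤ.* (c ℤ.* (n ℤ.* g))
      pull = solve-∀
      push : ∀ p c m k f → p ℤ.* (c ℤ.* (m ℤ.* (k ℤ.* f))) ≡ ((c ℤ.* k) ℤ.* m) ℤ.* (p ℤ.* f)
      push = solve-∀
      term : ∀ i → i < m → + suc p ℤ.* (P i ℤ.* (+ c′ i ℤ.* Γ p i)) ≡ (+ (2 * c) ℤ.* + m) ℤ.* (P i ℤ.* shift i F p)
      term i i<m@(s≤s i≤m₁) = begin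
        + suc p ℤ.* (P i ℤ.* (+ c′ i ℤ.* Γ p i))
          ≡⟨ pull (+ suc p) (P i) (+ c′ i) (Γ p i) ⟩
        P i ℤ.* (+ c′ i ℤ.* (+ suc p ℤ.* Γ p i))
          ≡⟨ cong (λ z → P i ℤ.* (+ c′ i ℤ.* z)) (exchange p i i≤m₁) ⟨
        P i ℤ.* (+ c′ i ℤ.* (+ m ℤ.* (+ (m₁ C i) ℤ.* shift i F p)))
          ≡⟨ push (P i) (+ c′ i) (+ m) (+ (m₁ C i)) (shift i F p) ⟩
        ((+ c′ i ℤ.* + (m₁ C i)) ℤ.* + m) ℤ.* (P i ℤ.* shift i F p)
          ≡⟨ cong (λ z → (z ℤ.* + m) ℤ.* (P i ℤ.* shift i F p))
                  (trans (sym (ℤ.pos-* (c′ i) (m₁ C i))) (cong +_ (c′*C i i<m))) ⟩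
        (+ (2 * c) ℤ.* + m) ℤ.* (P i ℤ.* shift i F p) ∎

    -- In the outer thirds `c′ i` is even. In the middle third it is odd and γ(p, i) has a common
    -- parity π, so these terms amount to π times the sum of the middle coefficients of P.
    D-even : ∀ p → D p ≃ 0ℤ [ + 2 ]
    D-even p = begin
      Σ< m term
        ≡⟨ cong (λ k → Σ< k term) m≡Q+Q+Q ⟩
      Σ< (Q + (Q + Q)) term
        ≡⟨ Σ<-+ Q (Q + Q) term ⟩
      Σ< Q term ℤ.+ Σ< (Q + Q) (λ i → term (Q + i))
        ≡⟨ cong (ℤ._+_ (Σ< Q term)) (Σ<-+ Q Q (λ i → term (Q + i))) ⟩
      Σ< Q term ℤ.+ (Σ< Q (λ e → term (Q + e)) ℤ.+ Σ< Q (λ e → term (Q + (Q + e))))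
        ≈⟨ ≃-+ (≃-trans (Σ<-≃ Q low) (≃-reflexive (Σ<-zero Q)))
               (≃-+ middle (≃-trans (Σ<-≃ Q high) (≃-reflexive (Σ<-zero Q)))) ⟩
      0ℤ ∎
      where
      open ≃-Reasoning (+ 2)
      term : ℕ → ℤ
      term i = P i ℤ.* (+ c′ i ℤ.* Γ p i)
      even-term : ∀ i → i < m → Odd (m₁ C i) → term i ≃ 0ℤ [ + 2 ]
      even-term i i<m odd-C = ≃-trans (≃-* (≃-refl {a = P i}) (≃-* (c′-even i i<m odd-C) (≃-refl {a = Γ p i})))
                                      (≃-reflexive (ℤ.*-zeroʳ (P i)))
      low : ∀ i → i < Q → term i ≃ 0ℤ [ + 2 ]
      low i i<Q = even-term i (low<m i<Q) (C-low i i<Q)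
      high : ∀ e → e < Q → term (Q + (Q + e)) ≃ 0ℤ [ + 2 ]
      high e e<Q = even-term _ (high<m e<Q) (C-high e e<Q)
      common-parity : ∃ λ π → ∀ e → e < Q → + γ p (Q + e) ≃ π [ + 2 ]
      common-parity with 2 ^ suc r ℕ.∣? suc p
      ... | yes d = 1ℤ , λ e e<Q → odd⇒≃1 (γ-middle-odd p e e<Q d)
      ... | no ∤  = 0ℤ , λ e e<Q → even⇒≃0 (γ-middle-even p e e<Q ∤)
      middle : Σ< Q (λ e → term (Q + e)) ≃ 0ℤ [ + 2 ]
      middle with common-parity
      ... | π , γ≃π = begin
        Σ< Q (λ e → term (Q + e))
          ≈⟨ Σ<-≃ Q (λ e e<Q → ≃-trans
               (≃-* (≃-refl {a = P (Q + e)}) (≃-* (c′-odd e e<Q) (≃-trans (Γ≃γ p (Q + e)) (γ≃π e e<Q))))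
               (≃-reflexive (trans (cong (P (Q + e) ℤ.*_) (ℤ.*-identityˡ π)) (ℤ.*-comm (P (Q + e)) π)))) ⟩
        Σ< Q (λ e → π ℤ.* P (Q + e))
          ≡⟨ Σ<-* Q π (λ e → P (Q + e)) ⟩
        π ℤ.* Σ< Q (λ e → P (Q + e))
          ≈⟨ ≃-* (≃-refl {a = π}) balance ⟩
        π ℤ.* 0ℤ
          ≡⟨ ℤ.*-zeroʳ π ⟩
        0ℤ ∎

    H : ℤ⟦x⟧
    H = ƛ ^ᵖ m ⊛ G

    -- θ annihilates degree 0, so `G′ 0` is free; c G(0) keeps G′ ≡ U G modulo 2 there. The argument
    -- of `D` is 2 (q + 1) - 1 in the form to which `2 * suc q` reduces.
    G′ : ℤ⟦x⟧
    G′ zero    = + c ℤ.* G 0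
    G′ (suc q) = + c ℤ.* H (2 * suc q) ℤ.+ D (q + suc (q + 0))

    cU≈2θ : + c • U (ƛ ^ᵖ m ⊛ θ G) ≈ + 2 • θ G′
    cU≈2θ = pointwise go
      where
      open ≡-Reasoning
      at-zero : ∀ c a → c ℤ.* (a ℤ.* 0ℤ) ≡ 0ℤ
      at-zero = solve-∀
      go : ∀ n → (+ c • U (ƛ ^ᵖ m ⊛ θ G)) n ≡ (+ 2 • θ G′) n
      go zero    = trans (cong (+ c ℤ.*_) (⊛-zero (ƛ ^ᵖ m) (θ G))) (at-zero (+ c) ((ƛ ^ᵖ m) 0))
      go (suc q) = begin
        + c ℤ.* U (ƛ ^ᵖ m ⊛ θ G) (suc q)
          ≡⟨ cong (+ c ℤ.*_) (trans (U-at (ƛ ^ᵖ m ⊛ θ G) (suc q)) (at (ƛ^m⊛θ m₁ G) N)) ⟩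
        + c ℤ.* (+ N ℤ.* H N ℤ.+ + (2 * m) ℤ.* K)
          ≡⟨ cong (λ z → + c ℤ.* (+ N ℤ.* H N ℤ.+ z ℤ.* K)) (ℤ.pos-* 2 m) ⟩
        + c ℤ.* (+ N ℤ.* H N ℤ.+ (+ 2 ℤ.* + m) ℤ.* K)
          ≡⟨ expand (+ c) (+ N) (H N) (+ m) K ⟩
        + N ℤ.* (+ c ℤ.* H N) ℤ.+ (+ 2 ℤ.* + c) ℤ.* (+ m ℤ.* K)
          ≡⟨ cong (λ z → + N ℤ.* (+ c ℤ.* H N) ℤ.+ z ℤ.* (+ m ℤ.* K)) (ℤ.pos-* 2 c) ⟨
        + N ℤ.* (+ c ℤ.* H N) ℤ.+ + (2 * c) ℤ.* (+ m ℤ.* K)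
          ≡⟨ cong (ℤ._+_ (+ N ℤ.* (+ c ℤ.* H N))) (D-spec (q + suc (q + 0))) ⟨
        + N ℤ.* (+ c ℤ.* H N) ℤ.+ + N ℤ.* D (q + suc (q + 0))
          ≡⟨ ℤ.*-distribˡ-+ (+ N) (+ c ℤ.* H N) (D (q + suc (q + 0))) ⟨
        + N ℤ.* G′ (suc q)
          ≡⟨ cong (ℤ._* G′ (suc q)) (ℤ.pos-* 2 (suc q)) ⟩
        (+ 2 ℤ.* + suc q) ℤ.* G′ (suc q)
          ≡⟨ ℤ.*-assoc (+ 2) (+ suc q) (G′ (suc q)) ⟩
        + 2 ℤ.* (+ suc q ℤ.* G′ (suc q)) ∎
        where
        N : ℕ
        N = 2 * suc q
        K : ℤ
        K = (X ⊛ (P ⊛ F)) N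
        expand : ∀ c n h m k → c ℤ.* (n ℤ.* h ℤ.+ (+ 2 ℤ.* m) ℤ.* k) ≡ n ℤ.* (c ℤ.* h) ℤ.+ (+ 2 ℤ.* c) ℤ.* (m ℤ.* k)
        expand = solve-∀

    G′≋UG : G′ ≋ U G [ + 2 ]
    G′≋UG = pointwise go
      where
      open ≃-Reasoning (+ 2)
      2∣2^ : + 2 ℤ.∣ + (2 ^ suc r)
      2∣2^ = divides (+ (2 ^ r)) (trans (cong +_ (ℕ.*-comm 2 (2 ^ r))) (ℤ.pos-* (2 ^ r) 2))
      ƛ^m≋𝟙 : ƛ ^ᵖ m ≋ 𝟙 [ + 2 ]
      ƛ^m≋𝟙 = subst (λ k → ƛ ^ᵖ k ≋ 𝟙 [ + 2 ]) (sym m≡3*2^r)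
        (pointwise λ n → ≃-weaken 2∣2^ (at≋ (ƛ^3*2^ r) n))
      go : ∀ n → G′ n ≃ U G n [ + 2 ]
      go zero    = ≃-trans (≃-* (odd⇒≃1 odd-c) (≃-refl {a = G 0})) (≃-reflexive (ℤ.*-identityˡ (G 0)))
      go (suc q) = begin
        + c ℤ.* H (2 * suc q) ℤ.+ D (q + suc (q + 0))
          ≈⟨ ≃-+ (≃-* (odd⇒≃1 odd-c) (at≋ (≋-⊛ ƛ^m≋𝟙 (≋-refl {f = G})) (2 * suc q))) (D-even (q + suc (q + 0))) ⟩
        1ℤ ℤ.* (𝟙 ⊛ G) (2 * suc q) ℤ.+ 0ℤ
          ≡⟨ trans (ℤ.+-identityʳ _) (trans (ℤ.*-identityˡ _) (at (⊛-identityˡ G) (2 * suc q))) ⟩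
        G (2 * suc q)
          ≡⟨ U-at G (suc q) ⟨
        U G (suc q) ∎

    P′ : ℤ⟦x⟧
    P′ = A ^ᵖ m₁ ⊛ G′

    A^mθG-polynomial : Vanishes m (A ^ᵖ m ⊛ θ G)
    A^mθG-polynomial (suc l) (s≤s m₁≤l) = trans (A^m⊛θ-suc m₁ G l)
      (trans (cong (λ z → + suc l ℤ.* z ℤ.+ (+ m₁ ℤ.- + l) ℤ.* P l) (polynomial (suc l) (s≤s m₁≤l)))
             (trans (cong (ℤ._+ (+ m₁ ℤ.- + l) ℤ.* P l) (ℤ.*-zeroʳ (+ suc l))) (trans (ℤ.+-identityˡ _) (boundary (ℕ.m≤n⇒m<n∨m≡n m₁≤l)))))
      where
      boundary : m₁ < l ⊎ m₁ ≡ l → (+ m₁ ℤ.- + l) ℤ.* P l ≡ 0ℤ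
      boundary (inj₁ m₁<l) = trans (cong ((+ m₁ ℤ.- + l) ℤ.*_) (polynomial l m₁<l)) (ℤ.*-zeroʳ (+ m₁ ℤ.- + l))
      boundary (inj₂ refl) = cong (ℤ._* P m₁) (ℤ.+-inverseʳ (+ m₁))

    -- Multiplied by (1 - x)ᵐ, the equation for G′ becomes 2 (1 - x)ᵐ θG′ = c U((1 - x)²ᵐ θG). The
    -- argument of U vanishes from degree 2m on, hence its image from degree m on.
    A^mθG′-polynomial : Vanishes m (A ^ᵖ m ⊛ θ G′)
    A^mθG′-polynomial l m≤l = ℤ.*-cancelˡ-≡ (+ 2) _ 0ℤ (trans (at doubled l) (begin
      + c ℤ.* U (A ^ᵖ m ⊛ (A ^ᵖ m ⊛ θ G)) l
        ≡⟨ cong (+ c ℤ.*_) (trans (U-at (A ^ᵖ m ⊛ (A ^ᵖ m ⊛ θ G)) l)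
             (vanishes-A^⊛ m A^mθG-polynomial (2 * l) (ℕ.+-mono-≤ m≤l (ℕ.≤-trans m≤l (ℕ.m≤m+n l 0))))) ⟩
      + c ℤ.* 0ℤ
        ≡⟨ ℤ.*-zeroʳ (+ c) ⟩
      0ℤ ∎))
      where
      open ≡-Reasoning
      doubled : + 2 • (A ^ᵖ m ⊛ θ G′) ≈ + c • U (A ^ᵖ m ⊛ (A ^ᵖ m ⊛ θ G))
      doubled = ≈R.begin
        + 2 • (A ^ᵖ m ⊛ θ G′)                     ≈R.≈⟨ ⊛-• (+ 2) (A ^ᵖ m) (θ G′) ⟨
        A ^ᵖ m ⊛ (+ 2 • θ G′)                     ≈R.≈⟨ ⊛-congˡ (A ^ᵖ m) cU≈2θ ⟨
        A ^ᵖ m ⊛ (+ c • U (ƛ ^ᵖ m ⊛ θ G))         ≈R.≈⟨ ⊛-• (+ c) (A ^ᵖ m) (U (ƛ ^ᵖ m ⊛ θ G)) ⟩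
        + c • (A ^ᵖ m ⊛ U (ƛ ^ᵖ m ⊛ θ G))         ≈R.≈⟨ •-cong (+ c) (U-σ (A ^ᵖ m) (ƛ ^ᵖ m ⊛ θ G)) ⟨
        + c • U (σ (A ^ᵖ m) ⊛ (ƛ ^ᵖ m ⊛ θ G))     ≈R.≈⟨ •-cong (+ c) (U-cong (⊛-assoc (σ (A ^ᵖ m)) (ƛ ^ᵖ m) (θ G))) ⟨
        + c • U ((σ (A ^ᵖ m) ⊛ ƛ ^ᵖ m) ⊛ θ G)     ≈R.≈⟨ •-cong (+ c) (U-cong (⊛-congʳ (θ G) (σ-A^m⊛ƛ^m m))) ⟩
        + c • U ((A ^ᵖ m ⊛ A ^ᵖ m) ⊛ θ G)         ≈R.≈⟨ •-cong (+ c) (U-cong (⊛-assoc (A ^ᵖ m) (A ^ᵖ m) (θ G))) ⟩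
        + c • U (A ^ᵖ m ⊛ (A ^ᵖ m ⊛ θ G))         ≈R.∎
        where module ≈R = ≈-Reasoning

    -- Upward induction: (l + 1) P′(l + 1) = -(m₁ - l) P′(l) for l ≥ m₁, and the right side is 0 at
    -- l = m₁.
    P′-polynomial : Vanishes m P′
    P′-polynomial (suc l) (s≤s m₁≤l) = ℤ.*-cancelˡ-≡ (+ suc l) _ 0ℤ (begin
      + suc l ℤ.* P′ (suc l)
        ≡⟨ ℤ.+-identityʳ _ ⟨
      + suc l ℤ.* P′ (suc l) ℤ.+ 0ℤ
        ≡⟨ cong (ℤ._+_ (+ suc l ℤ.* P′ (suc l))) (boundary (ℕ.m≤n⇒m<n∨m≡n m₁≤l)) ⟨
      + suc l ℤ.* P′ (suc l) ℤ.+ (+ m₁ ℤ.- + l) ℤ.* P′ l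
        ≡⟨ A^m⊛θ-suc m₁ G′ l ⟨
      (A ^ᵖ m ⊛ θ G′) (suc l)
        ≡⟨ A^mθG′-polynomial (suc l) (s≤s m₁≤l) ⟩
      0ℤ
        ≡⟨ ℤ.*-zeroʳ (+ suc l) ⟨
      + suc l ℤ.* 0ℤ ∎)
      where
      open ≡-Reasoning
      boundary : m₁ < l ⊎ m₁ ≡ l → (+ m₁ ℤ.- + l) ℤ.* P′ l ≡ 0ℤ
      boundary (inj₁ m₁<l) = trans (cong ((+ m₁ ℤ.- + l) ℤ.*_) (P′-polynomial l m₁<l)) (ℤ.*-zeroʳ (+ m₁ ℤ.- + l))
      boundary (inj₂ refl) = cong (ℤ._* P′ m₁) (ℤ.+-inverseʳ (+ m₁))

    -- Modulo 2, P′ = (1 - x)(1 - x^Q) h with h of degree < 2 Q - 1, so the sum telescopes to -2 h_(Q-1).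
    P′-balance : Σ< Q (λ e → P′ (Q + e)) ≃ 0ℤ [ + 2 ]
    P′-balance = begin
      Σ< Q (λ e → P′ (Q + e))
        ≈⟨ Σ<-≃ Q (λ e _ → at≋ P′≋A⊛f (Q + e)) ⟩
      Σ< Q (λ e → (A ⊛ f) (Q + e))
        ≡⟨ Σ<-cong Q (λ e _ → cong (λ k → (A ⊛ f) (k + e)) Q≡3+w) ⟩
      Σ< Q (λ e → (A ⊛ f) (suc (2 + w) + e))
        ≡⟨ Σ<-telescope Q f (2 + w) ⟩
      f (2 + w + Q) ℤ.- f (2 + w)
        ≡⟨ cong₂ ℤ._-_ top bottom ⟩
      (0ℤ ℤ.- h (2 + w)) ℤ.- h (2 + w)
        ≡⟨ double (h (2 + w)) ⟩
      h (2 + w) ℤ.* -1ℤ ℤ.* + 2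
        ≈⟨ ∣⇒≃0 (divides (h (2 + w) ℤ.* -1ℤ) refl) ⟩
      0ℤ ∎
      where
      open ≃-Reasoning (+ 2)
      Z h f : ℤ⟦x⟧
      Z = A ^ᵖ w ⊛ P
      h = U Z
      f = factor r ⊛ h
      double : ∀ a → (0ℤ ℤ.- a) ℤ.- a ≡ a ℤ.* -1ℤ ℤ.* + 2
      double = solve-∀
      bottom : f (2 + w) ≡ h (2 + w)
      bottom = trans (factor⊛ r h (2 + w))
        (trans (cong (λ z → h (2 + w) ℤ.- z) (shift-< h (ℕ.≤-reflexive (sym Q≡3+w)))) (ℤ.+-identityʳ (h (2 + w))))
      top : f (2 + w + Q) ≡ 0ℤ ℤ.- h (2 + w)
      top = trans (factor⊛ r h (2 + w + Q)) (cong₂ ℤ._-_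
        (trans (U-at Z (2 + w + Q)) (vanishes-A^⊛ w polynomial (2 * (2 + w + Q)) w+m≤))
        (trans (cong (shift Q h) (ℕ.+-comm (2 + w) Q)) (shift-+ Q h (2 + w))))
        where
        -- Z vanishes from degree w + m = 4Q - 3 on, which is one below 2 (2Q - 1).
        degrees : ∀ w → 2 * (2 + w + (3 + w)) ≡ suc (w + ((3 + w) + ((3 + w) + (3 + w))))
        degrees = ℕ-solver.solve-∀
        w+m≤ : w + m ≤ 2 * (2 + w + Q)
        w+m≤ = subst₂ _≤_ (sym (cong (_+_ w) (trans m≡Q+Q+Q (cong (λ k → k + (k + k)) Q≡3+w))))
                          (trans (sym (degrees w)) (cong (λ k → 2 * (2 + w + k)) (sym Q≡3+w))) (ℕ.n≤1+n _)
      -- y = 2Q - 2, so m₁ = (Q + 1) + y and 2y = w + m₁. Modulo 2, y factors σ A become A^(w + m₁),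
      -- which turns G into P with A^w to spare; the other Q + 1 leave U as A · A^Q. The exponent w
      -- = Q - 3 is where r ≥ 2 enters.
      y : ℕ
      y = 4 + (w + w)
      m₁≡ : m₁ ≡ suc Q + y
      m₁≡ = ℕ.suc-injective (trans m≡Q+Q+Q (trans (cong (λ k → k + (k + k)) Q≡3+w)
              (trans (exponents w) (cong (λ k → suc (suc k + y)) (sym Q≡3+w)))))
        where
        exponents : ∀ w → (3 + w) + ((3 + w) + (3 + w)) ≡ suc (suc (3 + w) + (4 + (w + w)))
        exponents = ℕ-solver.solve-∀
      y+y≡ : y + y ≡ w + m₁
      y+y≡ = trans (exponents w) (cong (_+_ w) (sym (trans m₁≡ (cong (λ k → suc k + y) Q≡3+w))))
        where
        exponents : ∀ w → (4 + (w + w)) + (4 + (w + w)) ≡ w + (suc (3 + w) + (4 + (w + w)))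
        exponents = ℕ-solver.solve-∀
      σA^y≋ : σ A ^ᵖ y ≋ A ^ᵖ (w + m₁) [ + 2 ]
      σA^y≋ = ≋R.begin
        σ A ^ᵖ y               ≋R.≈⟨ ≋-^ᵖ y σA≋A² ⟩
        (A ⊛ A) ^ᵖ y           ≋R.≈⟨ ≋-reflexive (^ᵖ-⊛ A A y) ⟩
        A ^ᵖ y ⊛ A ^ᵖ y        ≋R.≈⟨ ≋-reflexive (^ᵖ-+ A y y) ⟨
        A ^ᵖ (y + y)           ≋R.≡⟨ cong (A ^ᵖ_) y+y≡ ⟩
        A ^ᵖ (w + m₁)          ≋R.∎
        where module ≋R = ≋-Reasoning (+ 2)
      σA^m₁⊛G≋ : σ (A ^ᵖ m₁) ⊛ G ≋ σ (A ^ᵖ suc Q) ⊛ Z [ + 2 ]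
      σA^m₁⊛G≋ = ≋R.begin
        σ (A ^ᵖ m₁) ⊛ G
          ≋R.≈⟨ ≋-reflexive (⊛-congʳ G (σ-^ᵖ A m₁)) ⟩
        σ A ^ᵖ m₁ ⊛ G
          ≋R.≡⟨ cong (λ k → σ A ^ᵖ k ⊛ G) m₁≡ ⟩
        σ A ^ᵖ (suc Q + y) ⊛ G
          ≋R.≈⟨ ≋-reflexive (⊛-congʳ G (^ᵖ-+ (σ A) (suc Q) y)) ⟩
        (σ A ^ᵖ suc Q ⊛ σ A ^ᵖ y) ⊛ G
          ≋R.≈⟨ ≋-⊛ (≋-⊛ (≋-reflexive (≈-sym (σ-^ᵖ A (suc Q)))) σA^y≋) (≋-refl {f = G}) ⟩
        (σ (A ^ᵖ suc Q) ⊛ A ^ᵖ (w + m₁)) ⊛ G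
          ≋R.≈⟨ ≋-reflexive (⊛-congʳ G (⊛-congˡ (σ (A ^ᵖ suc Q)) (^ᵖ-+ A w m₁))) ⟩
        (σ (A ^ᵖ suc Q) ⊛ (A ^ᵖ w ⊛ A ^ᵖ m₁)) ⊛ G
          ≋R.≈⟨ ≋-reflexive (solve 4 (λ s a b g → (s :* (a :* b)) :* g := s :* (a :* (b :* g))) ≈-refl
                  (σ (A ^ᵖ suc Q)) (A ^ᵖ w) (A ^ᵖ m₁) G) ⟩
        σ (A ^ᵖ suc Q) ⊛ Z ≋R.∎
        where module ≋R = ≋-Reasoning (+ 2)
      P′≋A⊛f : P′ ≋ A ⊛ f [ + 2 ]
      P′≋A⊛f = ≋R.begin
        A ^ᵖ m₁ ⊛ G′                     ≋R.≈⟨ ≋-⊛ (≋-refl {f = A ^ᵖ m₁}) G′≋UG ⟩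
        A ^ᵖ m₁ ⊛ U G                    ≋R.≈⟨ ≋-reflexive (U-σ (A ^ᵖ m₁) G) ⟨
        U (σ (A ^ᵖ m₁) ⊛ G)              ≋R.≈⟨ ≋-U σA^m₁⊛G≋ ⟩
        U (σ (A ^ᵖ suc Q) ⊛ Z)           ≋R.≈⟨ ≋-reflexive (U-σ (A ^ᵖ suc Q) Z) ⟩
        (A ⊛ A ^ᵖ Q) ⊛ h                 ≋R.≈⟨ ≋-reflexive (⊛-assoc A (A ^ᵖ Q) h) ⟩
        A ⊛ (A ^ᵖ Q ⊛ h)                 ≋R.≈⟨ ≋-⊛ (≋-refl {f = A}) (≋-⊛ (A^2^ r) (≋-refl {f = h})) ⟩
        A ⊛ f                            ≋R.∎
        where module ≋R = ≋-Reasoning (+ 2)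

-- Valuations

ν₂-cong : ∀ a b → (∀ v → + (2 ^ v) ℤᵤ.∣ a → + (2 ^ v) ℤᵤ.∣ b) →
                  (∀ v → + (2 ^ v) ℤᵤ.∣ b → + (2 ^ v) ℤᵤ.∣ a) → ν₂ a ≡ ν₂ b
ν₂-cong a b a⇒b b⇒a with a ℤ.≟ 0ℤ | b ℤ.≟ 0ℤ
... | yes refl | yes refl = refl
... | yes refl | no b≢0   = contradiction (maximal (suc v) (a⇒b (suc v) ((2 ^ suc v) ℕ.∣0))) (ℕ.<⇒≱ (ℕ.n<1+n v))
  where
  v = proj₁ (ν₂-spec b b≢0)
  maximal = proj₂ (proj₂ (proj₂ (ν₂-spec b b≢0)))
... | no a≢0   | yes refl = contradiction (maximal (suc v) (b⇒a (suc v) ((2 ^ suc v) ℕ.∣0))) (ℕ.<⇒≱ (ℕ.n<1+n v))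
  where
  v = proj₁ (ν₂-spec a a≢0)
  maximal = proj₂ (proj₂ (proj₂ (ν₂-spec a a≢0)))
... | no a≢0   | no b≢0 with ν₂-spec a a≢0 | ν₂-spec b b≢0
... | v , ν₂a≡v , 2^v∣a , v-max | w , ν₂b≡w , 2^w∣b , w-max =
  trans ν₂a≡v (trans (cong [_] (ℕ.≤-antisym (w-max v (a⇒b v 2^v∣a)) (v-max w (b⇒a w 2^w∣b)))) (sym ν₂b≡w))

1≄0 : ¬ 1ℤ ≃ 0ℤ [ + 2 ]
1≄0 1≃0 = contradiction (ℕ.∣⇒≤ (ℤ.∣⇒∣ᵤ (≃0⇒∣ 1≃0))) λ { (s≤s ()) }

≃1⇒odd : ∀ {a} → a ≃ 1ℤ [ + 2 ] → Odd ℤ.∣ a ∣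
≃1⇒odd a≃1 2∣a = 1≄0 (≃-trans (≃-sym a≃1) (∣⇒≃0 (ℤ.∣ᵤ⇒∣ 2∣a)))

ν₂-unit : ∀ p q a b → p ≃ 1ℤ [ + 2 ] → q ≃ 1ℤ [ + 2 ] → p ℤ.* a ≡ q ℤ.* b → ν₂ a ≡ ν₂ b
ν₂-unit p q a b p≃1 q≃1 pa≡qb = ν₂-cong a b (transfer p q a b q≃1 pa≡qb) (transfer q p b a p≃1 (sym pa≡qb))
  where
  transfer : ∀ p q a b → q ≃ 1ℤ [ + 2 ] → p ℤ.* a ≡ q ℤ.* b → ∀ v → + (2 ^ v) ℤᵤ.∣ a → + (2 ^ v) ℤᵤ.∣ b
  transfer p q a b q≃1 pa≡qb v 2^v∣a = 2^-cancel-odd v (≃1⇒odd q≃1)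
    (subst (2 ^ v ℕ.∣_) (trans (sym (ℤ.abs-* p a)) (trans (cong ℤ.∣_∣ pa≡qb) (ℤ.abs-* q b)))
           (ℕ.∣n⇒∣m*n ℤ.∣ p ∣ 2^v∣a))

-- Powers up to 2^s are transferred by the congruence; higher ones divide neither side.
ν₂-≃ : ∀ s a b → a ≃ b [ + (2 ^ s) ] → ¬ 2 ^ s ℕ.∣ ℤ.∣ b ∣ → ν₂ a ≡ ν₂ b
ν₂-≃ s a b a≃b 2^s∤b = ν₂-cong a b (transfer a≃b 2^s∤b)
  (transfer (≃-sym a≃b) λ 2^s∣a → 2^s∤b (ℤ.∣⇒∣ᵤ (≃0⇒∣ (≃-trans (≃-sym a≃b) (∣⇒≃0 (ℤ.∣ᵤ⇒∣ {+ (2 ^ s)} {a} 2^s∣a))))))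
  where
  transfer : ∀ {a b} → a ≃ b [ + (2 ^ s) ] → ¬ 2 ^ s ℕ.∣ ℤ.∣ b ∣ → ∀ v → + (2 ^ v) ℤᵤ.∣ a → + (2 ^ v) ℤᵤ.∣ b
  transfer {a} {b} a≃b 2^s∤b v 2^v∣a with ℕ.≤-total v s
  ... | inj₁ v≤s = ℤ.∣⇒∣ᵤ (≃0⇒∣ (≃-trans (≃-sym (≃-weaken (ℤ.∣ᵤ⇒∣ {+ (2 ^ v)} {+ (2 ^ s)} (2^-mono-∣ v≤s)) a≃b)) (∣⇒≃0 (ℤ.∣ᵤ⇒∣ {+ (2 ^ v)} {a} 2^v∣a))))
  ... | inj₂ s≤v = contradiction (ℤ.∣⇒∣ᵤ (≃0⇒∣ (≃-trans (≃-sym a≃b) (∣⇒≃0 (ℤ.∣ᵤ⇒∣ {+ (2 ^ s)} {a} (ℕ.∣-trans (2^-mono-∣ s≤v) 2^v∣a)))))) 2^s∤b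

2-adic : ∀ n → 0 < n → ∃ λ L → ∃ λ N → Odd N × n ≡ 2 ^ L * N
2-adic = <-rec (λ n → 0 < n → ∃ λ L → ∃ λ N → Odd N × n ≡ 2 ^ L * N) go
  where
  go : ∀ n → (∀ {k} → k < n → 0 < k → ∃ λ L → ∃ λ N → Odd N × k ≡ 2 ^ L * N) →
       0 < n → ∃ λ L → ∃ λ N → Odd N × n ≡ 2 ^ L * N
  go n rec 0<n with 2 ℕ.∣? n
  ... | no odd-n = 0 , n , odd-n , sym (ℕ.+-identityʳ n)
  go n rec 0<n | yes (ℕ.divides zero refl) = contradiction 0<n λ ()
  go n rec 0<n | yes (ℕ.divides k@(suc _) refl) with rec (ℕ.m<m*n k 2 (s≤s (s≤s z≤n))) (s≤s z≤n)
  ... | L , N , odd-N , k≡ = suc L , N , odd-N ,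
    trans (cong (_* 2) k≡) (trans (ℕ.*-comm (2 ^ L * N) 2) (sym (ℕ.*-assoc 2 (2 ^ L) N)))

C-absorb-left : ∀ i d → suc d * ((i + suc d) C i) ≡ (i + suc d) * ((i + d) C i)
C-absorb-left i d = begin
  suc d * ((i + suc d) C i)
    ≡⟨ cong (suc d *_) (trans (nCk≡nC[n∸k] (ℕ.m≤m+n i (suc d))) (cong ((i + suc d) C_) (ℕ.m+n∸m≡n i (suc d)))) ⟩
  suc d * ((i + suc d) C suc d)
    ≡⟨ cong (λ n → suc d * (n C suc d)) (ℕ.+-suc i d) ⟩
  suc d * (suc (i + d) C suc d)
    ≡⟨ C-absorb (i + d) d ⟩
  suc (i + d) * ((i + d) C d)
    ≡⟨ cong₂ _*_ (sym (ℕ.+-suc i d)) (trans (nCk≡nC[n∸k] (ℕ.m≤n+m d i)) (cong ((i + d) C_) (ℕ.m+n∸n≡m i d))) ⟩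
  (i + suc d) * ((i + d) C i) ∎
  where open ≡-Reasoning

x^-self : ∀ k → (x^ k) k ≡ 1ℤ
x^-self zero    = refl
x^-self (suc k) = x^-self k

-- The truncation of (1 - x)^m₁ below x^j, for j = i + 1.
module Truncation (m₁ i : ℕ) (i<m₁ : i < m₁) where

  P G : ℤ⟦x⟧
  P l with l ℕ.≤? i
  ... | yes _ = (A ^ᵖ m₁) l
  ... | no _  = 0ℤ
  G = A⁻¹ ^ᵖ m₁ ⊛ P

  P-≤ : ∀ {l} → l ≤ i → P l ≡ (A ^ᵖ m₁) l
  P-≤ {l} l≤i with l ℕ.≤? i
  ... | yes _  = refl
  ... | no l≰i = contradiction l≤i l≰i

  P-> : ∀ {l} → i < l → P l ≡ 0ℤ
  P-> {l} i<l with l ℕ.≤? i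
  ... | yes l≤i = contradiction l≤i (ℕ.<⇒≱ i<l)
  ... | no _    = refl

  A^m₁⊛G : A ^ᵖ m₁ ⊛ G ≈ P
  A^m₁⊛G = ≈-sym (solve-for (A⁻¹ ^ᵖ m₁) (A ^ᵖ m₁) P G
    (≈-trans (⊛-comm (A⁻¹ ^ᵖ m₁) (A ^ᵖ m₁)) (^ᵖ-inverse m₁ A⊛A⁻¹)) ≈-refl)

  -- The coefficients of (1 - x)^m₁ satisfy `A^-recurrence`; truncation breaks it at l = i only, and
  -- κ is the defect there.
  κ : ℤ
  κ = (+ m₁ ℤ.- + i) ℤ.* (A ^ᵖ m₁) i

  -- This is `A^m⊛θ-suc` for the constant series 1, which θ annihilates.
  A^-recurrence : ∀ l → + suc l ℤ.* (A ^ᵖ m₁) (suc l) ℤ.+ (+ m₁ ℤ.- + l) ℤ.* (A ^ᵖ m₁) l ≡ 0ℤ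
  A^-recurrence l = begin
    + suc l ℤ.* (A ^ᵖ m₁) (suc l) ℤ.+ (+ m₁ ℤ.- + l) ℤ.* (A ^ᵖ m₁) l
      ≡⟨ cong₂ (λ a b → + suc l ℤ.* a ℤ.+ (+ m₁ ℤ.- + l) ℤ.* b) (at A^≈ (suc l)) (at A^≈ l) ⟨
    + suc l ℤ.* (A ^ᵖ m₁ ⊛ 𝟙) (suc l) ℤ.+ (+ m₁ ℤ.- + l) ℤ.* (A ^ᵖ m₁ ⊛ 𝟙) l
      ≡⟨ A^m⊛θ-suc m₁ 𝟙 l ⟨
    (A ^ᵖ suc m₁ ⊛ θ 𝟙) (suc l)
      ≡⟨ at (≈-trans (⊛-congˡ (A ^ᵖ suc m₁) θ-𝟙) (≈-trans (⊛-comm (A ^ᵖ suc m₁) 𝟘) (⊛-zeroˡ (A ^ᵖ suc m₁)))) (suc l) ⟩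
    0ℤ ∎
    where
    open ≡-Reasoning
    A^≈ : A ^ᵖ m₁ ⊛ 𝟙 ≈ A ^ᵖ m₁
    A^≈ = ≈-trans (⊛-comm (A ^ᵖ m₁) 𝟙) (⊛-identityˡ (A ^ᵖ m₁))

  A^m⊛θG : A ^ᵖ suc m₁ ⊛ θ G ≈ κ • (x^ suc i)
  A^m⊛θG = pointwise go
    where
    open ≡-Reasoning
    zeros : ∀ a b → a ℤ.* 0ℤ ℤ.+ b ℤ.* 0ℤ ≡ 0ℤ
    zeros = solve-∀
    P-step : ∀ l → + suc l ℤ.* P (suc l) ℤ.+ (+ m₁ ℤ.- + l) ℤ.* P l ≡ κ ℤ.* (x^ i) l
    P-step l with ℕ.<-cmp l i
    ... | tri< l<i l≢i _ = begin
      + suc l ℤ.* P (suc l) ℤ.+ (+ m₁ ℤ.- + l) ℤ.* P l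
        ≡⟨ cong₂ (λ a b → + suc l ℤ.* a ℤ.+ (+ m₁ ℤ.- + l) ℤ.* b) (P-≤ l<i) (P-≤ (ℕ.<⇒≤ l<i)) ⟩
      + suc l ℤ.* (A ^ᵖ m₁) (suc l) ℤ.+ (+ m₁ ℤ.- + l) ℤ.* (A ^ᵖ m₁) l
        ≡⟨ A^-recurrence l ⟩
      0ℤ
        ≡⟨ trans (cong (κ ℤ.*_) (x^-vanishes l≢i)) (ℤ.*-zeroʳ κ) ⟨
      κ ℤ.* (x^ i) l ∎
    ... | tri≈ _ refl _ = begin
      + suc l ℤ.* P (suc l) ℤ.+ (+ m₁ ℤ.- + l) ℤ.* P l
        ≡⟨ cong₂ (λ a b → + suc l ℤ.* a ℤ.+ (+ m₁ ℤ.- + l) ℤ.* b) (P-> (ℕ.n<1+n l)) (P-≤ ℕ.≤-refl) ⟩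
      + suc l ℤ.* 0ℤ ℤ.+ κ
        ≡⟨ trans (cong (ℤ._+ κ) (ℤ.*-zeroʳ (+ suc l))) (ℤ.+-identityˡ κ) ⟩
      κ
        ≡⟨ trans (cong (κ ℤ.*_) (x^-self l)) (ℤ.*-identityʳ κ) ⟨
      κ ℤ.* (x^ i) l ∎
    ... | tri> _ l≢i i<l = begin
      + suc l ℤ.* P (suc l) ℤ.+ (+ m₁ ℤ.- + l) ℤ.* P l
        ≡⟨ cong₂ (λ a b → + suc l ℤ.* a ℤ.+ (+ m₁ ℤ.- + l) ℤ.* b) (P-> (ℕ.m<n⇒m<1+n i<l)) (P-> i<l) ⟩
      + suc l ℤ.* 0ℤ ℤ.+ (+ m₁ ℤ.- + l) ℤ.* 0ℤ
        ≡⟨ zeros (+ suc l) (+ m₁ ℤ.- + l) ⟩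
      0ℤ
        ≡⟨ trans (cong (κ ℤ.*_) (x^-vanishes l≢i)) (ℤ.*-zeroʳ κ) ⟨
      κ ℤ.* (x^ i) l ∎
    go : ∀ l → (A ^ᵖ suc m₁ ⊛ θ G) l ≡ κ ℤ.* (x^ suc i) l
    go zero    = trans (A^m⊛θ-zero m₁ G) (sym (ℤ.*-zeroʳ κ))
    go (suc l) = trans (A^m⊛θ-suc m₁ G l)
      (trans (cong₂ (λ a b → + suc l ℤ.* a ℤ.+ (+ m₁ ℤ.- + l) ℤ.* b) (at A^m₁⊛G (suc l)) (at A^m₁⊛G l)) (P-step l))

  extract : ∀ f n → (A ^ᵖ suc m₁ ⊛ θ G ⊛ f) (suc i + n) ≡ κ ℤ.* f n
  extract f n = begin
    (A ^ᵖ suc m₁ ⊛ θ G ⊛ f) (suc i + n)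
      ≡⟨ at (≈-trans (⊛-congʳ f A^m⊛θG) (•-⊛ κ (x^ suc i) f)) (suc i + n) ⟩
    κ ℤ.* ((x^ suc i) ⊛ f) (suc i + n)
      ≡⟨ cong (κ ℤ.*_) (trans (x^⊛-shift (suc i) f (suc i + n)) (shift-+ (suc i) f n)) ⟩
    κ ℤ.* f n ∎
    where open ≡-Reasoning

  θG⊛V : ∀ n → (θ G ⊛ V (suc m₁)) (suc i + n) ≡ κ ℤ.* (T ^ᵖ suc m₁) n
  θG⊛V n = trans (at (solve 3 (λ g a t → g :* (a :* t) := a :* g :* t) ≈-refl (θ G) (A ^ᵖ suc m₁) (T ^ᵖ suc m₁)) (suc i + n))
                 (extract (T ^ᵖ suc m₁) n)

  θG : ∀ n → θ G (suc i + n) ≡ κ ℤ.* (A⁻¹ ^ᵖ suc m₁) n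
  θG n = trans (at (≈-trans (solve-for (A ^ᵖ suc m₁) (A⁻¹ ^ᵖ suc m₁) (θ G) (A ^ᵖ suc m₁ ⊛ θ G)
                              (^ᵖ-inverse {A} {A⁻¹} (suc m₁) A⊛A⁻¹) ≈-refl)
                            (⊛-comm (A⁻¹ ^ᵖ suc m₁) (A ^ᵖ suc m₁ ⊛ θ G))) (suc i + n))
               (extract (A⁻¹ ^ᵖ suc m₁) n)

  -- Divides θG(n) = κ C(a + m₁, m₁) by n through `C-exchange`; the resulting product of binomials
  -- shows the parity of G(n) when a high power of 2 divides n.
  G-coefficient : ∀ a → let d = m₁ ∸ suc i ; n = a + suc i in
                  G n ≡ B⁻¹ i ℤ.* + (((n + d) C d) * ((a + i) C i))
  G-coefficient a = ℤ.*-cancelˡ-≡ (+ n) _ _ {{n≢0}} (begin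
    + n ℤ.* G n
      ≡⟨ cong (λ k → θ G k) (ℕ.+-comm a (suc i)) ⟩
    θ G (suc i + a)
      ≡⟨ θG a ⟩
    (+ m₁ ℤ.- + i) ℤ.* (A ^ᵖ m₁) i ℤ.* (A⁻¹ ^ᵖ suc m₁) a
      ≡⟨ cong₂ ℤ._*_ (cong₂ ℤ._*_ difference (A^-coefficient m₁ i)) (A⁻¹^ m₁ a) ⟩
    + suc d ℤ.* (B⁻¹ i ℤ.* + (m₁ C i)) ℤ.* + ((a + m₁) C m₁)
      ≡⟨ regroup (+ suc d) (B⁻¹ i) (+ (m₁ C i)) (+ ((a + m₁) C m₁)) ⟩
    B⁻¹ i ℤ.* (+ suc d ℤ.* + (m₁ C i) ℤ.* + ((a + m₁) C m₁))
      ≡⟨ cong (λ z → B⁻¹ i ℤ.* z) (trans (cong (ℤ._* + ((a + m₁) C m₁)) (sym (ℤ.pos-* (suc d) (m₁ C i))))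
           (trans (sym (ℤ.pos-* (suc d * (m₁ C i)) ((a + m₁) C m₁))) (trans (cong +_ naturals) (ℤ.pos-* n γ)))) ⟩
    B⁻¹ i ℤ.* (+ n ℤ.* + γ)
      ≡⟨ swap (B⁻¹ i) (+ n) (+ γ) ⟩
    + n ℤ.* (B⁻¹ i ℤ.* + γ) ∎)
    where
    open ≡-Reasoning
    d n γ : ℕ
    d = m₁ ∸ suc i
    n = a + suc i
    γ = ((n + d) C d) * ((a + i) C i)
    n≢0 : ℤ.NonZero (+ n)
    n≢0 = subst (λ k → ℤ.NonZero (+ k)) (sym (ℕ.+-suc a i)) _
    regroup : ∀ d s c e → d ℤ.* (s ℤ.* c) ℤ.* e ≡ s ℤ.* (d ℤ.* c ℤ.* e)
    regroup = solve-∀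
    swap : ∀ a b c → a ℤ.* (b ℤ.* c) ≡ b ℤ.* (a ℤ.* c)
    swap = solve-∀
    m₁≡ : i + suc d ≡ m₁
    m₁≡ = trans (ℕ.+-suc i d) (ℕ.m+[n∸m]≡n i<m₁)
    difference : + m₁ ℤ.- + i ≡ + suc d
    difference = trans (cong (λ k → + k ℤ.- + i) (sym m₁≡))
      (trans (cong (ℤ._- + i) (ℤ.pos-+ i (suc d))) (cancel (+ i) (+ suc d)))
      where
      cancel : ∀ a b → (a ℤ.+ b) ℤ.- a ≡ b
      cancel = solve-∀
    naturals : suc d * (m₁ C i) * ((a + m₁) C m₁) ≡ n * γ
    naturals = subst (λ m₁ → suc d * (m₁ C i) * ((a + m₁) C m₁) ≡ n * γ) m₁≡ (begin
      suc d * ((i + suc d) C i) * ((a + (i + suc d)) C (i + suc d))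
        ≡⟨ cong (_* ((a + (i + suc d)) C (i + suc d))) (C-absorb-left i d) ⟩
      (i + suc d) * ((i + d) C i) * ((a + (i + suc d)) C (i + suc d))
        ≡⟨ reorder (i + suc d) ((i + d) C i) ((a + (i + suc d)) C (i + suc d)) ⟩
      (i + suc d) * ((a + (i + suc d)) C (i + suc d)) * ((i + d) C i)
        ≡⟨ C-exchange a i d ⟩
      n * γ ∎)
      where
      reorder : ∀ x y z → x * y * z ≡ x * z * y
      reorder = ℕ-solver.solve-∀

odd-multiple-trans : ∀ c₂ c₁ K u v z → + c₁ ℤ.* u ≡ + 2 ℤ.* v → + c₂ ℤ.* v ≡ + (2 ^ K) ℤ.* z →
  + (c₂ * c₁) ℤ.* u ≡ + (2 ^ suc K) ℤ.* z
odd-multiple-trans c₂ c₁ K u v z c₁u≡2v c₂v≡2^Kz = begin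
  + (c₂ * c₁) ℤ.* u              ≡⟨ cong (ℤ._* u) (ℤ.pos-* c₂ c₁) ⟩
  (+ c₂ ℤ.* + c₁) ℤ.* u          ≡⟨ ℤ.*-assoc (+ c₂) (+ c₁) u ⟩
  + c₂ ℤ.* (+ c₁ ℤ.* u)          ≡⟨ cong (+ c₂ ℤ.*_) c₁u≡2v ⟩
  + c₂ ℤ.* (+ 2 ℤ.* v)           ≡⟨ swap (+ c₂) (+ 2) v ⟩
  + 2 ℤ.* (+ c₂ ℤ.* v)           ≡⟨ cong (+ 2 ℤ.*_) c₂v≡2^Kz ⟩
  + 2 ℤ.* (+ (2 ^ K) ℤ.* z)      ≡⟨ ℤ.*-assoc (+ 2) (+ (2 ^ K)) z ⟨
  + 2 ℤ.* + (2 ^ K) ℤ.* z        ≡⟨ cong (ℤ._* z) (ℤ.pos-* 2 (2 ^ K)) ⟨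
  + (2 ^ suc K) ℤ.* z            ∎
  where
  open ≡-Reasoning
  swap : ∀ a b c → a ℤ.* (b ℤ.* c) ≡ b ℤ.* (a ℤ.* c)
  swap = solve-∀

-- Comparison of the valuations of tₘ(n) and b(n).

module Valuation (s m₁ w : ℕ) (m≡3*2^r : suc m₁ ≡ 3 * 2 ^ suc s) (Q≡3+w : 2 ^ suc s ≡ 3 + w) where

  open Thirds s m₁ m≡3*2^r
  open Descent s m₁ w m≡3*2^r Q≡3+w

  V≋ : V m ≋ 𝟙 [ + (2 ^ suc r) ]
  V≋ = V≋𝟙 m (subst (λ k → ƛ ^ᵖ k ≋ 𝟙 [ + (2 ^ suc r) ]) (sym m≡3*2^r) (ƛ^3*2^ r))

  b : ℕ → ℕ
  b n = (n + m₁) C m₁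

  t≃b : ∀ n → t m n ≃ + b n [ + (2 ^ suc r) ]
  t≃b n = at≋ (begin
    T ^ᵖ m               ≈⟨ ≋-reflexive (T^m≈ m) ⟩
    A⁻¹ ^ᵖ m ⊛ V m       ≈⟨ ≋-⊛ (≋-refl {f = A⁻¹ ^ᵖ m}) V≋ ⟩
    A⁻¹ ^ᵖ m ⊛ 𝟙         ≈⟨ ≋-reflexive (≈-trans (⊛-comm (A⁻¹ ^ᵖ m) 𝟙) (⊛-identityˡ (A⁻¹ ^ᵖ m))) ⟩
    A⁻¹ ^ᵖ m             ≈⟨ ≋-reflexive (pointwise (A⁻¹^ m₁)) ⟩
    (λ n → + b n)        ∎) n
    where open ≋-Reasoning (+ (2 ^ suc r))

  -- V(x) = ƛᵐ V(x²), and V(x²) leaves U as V(x), so the halving step acts on θG alone.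
  descend : ∀ {c G G′} → + c • U (ƛ ^ᵖ m ⊛ θ G) ≈ + 2 • θ G′ →
            ∀ n → + c ℤ.* (θ G ⊛ V m) (2 * n) ≡ + 2 ℤ.* (θ G′ ⊛ V m) n
  descend {c} {G} {G′} cU≈2θ n = trans (cong (+ c ℤ.*_) (sym (U-at (θ G ⊛ V m) n))) (at (begin
    + c • U (θ G ⊛ V m)
      ≈⟨ •-cong (+ c) (U-cong (⊛-congˡ (θ G) (V-functional m))) ⟩
    + c • U (θ G ⊛ (ƛ ^ᵖ m ⊛ σ (V m)))
      ≈⟨ •-cong (+ c) (U-cong (solve 3 (λ g l v → g :* (l :* v) := v :* (l :* g)) ≈-refl (θ G) (ƛ ^ᵖ m) (σ (V m)))) ⟩
    + c • U (σ (V m) ⊛ (ƛ ^ᵖ m ⊛ θ G))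
      ≈⟨ •-cong (+ c) (U-σ (V m) (ƛ ^ᵖ m ⊛ θ G)) ⟩
    + c • (V m ⊛ U (ƛ ^ᵖ m ⊛ θ G))
      ≈⟨ ⊛-• (+ c) (V m) (U (ƛ ^ᵖ m ⊛ θ G)) ⟨
    V m ⊛ (+ c • U (ƛ ^ᵖ m ⊛ θ G))
      ≈⟨ ⊛-congˡ (V m) cU≈2θ ⟩
    V m ⊛ (+ 2 • θ G′)
      ≈⟨ ⊛-• (+ 2) (V m) (θ G′) ⟩
    + 2 • (V m ⊛ θ G′)
      ≈⟨ •-cong (+ 2) (⊛-comm (V m) (θ G′)) ⟩
    + 2 • (θ G′ ⊛ V m) ∎) n)
    where open ≈-Reasoning

  2∣2^1+r : + 2 ℤ.∣ + (2 ^ suc r)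
  2∣2^1+r = ℤ.∣ᵤ⇒∣ {+ 2} {+ (2 ^ suc r)} (ℕ.m∣m*n (2 ^ r))

  Divisible : ℕ → ℕ → ℤ⟦x⟧ → Set
  Divisible K N G = ∃ λ c → Odd c × ∃ λ z →
    + c ℤ.* (θ G ⊛ V m) (2 ^ K * N) ≡ + (2 ^ K) ℤ.* z × z ≃ + N ℤ.* G (2 ^ K * N) [ + 2 ]

  θG⊛V≋θG : ∀ G → θ G ⊛ V m ≋ θ G [ + 2 ]
  θG⊛V≋θG G = begin
    θ G ⊛ V m    ≈⟨ ≋-⊛ (≋-refl {f = θ G}) (pointwise λ n → ≃-weaken 2∣2^1+r (at≋ V≋ n)) ⟩
    θ G ⊛ 𝟙      ≈⟨ ≋-reflexive (≈-trans (⊛-comm (θ G) 𝟙) (⊛-identityˡ (θ G))) ⟩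
    θ G          ∎
    where open ≋-Reasoning (+ 2)

  -- For K = 0 the congruence V ≡ 1 modulo 2 suffices. A halving step multiplies c by another odd
  -- number and keeps the parity of z, since G′(2^K N) ≡ G(2^(K + 1) N).
  divisible : ∀ K N {G} → Balanced G → Divisible K N G
  divisible zero    N {G} _ = 2 ^ 0 , (λ 2∣1 → contradiction (ℕ.∣⇒≤ 2∣1) λ { (s≤s ()) }) , (θ G ⊛ V m) (2 ^ 0 * N) , refl ,
    subst (λ k → (θ G ⊛ V m) k ≃ + N ℤ.* G k [ + 2 ]) (sym (ℕ.*-identityˡ N)) (at≋ (θG⊛V≋θG G) N)
  divisible (suc K) N {G} G-balanced = compose (balanced-descent G-balanced)
    where
    n : ℕ
    n = 2 ^ K * N
    2n≡ : 2 ^ suc K * N ≡ 2 * n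
    2n≡ = ℕ.*-assoc 2 (2 ^ K) N
    compose : (∃ λ c → Odd c × ∃ λ G′ →
      Balanced G′ × (+ c • U (ƛ ^ᵖ m ⊛ θ G) ≈ + 2 • θ G′) × G′ ≋ U G [ + 2 ]) → Divisible (suc K) N G
    compose (c₁ , odd-c₁ , G′ , G′-balanced , cU≈2θ , G′≋UG) = extend (divisible K N G′-balanced)
      where
      extend : Divisible K N G′ → Divisible (suc K) N G
      extend (c₂ , odd-c₂ , z , c₂W≡2^Kz , z≃NG′) = c₂ * c₁ , odd-* odd-c₂ odd-c₁ , z
        , trans (cong (λ k → + (c₂ * c₁) ℤ.* (θ G ⊛ V m) k) 2n≡)
                (odd-multiple-trans c₂ c₁ K ((θ G ⊛ V m) (2 * n)) ((θ G′ ⊛ V m) n) z (descend {c₁} {G} {G′} cU≈2θ n) c₂W≡2^Kz)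
        , ≃-trans z≃NG′ (≃-* (≃-refl {a = + N}) (≃-trans (at≋ G′≋UG n)
            (≃-reflexive (trans (U-at G n) (cong G (sym 2n≡))))))

  m<2^2+r : m < 2 ^ (2 + r)
  m<2^2+r = subst (_< 2 ^ (2 + r)) (sym m≡3*2^r)
    (subst (3 * 2 ^ r <_) (ℕ.*-assoc 2 2 (2 ^ r)) (ℕ.*-monoˡ-< (2 ^ r) {{ℕ.m^n≢0 2 r}} {3} {4} ℕ.≤-refl))

  ν₂-near-multiple : ∀ n i → i < m₁ → 2 ^ (2 + r) ℕ.∣ n + suc i → ν₂ (t m n) ≡ ν₂ (+ b n)
  ν₂-near-multiple n i i<m₁ 2^∣N′ with 2-adic (n + suc i) (ℕ.≤-trans (s≤s z≤n) (ℕ.m≤n+m (suc i) n))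
  ... | K , N , odd-N , N′≡ = conclude (divisible K N G-balanced)
    where
    open Truncation m₁ i i<m₁
    N′ : ℕ
    N′ = n + suc i

    G-balanced : Balanced G
    G-balanced = record
      { polynomial = λ l m≤l → trans (at A^m₁⊛G l) (P-> (ℕ.<-trans i<m₁ m≤l))
      ; balance    = ≃-trans (Σ<-≃ Q middle) (≃-reflexive (Σ<-zero Q)) }
      where
      -- For the initial G each middle coefficient is even by itself, being 0 or C(m₁, Q + e) up to
      -- sign.
      middle : ∀ e → e < Q → (A ^ᵖ m₁ ⊛ G) (Q + e) ≃ 0ℤ [ + 2 ]
      middle e e<Q = ≃-trans (≃-reflexive (at A^m₁⊛G (Q + e))) (cases (Q + e ℕ.≤? i))
        where
        cases : Dec (Q + e ≤ i) → P (Q + e) ≃ 0ℤ [ + 2 ]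
        cases (yes l≤i) = ≃-trans (≃-reflexive (trans (P-≤ l≤i) (A^-coefficient m₁ (Q + e))))
          (≃-trans (≃-* (≃-refl {a = B⁻¹ (Q + e)}) (even⇒≃0 (proj₁ (C-middle e e<Q))))
                   (≃-reflexive (ℤ.*-zeroʳ (B⁻¹ (Q + e)))))
        cases (no l≰i)  = ≃-reflexive (P-> (ℕ.≰⇒> l≰i))

    -- Both lower indices, m₁ - (i + 1) and i, stay below m < 2^(r + 2), and 2^(r + 2) divides N′.
    G-odd : G N′ ≃ 1ℤ [ + 2 ]
    G-odd = ≃-trans (≃-reflexive (G-coefficient n)) (≃-* (B⁻¹-odd i) (odd⇒≃1 (odd-*
      (C-multiset-odd {2 + r} 2^∣N′ (m₁ ∸ suc i) (ℕ.≤-<-trans (ℕ.m∸n≤m m₁ (suc i)) (ℕ.<-trans (ℕ.n<1+n m₁) m<2^2+r)))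
      (C-pred-odd {2 + r} 2^∣N′ (n + i) i (ℕ.+-suc n i) (ℕ.<-trans i<m₁ (ℕ.<-trans (ℕ.n<1+n m₁) m<2^2+r))))))

    conclude : Divisible K N G → ν₂ (t m n) ≡ ν₂ (+ b n)
    -- κ can be even, so it is cancelled rather than evaluated: c N G(N′) tₘ(n) = z b(n), with odd
    -- multipliers on both sides.
    conclude (c , odd-c , z , cW≡2^Kz , z≃NG) = ν₂-unit (+ c ℤ.* (+ N ℤ.* G N′)) z (t m n) (+ b n)
      (≃-* (odd⇒≃1 odd-c) NG≃1) z≃1 (ℤ.*-cancelˡ-≡ κ _ _ {{ℤ.≢-nonZero κ≢0}} (begin
        κ ℤ.* (+ c ℤ.* (+ N ℤ.* G N′) ℤ.* t m n)
          ≡⟨ regroup₁ κ (+ c) (+ N ℤ.* G N′) (t m n) ⟩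
        (+ c ℤ.* (κ ℤ.* t m n)) ℤ.* (+ N ℤ.* G N′)
          ≡⟨ cong (ℤ._* (+ N ℤ.* G N′)) cκt≡2^Kz ⟩
        (+ (2 ^ K) ℤ.* z) ℤ.* (+ N ℤ.* G N′)
          ≡⟨ regroup₂ (+ (2 ^ K)) z (+ N) (G N′) ⟩
        z ℤ.* ((+ (2 ^ K) ℤ.* + N) ℤ.* G N′)
          ≡⟨ cong (λ k → z ℤ.* (k ℤ.* G N′)) (trans (sym (ℤ.pos-* (2 ^ K) N)) (cong +_ (sym N′≡))) ⟩
        z ℤ.* θ G N′
          ≡⟨ cong (z ℤ.*_) (trans (cong (θ G) (ℕ.+-comm n (suc i))) (trans (θG n) (cong (κ ℤ.*_) (A⁻¹^ m₁ n)))) ⟩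
        z ℤ.* (κ ℤ.* + b n)
          ≡⟨ swap z κ (+ b n) ⟩
        κ ℤ.* (z ℤ.* + b n) ∎))
      where
      open ≡-Reasoning
      regroup₁ : ∀ k c g t → k ℤ.* (c ℤ.* g ℤ.* t) ≡ (c ℤ.* (k ℤ.* t)) ℤ.* g
      regroup₁ = solve-∀
      regroup₂ : ∀ q z n g → (q ℤ.* z) ℤ.* (n ℤ.* g) ≡ z ℤ.* ((q ℤ.* n) ℤ.* g)
      regroup₂ = solve-∀
      swap : ∀ a b c → a ℤ.* (b ℤ.* c) ≡ b ℤ.* (a ℤ.* c)
      swap = solve-∀
      NG≃1 : + N ℤ.* G N′ ≃ 1ℤ [ + 2 ]
      NG≃1 = ≃-* (odd⇒≃1 odd-N) G-odd
      z≃1 : z ≃ 1ℤ [ + 2 ]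
      z≃1 = ≃-trans z≃NG (subst (λ k → + N ℤ.* G k ≃ 1ℤ [ + 2 ]) N′≡ NG≃1)
      cκt≡2^Kz : + c ℤ.* (κ ℤ.* t m n) ≡ + (2 ^ K) ℤ.* z
      cκt≡2^Kz = trans (cong (+ c ℤ.*_) (trans (sym (θG⊛V n))
        (cong (θ G ⊛ V m) (trans (ℕ.+-comm (suc i) n) N′≡)))) cW≡2^Kz
      -- z is odd, and κ = 0 would make it 0.
      κ≢0 : κ ≢ 0ℤ
      κ≢0 κ≡0 = 1≄0 (≃-trans (≃-sym z≃1) (≃-reflexive z≡0))
        where
        zero-product : ∀ c t → c ℤ.* (0ℤ ℤ.* t) ≡ 0ℤ
        zero-product = solve-∀
        z≡0 : z ≡ 0ℤ
        z≡0 = ℤ.*-cancelˡ-≡ (+ (2 ^ K)) z 0ℤ {{ℕ.m^n≢0 2 K}} (trans (sym cκt≡2^Kz)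
          (trans (cong (λ k → + c ℤ.* (k ℤ.* t m n)) κ≡0)
                 (trans (zero-product (+ c) (t m n)) (sym (ℤ.*-zeroʳ (+ (2 ^ K)))))))

  -- Passing from e to e + 1 adds C(x, m₁) with x = N + e + m. It is even, because m C(x, m) = (N +
  -- e + 1) C(x, m₁) and 2^r divides m but not N + e + 1.
  C-after-multiple-odd : ∀ N e → 2 ^ (2 + r) ℕ.∣ N → e < Q → Odd ((N + e + m) C m)
  C-after-multiple-odd N zero    2^∣N _ = subst (λ k → Odd ((k + m) C m)) (sym (ℕ.+-identityʳ N))
    (C-multiset-odd {2 + r} 2^∣N m m<2^2+r)
  C-after-multiple-odd N (suc e) 2^∣N 1+e<Q 2∣C = C-after-multiple-odd N e 2^∣N (ℕ.<-trans (ℕ.n<1+n e) 1+e<Q)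
    (ℕ.∣m+n∣m⇒∣n (subst (2 ℕ.∣_) recurrence 2∣C) even)
    where
    x : ℕ
    x = N + e + m
    recurrence : (N + suc e + m) C m ≡ (x C m₁) + (x C m)
    recurrence = trans (cong (λ k → (k + m) C m) (ℕ.+-suc N e)) (sym (nCk+nC[k+1]≡[n+1]C[k+1] x m₁))
    ∤ : ¬ 2 ^ suc s ℕ.∣ suc (N + e)
    ∤ d = ℕ.>⇒∤ 1+e<Q (ℕ.∣m+n∣m⇒∣n (subst (2 ^ r ℕ.∣_) (sym (ℕ.+-suc N e)) d) (ℕ.∣-trans (2^-mono-∣ (ℕ.m≤n+m r 2)) 2^∣N))
    absorb : m * (x C m) ≡ suc (N + e) * (x C m₁)
    absorb = trans (cong (λ k → m * (k C m)) (ℕ.+-suc (N + e) m₁))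
      (trans (C-absorb-top (N + e) m₁) (cong (λ k → suc (N + e) * (k C m₁)) (sym (ℕ.+-suc (N + e) m₁))))
    even : 2 ℕ.∣ x C m₁
    even = 2^-cancel s 1 ∤ (subst₂ ℕ._∣_ (cong (2 ^_) (ℕ.+-comm 1 s)) absorb (ℕ.∣m⇒∣m*n (x C m) Q∣m))

  2^1+r∤m : ¬ 2 ^ suc r ℕ.∣ m
  2^1+r∤m d = from-no (2 ℕ.∣? 3)
    (ℕ.*-cancelʳ-∣ {2} {3} (2 ^ r) {{ℕ.m^n≢0 2 r}} (subst (2 * 2 ^ r ℕ.∣_) m≡3*2^r d))

  -- b(N) is odd. For ρ = e + 1 absorption gives (N + ρ) b(N + ρ) = m C(N + e + m, m), where the
  -- binomial is odd and 2^(r + 1) does not divide m.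
  2^1+r∤b : ∀ N ρ → 2 ^ (2 + r) ℕ.∣ N → ρ ≤ Q → ¬ 2 ^ suc r ℕ.∣ b (N + ρ)
  2^1+r∤b N zero    2^∣N _   d = subst (λ k → Odd (b k)) (sym (ℕ.+-identityʳ N))
    (C-multiset-odd {2 + r} 2^∣N m₁ (ℕ.<-trans (ℕ.n<1+n m₁) m<2^2+r)) (ℕ.∣-trans (ℕ.m∣m*n (2 ^ r)) d)
  2^1+r∤b N (suc e) 2^∣N e<Q d = 2^1+r∤m (2^-cancel-odd (suc r) {(N + e + m) C m} {m} (C-after-multiple-odd N e 2^∣N e<Q)
    (subst (2 ^ suc r ℕ.∣_) absorb (ℕ.∣n⇒∣m*n (suc (N + e)) d)))
    where
    absorb : suc (N + e) * b (N + suc e) ≡ ((N + e + m) C m) * m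
    absorb = begin
      suc (N + e) * b (N + suc e)            ≡⟨ cong (λ k → suc (N + e) * ((k + m₁) C m₁)) (ℕ.+-suc N e) ⟩
      suc (N + e) * ((suc (N + e) + m₁) C m₁) ≡⟨ C-absorb-top (N + e) m₁ ⟨
      m * ((suc (N + e) + m₁) C m)           ≡⟨ cong (λ k → m * (k C m)) (ℕ.+-suc (N + e) m₁) ⟨
      m * ((N + e + m) C m)                  ≡⟨ ℕ.*-comm m ((N + e + m) C m) ⟩
      ((N + e + m) C m) * m                  ∎
      where open ≡-Reasoning

  ν₂-after-multiple : ∀ N ρ → 2 ^ (2 + r) ℕ.∣ N → ρ ≤ Q → ν₂ (t m (N + ρ)) ≡ ν₂ (+ b (N + ρ))
  ν₂-after-multiple N ρ 2^∣N ρ≤Q = ν₂-≃ (suc r) (t m (N + ρ)) (+ b (N + ρ)) (t≃b (N + ρ)) (2^1+r∤b N ρ 2^∣N ρ≤Q)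

  private instance
    2^2+r≢0 : NonZero (2 ^ (2 + r))
    2^2+r≢0 = ℕ.m^n≢0 2 (2 + r)

  ν₂-t : ∀ n → ν₂ (t m n) ≡ ν₂ (+ b n)
  ν₂-t n with n % 2 ^ (2 + r) ℕ.≤? Q
  ... | yes ρ≤Q = subst (λ n → ν₂ (t m n) ≡ ν₂ (+ b n)) (trans (ℕ.+-comm _ (n % 2 ^ (2 + r))) (sym (ℕ.m≡m%n+[m/n]*n n (2 ^ (2 + r)))))
    (ν₂-after-multiple (n / 2 ^ (2 + r) * 2 ^ (2 + r)) (n % 2 ^ (2 + r)) (ℕ.n∣m*n (n / 2 ^ (2 + r))) ρ≤Q)
  ... | no ρ≰Q with m≤n⇒∃[o]o+m≡n (ℕ.m%n<n n (2 ^ (2 + r)))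
  ... | i , i+1+ρ≡2^ = ν₂-near-multiple n i i<m₁ (ℕ.divides (suc (n / 2 ^ (2 + r))) (begin
      n + suc i
        ≡⟨ cong (_+ suc i) (ℕ.m≡m%n+[m/n]*n n (2 ^ (2 + r))) ⟩
      n % 2 ^ (2 + r) + n / 2 ^ (2 + r) * 2 ^ (2 + r) + suc i
        ≡⟨ regroup (n % 2 ^ (2 + r)) (n / 2 ^ (2 + r) * 2 ^ (2 + r)) i ⟩
      i + suc (n % 2 ^ (2 + r)) + n / 2 ^ (2 + r) * 2 ^ (2 + r)
        ≡⟨ cong (_+ n / 2 ^ (2 + r) * 2 ^ (2 + r)) i+1+ρ≡2^ ⟩
      suc (n / 2 ^ (2 + r)) * 2 ^ (2 + r) ∎))
    where
    open ≡-Reasoning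
    regroup : ∀ ρ k i → ρ + k + suc i ≡ i + suc ρ + k
    regroup = ℕ-solver.solve-∀
    -- As 2^(r + 2) = Q + m, a residue above Q is less than m away from the next multiple.
    four : 2 ^ (2 + r) ≡ Q + m
    four = trans (split Q) (cong (_+_ Q) (sym m≡3*2^r))
      where
      split : ∀ q → 2 * (2 * q) ≡ q + 3 * q
      split = ℕ-solver.solve-∀
    i<m₁ : i < m₁
    i<m₁ = ℕ.+-cancelˡ-< (suc Q) i m₁ (R.begin-strict
      suc Q + i                       R.≡⟨ ℕ.+-comm (suc Q) i ⟩
      i + suc Q                       R.<⟨ ℕ.+-monoʳ-< i (s≤s (ℕ.≰⇒> ρ≰Q)) ⟩
      i + suc (n % 2 ^ (2 + r))       R.≡⟨ trans i+1+ρ≡2^ four ⟩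
      Q + m                           R.≡⟨ ℕ.+-suc Q m₁ ⟩
      suc Q + m₁                      R.∎)
      where module R = ℕ.≤-Reasoning

theorem1p2 : ∀ (r : ℕ) → 2 ≤ r →
    let m = 3 * 2 ^ r in
    ∀ (n : ℕ) → ν₂ (t m n) ≡ ν₂ (+ ((n + m ∸ 1) C (m ∸ 1)))
theorem1p2 (suc zero)            (s≤s ()) n
-- r ≥ 2 gives 2^r ≥ 4, so w = 2^r - 3 exists.
theorem1p2 r@(suc s@(suc _)) _        n with m≤n⇒∃[o]o+m≡n (ℕ.≤-trans (ℕ.n≤1+n 3) (ℕ.^-monoʳ-≤ 2 {2} {r} (s≤s (s≤s z≤n))))
... | w , w+3≡2^r = subst (λ m → ν₂ (t m n) ≡ ν₂ (+ ((n + m ∸ 1) C (m ∸ 1)))) m≡3*2^r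
    (trans (Valuation.ν₂-t s m₁ w m≡3*2^r (trans (sym w+3≡2^r) (ℕ.+-comm w 3)) n)
           (cong (λ k → ν₂ (+ ((k ∸ 1) C m₁))) (sym (ℕ.+-suc n m₁))))
  where
  m₁ : ℕ
  m₁ = 3 * 2 ^ r ∸ 1
  m≡3*2^r : suc m₁ ≡ 3 * 2 ^ r
  m≡3*2^r = ℕ.m+[n∸m]≡n (ℕ.≤-trans (ℕ.m^n>0 2 r) (ℕ.m≤n*m (2 ^ r) 3))
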